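{- For any graphs $G$ and $G'$ on the same vertex set, $d(|G\rangle, |G'\rangle)=d(G,G')$, where the left-hand side is the ancilla distance between graph states and the right-hand side is the vertex-minor distance between graphs.
   Context: Graphs are finite, simple and undirected. For a graph $G$ on vertex set $V$, the graph state $|G\rangle$ on the qubit set $V$ is (up to normalization) $|G\rangle=\sum_{X\subseteq V}(-1)^{e_X}|1\rangle_X|0\rangle_{V\setminus X}$, where $e_X$ is the number of edges of the subgraph of $G$ induced by $X$. Allowed operations: one-qubit Clifford gates (one-qubit unitaries normalizing the one-qubit Pauli group), one-qubit Pauli measurements (measuring one qubit in the eigenbasis of Pauli $X$, $Y$ or $Z$; measurements are destructive, i.e. the measured qubit is removed from the system), and classical communication (later operations may depend on earlier measurement outcomes). A state can be prepared deterministically from another one with these operations if there is such a protocol which, for every sequence of measurement outcomes that can occur, ends in the desired state (up to a global scalar). Distance between graph states: for graphs $G,G'$ on the same vertex set $V$, $d(|G\rangle,|G'\rangle)$ is the minimum of $|A|$ over all graph states $|\widehat G\rangle$ on a disjoint union $V\cup A$ (the qubits in $A$ are called ancilla qubits) from which each of $|G\rangle$ and $|G'\rangle$ can be prepared deterministically using only one-qubit Clifford gates, one-qubit Pauli measurements, and classical communication. Distance between graphs: locally complementing at a vertex $v$ of a graph replaces the induced subgraph on the neighborhood of $v$ by its complement. The vertex-minors of a graph are the graphs that can be obtained from it by a sequence of vertex deletions and local complementations. For graphs $G,G'$ on the same $n$-element vertex set, $d(G,G')$ is the minimum integer $k$ such that there exists a graph on $n+k$ vertices (whose vertex set contains $V(G)$)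 which contains both $G$ and $G'$ as vertex-minors. -}

module Defs where

open import Algebra.Apartness.Bundles using (HeytingField)
open import Algebra.Bundles using (RawRing; module CommutativeRing)
open import Algebra.Morphism.Structures using (IsRingHomomorphism)
import Algebra.Definitions.RawSemiring as RawSemiringOps
import Algebra.Properties.CommutativeMonoid.Sum as Sum
open import Data.Bool using (Bool; true; false; _∧_; _xor_; not; if_then_else_)
open import Data.Bool.Properties using (∧-comm; ∧-zeroʳ)
open import Data.Fin using (Fin; splitAt; _↑ˡ_)
open import Data.Fin.Properties using (_≟_; _<?_; splitAt⁻¹-↑ˡ)
open import Data.Fin.Subset using (Subset; inside; outside; _∈_; _⊆_; _-_; ⊤; ⊥)
open import Data.Fin.Subset.Properties using (∈⊤)
open import Data.Nat using (ℕ; suc; _+_; _≤_)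
open import Data.Nat.Properties using (+-0-commutativeMonoid)
open import Data.Product using (Σ; ∃-syntax; _×_; _,_)
open import Data.Sign using (Sign)
open import Data.Sum using (_⊎_; inj₁; inj₂)
open import Data.Vec using (lookup; _[_]≔_; _++_)
open import Data.Vec.Properties using (lookup⇒[]=; []=⇒lookup; lookup-++ˡ)
open import Level using (Level; _⊔_) renaming (suc to lsuc)
open import Relation.Binary.PropositionalEquality
  using (_≡_; refl; sym; trans; cong; cong₂; subst)
open import Relation.Nullary using (¬_; does; yes; no)
open import Relation.Nullary.Decidable using (dec-true)

IsMinimum : ∀ {ℓ} → (ℕ → Set ℓ) → ℕ → Set ℓ
IsMinimum P k = P k × (∀ j → P j → k ≤ j)

------------------------------------------------------------------------
-- Graphs

private
  ∧-trueˡ : ∀ a {b} → a ∧ b ≡ true → a ≡ true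
  ∧-trueˡ true _ = refl

  ∧-trueʳ : ∀ a {b} → a ∧ b ≡ true → b ≡ true
  ∧-trueʳ true p = p

  xor-true : ∀ a {b} → a xor b ≡ true → a ≡ true ⊎ b ≡ true
  xor-true true  _ = inj₁ refl
  xor-true false p = inj₂ p

-- A finite simple graph whose vertex set S is a subset of Fin N.
record Graph {N : ℕ} (S : Subset N) : Set where
  field
    adj    : Fin N → Fin N → Bool
    symm   : ∀ u w → adj u w ≡ adj w u
    irrefl : ∀ u → adj u u ≡ false
    adj⇒∈  : ∀ {u w} → adj u w ≡ true → u ∈ S

open Graph public

-- The subgraph of G induced by T (more precisely by S ∩ T, with the vertices
-- of T outside S added as isolated vertices; below, always T ⊆ S).
induced : ∀ {N} {S : Subset N} → Graph S → (T : Subset N) → Graph T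
induced G T = record
  { adj    = λ u w → adj G u w ∧ (lookup T u ∧ lookup T w)
  ; symm   = λ u w → cong₂ _∧_ (symm G u w) (∧-comm (lookup T u) (lookup T w))
  ; irrefl = λ u → cong (_∧ _) (irrefl G u)
  ; adj⇒∈  = λ {u} {w} p → lookup⇒[]= u T (∧-trueˡ (lookup T u) (∧-trueʳ (adj G u w) p))
  }

delete : ∀ {N} {S : Subset N} (v : Fin N) → Graph S → Graph (S - v)
delete {S = S} v G = induced G (S - v)

localComplement : ∀ {N} {S : Subset N} → Fin N → Graph S → Graph S
localComplement {N} {S} v G = record
  { adj    = λ u w → adj G u w xor toggled u w
  ; symm   = λ u w → cong₂ _xor_ (symm G u w) (toggled-symm u w)
  ; irrefl = λ u → cong₂ _xor_ (irrefl G u) (toggled-irrefl u)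
  ; adj⇒∈  = λ {u} {w} p → support u w (xor-true (adj G u w) p)
  }
  where
  toggled : Fin N → Fin N → Bool
  toggled u w = (adj G v u ∧ adj G v w) ∧ not (does (u ≟ w))

  does-symm : ∀ u w → does (u ≟ w) ≡ does (w ≟ u)
  does-symm u w with u ≟ w | w ≟ u
  ... | yes _ | yes _ = refl
  ... | no  _ | no  _ = refl
  ... | yes p | no ¬q with () ← ¬q (sym p)
  ... | no ¬p | yes q with () ← ¬p (sym q)

  toggled-symm : ∀ u w → toggled u w ≡ toggled w u
  toggled-symm u w =
    cong₂ _∧_ (∧-comm (adj G v u) (adj G v w)) (cong not (does-symm u w))

  toggled-irrefl : ∀ u → toggled u u ≡ false
  toggled-irrefl u = trans
    (cong (λ b → (adj G v u ∧ adj G v u) ∧ not b) (dec-true (u ≟ u) refl))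
    (∧-zeroʳ (adj G v u ∧ adj G v u))

  support : ∀ u w → adj G u w ≡ true ⊎ toggled u w ≡ true → u ∈ S
  support u w (inj₁ p) = adj⇒∈ G p
  support u w (inj₂ p) = adj⇒∈ G (trans (symm G u v)
    (∧-trueˡ (adj G v u) (∧-trueˡ (adj G v u ∧ adj G v w) p)))

data _IsVertexMinorOf_ {N} {T : Subset N} (H : Graph T) :
                       {S : Subset N} → Graph S → Set where
  equal      : ∀ {S} {G : Graph S} → S ≡ T → (∀ u w → adj G u w ≡ adj H u w) →
               H IsVertexMinorOf G
  deletion   : ∀ {S} {G : Graph S} v → v ∈ S →
               H IsVertexMinorOf delete v G → H IsVertexMinorOf G
  complement : ∀ {S} {G : Graph S} v → v ∈ S →
               H IsVertexMinorOf localComplement v G → H IsVertexMinorOf G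

edgeCount : ∀ {N} {S : Subset N} → Graph S → ℕ
edgeCount {N} G =
  sum {N} λ u → sum {N} λ w → if does (u <? w) ∧ adj G u w then 1 else 0
  where open Sum +-0-commutativeMonoid using (sum)

-- V = Fin n is regarded as the first n elements of V ∪ A = Fin (n + k).
base : ∀ n k → Subset (n + k)
base n k = ⊤ {n} ++ ⊥ {k}

embed : ∀ {n} k → Graph (⊤ {n}) → Graph (base n k)
embed {n} k G = record
  { adj    = λ u w → adj′ (splitAt n u) (splitAt n w)
  ; symm   = λ u w → symm′ (splitAt n u) (splitAt n w)
  ; irrefl = λ u → irrefl′ (splitAt n u)
  ; adj⇒∈  = λ {u} {w} → support u (splitAt n u) (splitAt n w) refl
  }
  where
  adj′ : Fin n ⊎ Fin k → Fin n ⊎ Fin k → Bool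
  adj′ (inj₁ u) (inj₁ w) = adj G u w
  adj′ (inj₁ _) (inj₂ _) = false
  adj′ (inj₂ _) _        = false

  symm′ : ∀ u w → adj′ u w ≡ adj′ w u
  symm′ (inj₁ u) (inj₁ w) = symm G u w
  symm′ (inj₁ _) (inj₂ _) = refl
  symm′ (inj₂ _) (inj₁ _) = refl
  symm′ (inj₂ _) (inj₂ _) = refl

  irrefl′ : ∀ u → adj′ u u ≡ false
  irrefl′ (inj₁ u) = irrefl G u
  irrefl′ (inj₂ _) = refl

  ↑ˡ∈base : ∀ u → u ↑ˡ k ∈ base n k
  ↑ˡ∈base u = lookup⇒[]= (u ↑ˡ k) (base n k)
    (trans (lookup-++ˡ (⊤ {n}) (⊥ {k}) u) ([]=⇒lookup (∈⊤ {x = u})))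

  support : ∀ u s t → splitAt n u ≡ s → adj′ s t ≡ true → u ∈ base n k
  support u (inj₁ x) _ p _ = subst (_∈ base n k) (splitAt⁻¹-↑ˡ p) (↑ˡ∈base x)

HasCommonVertexMajor : ∀ {n} → Graph (⊤ {n}) → Graph (⊤ {n}) → ℕ → Set
HasCommonVertexMajor {n} G G′ k =
  Σ (Graph (⊤ {n + k})) λ Ĝ →
    embed k G IsVertexMinorOf Ĝ × embed k G′ IsVertexMinorOf Ĝ

GraphDistance : ∀ {n} → Graph (⊤ {n}) → Graph (⊤ {n}) → ℕ → Set
GraphDistance G G′ = IsMinimum (HasCommonVertexMajor G G′)

------------------------------------------------------------------------
-- Scalars

-- The algebraic structure of ℂ used by one-qubit Clifford gates and Pauli
-- measurements.  The library has no complex numbers, so they are replaced by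
-- an arbitrary field with this structure; ℂ itself is one.  Nonzero scalars are
-- those apart from 0#, which for ℂ (classically) means different from 0.
record ComplexField c ℓ₁ ℓ₂ : Set (lsuc (c ⊔ ℓ₁ ⊔ ℓ₂)) where
  field
    heytingField : HeytingField c ℓ₁ ℓ₂

  open HeytingField heytingField public
    renaming (_+_ to _+ᶜ_; _*_ to _*ᶜ_; -_ to -ᶜ_)

  rawRing : RawRing c ℓ₁
  rawRing = CommutativeRing.rawRing record { isCommutativeRing = isCommutativeRing }

  open RawSemiringOps (RawRing.rawSemiring rawRing) public
    using (_^_) renaming (_×_ to _×ᶜ_)

  field
    characteristic-zero : ∀ n → (suc n ×ᶜ 1#) # 0#
    conj                : Carrier → Carrier
    conj-homomorphism   : IsRingHomomorphism rawRing rawRing conj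
    conj-involutive     : ∀ x → conj (conj x) ≈ x
    i                   : Carrier
    i²≈-1               : i *ᶜ i ≈ -ᶜ 1#
    conj-i              : conj i ≈ -ᶜ i
    √2                  : Carrier
    √2²≈2               : √2 *ᶜ √2 ≈ 1# +ᶜ 1#
    conj-√2             : conj √2 ≈ √2

------------------------------------------------------------------------
-- Qubits

module Quantum {c ℓ₁ ℓ₂} (K : ComplexField c ℓ₁ ℓ₂) where
  open ComplexField K hiding (_-_; sym; trans; refl)

  -- In both indices false is |0⟩ and true is |1⟩; U row column.
  Matrix : Set c
  Matrix = Bool → Bool → Carrier

  infix 4 _≈ᴹ_
  _≈ᴹ_ : Matrix → Matrix → Set ℓ₁
  U ≈ᴹ W = ∀ a b → U a b ≈ W a b

  infixl 7 _·_
  _·_ : Matrix → Matrix → Matrix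
  (U · W) a b = (U a false *ᶜ W false b) +ᶜ (U a true *ᶜ W true b)

  infix 9 _†
  _† : Matrix → Matrix
  (U †) a b = conj (U b a)

  infixr 8 _•_
  _•_ : Carrier → Matrix → Matrix
  (x • U) a b = x *ᶜ U a b

  𝟙 : Matrix
  𝟙 false false = 1#
  𝟙 false true  = 0#
  𝟙 true  false = 0#
  𝟙 true  true  = 1#

  data Axis : Set where
    X Y Z : Axis

  σ : Axis → Matrix
  σ X false false = 0#
  σ X false true  = 1#
  σ X true  false = 1#
  σ X true  true  = 0#
  σ Y false false = 0#
  σ Y false true  = -ᶜ i
  σ Y true  false = i
  σ Y true  true  = 0#
  σ Z false false = 1#
  σ Z false true  = 0#
  σ Z true  false = 0#
  σ Z true  true  = -ᶜ 1#

  data InPauliGroup (P : Matrix) : Set ℓ₁ where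
    scalar : ∀ k   → P ≈ᴹ (i ^ k) • 𝟙   → InPauliGroup P
    pauli  : ∀ k a → P ≈ᴹ (i ^ k) • σ a → InPauliGroup P

  record IsClifford (U : Matrix) : Set (c ⊔ ℓ₁) where
    field
      U†U≈𝟙      : U † · U ≈ᴹ 𝟙
      UU†≈𝟙      : U · U † ≈ᴹ 𝟙
      normalizes : ∀ P → InPauliGroup P → InPauliGroup (U · P · U †)

  -- An unnormalized state: ψ B is the coefficient of |1⟩_B|0⟩_{S∖B}, where S
  -- is the set of qubits.  Only the values on subsets B of S are meaningful.
  State : ℕ → Set c
  State N = Subset N → Carrier

  SameRay : ∀ {N} → Subset N → State N → State N → Set (c ⊔ ℓ₁ ⊔ ℓ₂)
  SameRay S ψ φ = ∃[ x ] (x # 0# × ∀ B → B ⊆ S → ψ B ≈ x *ᶜ φ B)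

  IsZero : ∀ {N} → Subset N → State N → Set ℓ₁
  IsZero S ψ = ∀ B → B ⊆ S → ψ B ≈ 0#

  graphState : ∀ {N} {S : Subset N} → Graph S → State N
  graphState G B = (-ᶜ 1#) ^ edgeCount (induced G B)

  applyGate : ∀ {N} → Matrix → Fin N → State N → State N
  applyGate U v ψ B = (U (lookup B v) false *ᶜ ψ (B [ v ]≔ outside))
                   +ᶜ (U (lookup B v) true  *ᶜ ψ (B [ v ]≔ inside))

  signed : Sign → Carrier → Carrier
  signed Sign.+ x = x
  signed Sign.- x = -ᶜ x

  -- eigenvector a s is, up to normalization, the eigenvector of σ a with
  -- eigenvalue s.
  eigenvector : Axis → Sign → Bool → Carrier
  eigenvector X s false = 1#
  eigenvector X s true  = signed s 1#
  eigenvector Y s false = 1#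
  eigenvector Y s true  = signed s i
  eigenvector Z Sign.+ false = 1#
  eigenvector Z Sign.+ true  = 0#
  eigenvector Z Sign.- false = 0#
  eigenvector Z Sign.- true  = 1#

  -- The partial inner product of ψ with eigenvector a s on qubit v: the state
  -- of the remaining qubits after outcome s, zero iff s has probability zero.
  afterOutcome : ∀ {N} → Axis → Sign → Fin N → State N → State N
  afterOutcome a s v ψ B =
       (conj (eigenvector a s false) *ᶜ ψ (B [ v ]≔ outside))
    +ᶜ (conj (eigenvector a s true)  *ᶜ ψ (B [ v ]≔ inside))

  -- Protocols from qubit set S to qubit set T.  Classical communication is the
  -- dependence of the continuation of a measurement on its outcome.
  data Protocol {N} (T : Subset N) : Subset N → Set (c ⊔ ℓ₁) where
    stop    : ∀ {S} → S ≡ T → Protocol T S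
    gate    : ∀ {S} v → v ∈ S → (U : Matrix) → IsClifford U →
              Protocol T S → Protocol T S
    measure : ∀ {S} v → v ∈ S → Axis → (Sign → Protocol T (S - v)) → Protocol T S

  Yields : ∀ {N} {T S : Subset N} → Protocol T S → State N → State N →
           Set (c ⊔ ℓ₁ ⊔ ℓ₂)
  Yields {T = T} (stop _) ψ φ = SameRay T ψ φ
  Yields (gate v _ U _ p) ψ φ = Yields p (applyGate U v ψ) φ
  Yields {S = S} (measure v _ a p) ψ φ =
    ∀ s → ¬ IsZero (S - v) (afterOutcome a s v ψ) →
    Yields (p s) (afterOutcome a s v ψ) φ

  CanPrepare : ∀ {N} {T S : Subset N} → Graph T → Graph S → Set (c ⊔ ℓ₁ ⊔ ℓ₂)
  CanPrepare {T = T} {S} H G =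
    Σ (Protocol T S) λ p → Yields p (graphState G) (graphState H)

  HasCommonSource : ∀ {n} → Graph (⊤ {n}) → Graph (⊤ {n}) → ℕ → Set (c ⊔ ℓ₁ ⊔ ℓ₂)
  HasCommonSource {n} G G′ k =
    Σ (Graph (⊤ {n + k})) λ Ĝ →
      CanPrepare (embed k G) Ĝ × CanPrepare (embed k G′) Ĝ

StateDistance : ∀ {c ℓ₁ ℓ₂} → ComplexField c ℓ₁ ℓ₂ → ∀ {n} →
                Graph (⊤ {n}) → Graph (⊤ {n}) → ℕ → Set (c ⊔ ℓ₁ ⊔ ℓ₂)
StateDistance K G G′ = IsMinimum (Quantum.HasCommonSource K G G′)

{-# OPTIONS --safe #-}

-- |H⟩ can be prepared from |G⟩ exactly if H is a vertex-minor of G, so both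
-- distances are the minimum of one set of numbers, which is decidable and
-- nonempty.  If H is a vertex-minor of G, a local complementation at v is
-- carried out by the gates √X at v and √Z at its neighbours, and the deletion
-- of v by a measurement of Z at v with Z corrections at its neighbours.
--
-- Conversely, along a branch of nonzero probability a protocol applies a
-- one-qubit operator to every qubit, so every amplitude of |H⟩ is, up to a
-- factor, the overlap of |G⟩ with a product of Pauli eigenvectors, and the axis
-- of the eigenvector at a vertex is the same for all amplitudes.  Replacing G by
-- its local complement at v exchanges the axes Y and Z at v, and X and Y at the
-- neighbours of v.  Hence an axis Y at v can be made Z, and so can an axis X if
-- some neighbour u has an axis other than Z, by complementing at u first.  If
-- all neighbours have axis Z, they disentangle v, and its axis X can simply be
-- replaced by Z because |H⟩ has no amplitude 0.  Once all axes are Z, comparing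
-- amplitudes shows that G and H agree on the vertices of H.
module Submission where

open import Defs

import Algebra.Apartness.Properties.HeytingCommutativeRing as Apartness
open import Algebra.Apartness.Bundles using (module HeytingField)
open import Algebra.Bundles using (CommutativeRing; RawRing)
open import Algebra.Morphism.Structures using (module IsRingHomomorphism)
import Algebra.Properties.AbelianGroup as AbelianGroupProperties
import Algebra.Properties.CommutativeMonoid.Sum as Sum
import Algebra.Properties.Ring as RingProperties
import Algebra.Properties.Semiring.Mult as Mult
import Algebra.Solver.Ring as RingSolver
open import Algebra.Solver.Ring.AlmostCommutativeRing using (fromCommutativeRing; _-Raw-AlmostCommutative⟶_)
import Algebra.Solver.Ring.NaturalCoefficients.Default as SemiringSolver
open import Data.Bool using (Bool; true; false; _∧_; _∨_; _xor_; not; if_then_else_)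
import Data.Bool.Properties as Bool
open import Data.Bool.Solver using (module xor-∧-Solver)
open import Data.Empty using (⊥-elim)
open import Data.Fin using (Fin; zero; suc; splitAt; _↑ʳ_; combine; remQuot)
open import Data.Fin.Properties as Fin using (_≟_; _<?_; splitAt⁻¹-↑ˡ; splitAt-↑ʳ; remQuot-combine)
open import Data.Fin.Subset using (Subset; outside; _∈_; _⊆_; _-_; ⁅_⁆; ⊤; ⊥)
open import Data.Fin.Subset.Properties
  using (∈⊤; ∉⊥; _∈?_; Empty-unique; ⊆-antisym; p─⊥≡p; p─q⊆p; x∈p∧x≢y⇒x∈p-y)
open import Data.Integer as ℤ using (ℤ; +_; -[1+_]; _⊖_)
import Data.Integer.Properties as ℤ
open import Data.List using (List; []; _∷_; cartesianProductWith; allFin)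
open import Data.List.Membership.Propositional using (lose) renaming (_∈_ to _∈ˡ_)
open import Data.List.Membership.Propositional.Properties using (∈-cartesianProductWith⁺; ∈-allFin)
open import Data.List.Relation.Unary.Any as Any using (here; there)
open import Data.Maybe using (Maybe; just; nothing)
open import Data.Nat as ℕ using (ℕ; zero; suc; _+_; _*_; z≤n; s≤s)
open import Data.Nat.Properties using (+-0-commutativeMonoid; n<1+n)
open import Data.Product using (Σ; ∃; ∃-syntax; _×_; _,_; proj₁; proj₂)
open import Data.Sign using (Sign)
open import Data.Sum using (_⊎_; inj₁; inj₂; [_,_])
open import Data.Sum.Properties using (inj₁-injective)
open import Data.Vec using (Vec; []; _∷_; lookup; tabulate; _++_; _[_]≔_)
open import Data.Vec.Properties
  using ( lookup⇒[]=; []=⇒lookup; lookup∘tabulate; tabulate∘lookup; tabulate-cong; ≡-dec; lookup-splitAt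
        ; lookup-replicate; lookup-++ʳ; lookup∘update; lookup∘update′; []≔-lookup; []≔-idempotent)
open import Function using (_∘_; _$_; id; case_of_)
open import Level using (0ℓ; _⊔_)
open import Relation.Binary.PropositionalEquality as ≡ using (_≡_; _≢_; _≗_)
import Relation.Binary.Reasoning.Setoid as SetoidReasoning
open import Relation.Nullary using (¬_; Dec; does; yes; no; contradiction; ¬?)
open import Relation.Nullary.Decidable using (dec-true; dec-false; decidable-stable; map′; _×-dec_; _⊎-dec_)

open xor-∧-Solver using () renaming (solve to xor-solve; _:+_ to _:⊕_; _:*_ to _:∧_; _:=_ to _:≡_)

-- In an abstract field it cannot be decided which outcomes have nonzero probability, so following a
-- possible branch yields the vertex-minor only under a double negation. Decidability of the finite
-- vertex-minor relation removes it; the same decidability turns nonemptiness into the existence of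
-- a minimum. Nonemptiness comes from one ancilla for every pair of vertices, joined to the two:
-- deleting it leaves the pair alone, complementing at it first toggles the pair.
--
-- Of the operator gathered at a qubit only the effect on the lines spanned by Pauli eigenvectors is
-- kept: an axis, a sign and an unspecified nonzero factor. This suffices because the final
-- comparison takes a mixed second difference of edge parities, in which the signs merely translate
-- the argument and the factors cancel.
--
-- The explicit gates and eigenvectors are, up to a scalar, matrices of Gaussian integers.
-- Identities between them then hold by evaluation, and a Gaussian integer of positive norm is
-- invertible by characteristic zero.

private
  variable
    N n k : ℕ
    S S′ S″ T : Subset N

-- Subsets

∈⇒true : ∀ {v : Fin N} → v ∈ S → lookup S v ≡ true
∈⇒true = []=⇒lookup

true⇒∈ : ∀ {v : Fin N} → lookup S v ≡ true → v ∈ S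
true⇒∈ {S = S} {v} = lookup⇒[]= v S

false⇒∉ : ∀ {v : Fin N} → lookup S v ≡ false → ¬ v ∈ S
false⇒∉ p m with () ← ≡.trans (≡.sym p) (∈⇒true m)

∉⇒false : ∀ {v : Fin N} → ¬ v ∈ S → lookup S v ≡ false
∉⇒false {S = S} {v} p with lookup S v in eq
... | true  = contradiction (true⇒∈ eq) p
... | false = ≡.refl

lookup-- : ∀ (S : Subset N) v w → lookup (S - v) w ≡ lookup S w ∧ not (does (v ≟ w))
lookup-- (b ∷ S) zero    zero    = ≡.sym (Bool.∧-zeroʳ b)
lookup-- (b ∷ S) zero    (suc w) =
  ≡.trans (≡.cong (λ S → lookup S w) (p─⊥≡p S)) (≡.sym (Bool.∧-identityʳ _))
lookup-- (b ∷ S) (suc v) zero    = ≡.sym (Bool.∧-identityʳ b)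
lookup-- (b ∷ S) (suc v) (suc w) = lookup-- S v w

x∉p-x : ∀ (v : Fin N) → ¬ v ∈ S - v
x∉p-x {S = S} v = false⇒∉ (≡.trans (lookup-- S v v)
  (≡.trans (≡.cong (λ b → lookup S v ∧ not b) (dec-true (v ≟ v) ≡.refl)) (Bool.∧-zeroʳ _)))

p-x⊆p : ∀ (v : Fin N) → S - v ⊆ S
p-x⊆p {S = S} v = p─q⊆p S ⁅ v ⁆

++-- : ∀ (S : Subset n) (T : Subset k) a → (S ++ T) - (n ↑ʳ a) ≡ S ++ (T - a)
++-- []      T a = ≡.refl
++-- (b ∷ S) T a = ≡.cong (b ∷_) (++-- S T a)

adj⇒∈ʳ : ∀ (G : Graph S) {u w} → adj G u w ≡ true → w ∈ S
adj⇒∈ʳ G {u} {w} p = adj⇒∈ G (≡.trans (symm G w u) p)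

adj⇒≢ : ∀ (G : Graph S) {u w} → adj G u w ≡ true → u ≢ w
adj⇒≢ G {u} p ≡.refl with () ← ≡.trans (≡.sym p) (irrefl G u)

does-sym : ∀ (u w : Fin N) → does (u ≟ w) ≡ does (w ≟ u)
does-sym u w with u ≟ w
... | yes ≡.refl = ≡.sym (dec-true (u ≟ u) ≡.refl)
... | no u≢w   = ≡.sym (dec-false (w ≟ u) (u≢w ∘ ≡.sym))

∧-true : ∀ a b → a ∧ b ≡ true → a ≡ true × b ≡ true
∧-true true true _ = ≡.refl , ≡.refl

-- Vertex-minors

infix 4 _≋_
-- Propositional equality of graphs would require function extensionality and equality of the proof
-- fields. The relation spans two supports because supports reached by different deletions agree
-- only propositionally.
record _≋_ {N} {S S′ : Subset N} (G : Graph S) (H : Graph S′) : Set where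
  constructor mk≋
  field
    ≋-support : S ≡ S′
    ≋-adj     : ∀ u w → adj G u w ≡ adj H u w

≋-refl : {G : Graph S} → G ≋ G
≋-refl = mk≋ ≡.refl λ _ _ → ≡.refl

≋-sym : {G : Graph S} {H : Graph S′} → G ≋ H → H ≋ G
≋-sym (mk≋ p q) = mk≋ (≡.sym p) λ u w → ≡.sym (q u w)

≋-trans : {G : Graph S} {H : Graph S′} {F : Graph S″} → G ≋ H → H ≋ F → G ≋ F
≋-trans (mk≋ p q) (mk≋ p′ q′) = mk≋ (≡.trans p p′) λ u w → ≡.trans (q u w) (q′ u w)

delete-cong : ∀ v {G : Graph S} {H : Graph S′} → G ≋ H → delete v G ≋ delete v H
delete-cong v (mk≋ ≡.refl q) = mk≋ ≡.refl λ u w → ≡.cong (_∧ _) (q u w)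

localComplement-cong : ∀ v {G : Graph S} {H : Graph S′} → G ≋ H →
                       localComplement v G ≋ localComplement v H
localComplement-cong v (mk≋ ≡.refl q) = mk≋ ≡.refl λ u w →
  ≡.cong₂ _xor_ (q u w) (≡.cong (_∧ _) (≡.cong₂ _∧_ (q v u) (q v w)))

minor-respʳ : {H : Graph T} {G : Graph S} {G′ : Graph S′} → G ≋ G′ →
              H IsVertexMinorOf G′ → H IsVertexMinorOf G
minor-respʳ (mk≋ ≡.refl q) (equal p r) = equal p (λ u w → ≡.trans (q u w) (r u w))
minor-respʳ G≋@(mk≋ ≡.refl _) (deletion v m p) =
  deletion v m (minor-respʳ (delete-cong v G≋) p)
minor-respʳ G≋@(mk≋ ≡.refl _) (complement v m p) =
  complement v m (minor-respʳ (localComplement-cong v G≋) p)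

minor-trans : {H : Graph T} {G : Graph S} {F : Graph S′} →
              H IsVertexMinorOf G → G IsVertexMinorOf F → H IsVertexMinorOf F
minor-trans p (equal e r)        = minor-respʳ (mk≋ e r) p
minor-trans p (deletion v m q)   = deletion v m (minor-trans p q)
minor-trans p (complement v m q) = complement v m (minor-trans p q)

-- Deleting the vertices outside `T` one after the other never touches a pair inside `T`. The list
-- in `go` contains all vertices outside `T` that are still present, so the support equals `T` when
-- it is empty.
agreeing-minor : ∀ {G : Graph S} {H : Graph T} → T ⊆ S →
                 (∀ {u w} → u ∈ T → w ∈ T → adj G u w ≡ adj H u w) → H IsVertexMinorOf G
agreeing-minor {N} {S = S} {T} {G = G} {H} T⊆S agree =
  go (allFin N) T⊆S (λ _ _ → ∈-allFin _) G agree
  where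
  go : ∀ (vs : List (Fin N)) {S : Subset N} → T ⊆ S → (∀ {v} → v ∈ S → ¬ v ∈ T → v ∈ˡ vs) →
       (G : Graph S) → (∀ {u w} → u ∈ T → w ∈ T → adj G u w ≡ adj H u w) → H IsVertexMinorOf G
  go [] {S} T⊆S rest G agree = equal (⊆-antisym S⊆T T⊆S) same
    where
    S⊆T : S ⊆ T
    S⊆T {v} m with v ∈? T
    ... | yes t = t
    ... | no ¬t with () ← rest m ¬t

    same : ∀ u w → adj G u w ≡ adj H u w
    same u w with u ∈? T | w ∈? T
    ... | yes p | yes q = agree p q
    ... | no ¬p | _     = ≡.trans (Bool.¬-not (λ a → ¬p (S⊆T (adj⇒∈ G a)))) (≡.sym (Bool.¬-not (λ a → ¬p (adj⇒∈ H a))))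
    ... | yes _ | no ¬q = ≡.trans (Bool.¬-not (λ a → ¬q (S⊆T (adj⇒∈ʳ G a)))) (≡.sym (Bool.¬-not (λ a → ¬q (adj⇒∈ʳ H a))))
  go (v ∷ vs) {S} T⊆S rest G agree with v ∈? S | v ∈? T
  ... | no ¬s | _     = go vs T⊆S (λ m ¬t → case′ m (rest m ¬t)) G agree
    where
    case′ : ∀ {w} → w ∈ S → w ∈ˡ v ∷ vs → w ∈ˡ vs
    case′ m (here ≡.refl) = contradiction m ¬s
    case′ m (there p)   = p
  ... | yes _ | yes t = go vs T⊆S (λ m ¬t → case′ ¬t (rest m ¬t)) G agree
    where
    case′ : ∀ {w} → ¬ w ∈ T → w ∈ˡ v ∷ vs → w ∈ˡ vs
    case′ ¬t (here ≡.refl) = contradiction t ¬t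
    case′ ¬t (there p)   = p
  ... | yes s | no ¬t = deletion v s (go vs T⊆S-v rest′ (delete v G) agree′)
    where
    T⊆S-v : T ⊆ S - v
    T⊆S-v {w} m = x∈p∧x≢y⇒x∈p-y (T⊆S m) (λ { ≡.refl → ¬t m })

    rest′ : ∀ {w} → w ∈ S - v → ¬ w ∈ T → w ∈ˡ vs
    rest′ m ¬q with rest (p-x⊆p v m) ¬q
    ... | here ≡.refl = contradiction m (x∉p-x v)
    ... | there p   = p

    agree′ : ∀ {u w} → u ∈ T → w ∈ T → adj (delete v G) u w ≡ adj H u w
    agree′ {u} {w} p q = ≡.trans
      (≡.cong (adj G u w ∧_) (≡.cong₂ _∧_ (∈⇒true (T⊆S-v p)) (∈⇒true (T⊆S-v q))))
      (≡.trans (Bool.∧-identityʳ _) (agree p q))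

-- Decidability of the vertex-minor relation

vectors : ∀ {A : Set} → List A → ∀ n → List (Vec A n)
vectors xs zero    = [] ∷ []
vectors xs (suc n) = cartesianProductWith _∷_ xs (vectors xs n)

∈-vectors : ∀ {A : Set} {xs : List A} → (∀ x → x ∈ˡ xs) → ∀ (v : Vec A n) → v ∈ˡ vectors xs n
∈-vectors all []      = here ≡.refl
∈-vectors all (x ∷ v) = ∈-cartesianProductWith⁺ _∷_ (all x) (∈-vectors all v)

subsets : ∀ N → List (Subset N)
subsets = vectors (true ∷ false ∷ [])

∈-subsets : ∀ (S : Subset N) → S ∈ˡ subsets N
∈-subsets = ∈-vectors λ { true → here ≡.refl ; false → there (here ≡.refl) }

matrices : ∀ N → List (Vec (Subset N) N)
matrices N = vectors (subsets N) N

-- For the enumeration every matrix of bits has to denote a graph, hence the conjunction with the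
-- transpose, the cleared diagonal and the mask by `S`. On the matrix of an actual graph all three
-- change nothing.
decode : ∀ {N} (S : Subset N) → Vec (Subset N) N → Graph S
decode S M = record
  { adj    = λ u w → (entry u w ∧ entry w u) ∧ (not (does (u ≟ w))) ∧ (lookup S u ∧ lookup S w)
  ; symm   = λ u w → ≡.cong₂ _∧_ (Bool.∧-comm (entry u w) _)
      (≡.cong₂ _∧_ (≡.cong not (does-sym u w)) (Bool.∧-comm (lookup S u) _))
  ; irrefl = λ u → ≡.trans (≡.cong (λ b → (entry u u ∧ entry u u) ∧ not b ∧ (lookup S u ∧ lookup S u)) (dec-true (u ≟ u) ≡.refl)) (Bool.∧-zeroʳ _)
  ; adj⇒∈  = λ {u} {w} p → true⇒∈ (proj₁ (∧-true (lookup S u) _ (proj₂ (∧-true (not (does (u ≟ w))) _ (proj₂ (∧-true (entry u w ∧ entry w u) _ p))))))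
  }
  where
  entry : Fin _ → Fin _ → Bool
  entry u w = lookup (lookup M u) w

encode : ∀ {N} {S : Subset N} → Graph S → Vec (Subset N) N
encode G = tabulate (λ u → tabulate (adj G u))

decode-encode : (G : Graph S) → G ≋ decode S (encode G)
decode-encode {S = S} G = mk≋ ≡.refl same
  where
  entry : ∀ u w → lookup (lookup (encode G) u) w ≡ adj G u w
  entry u w = ≡.trans (≡.cong (λ r → lookup r w) (lookup∘tabulate _ u)) (lookup∘tabulate _ w)

  same : ∀ u w → adj G u w ≡ adj (decode S (encode G)) u w
  same u w rewrite entry u w | entry w u | symm G w u with adj G u w in eq
  ... | false = ≡.refl
  ... | true  rewrite dec-false (u ≟ w) (adj⇒≢ G eq) | ∈⇒true (adj⇒∈ G eq) | ∈⇒true (adj⇒∈ʳ G eq) = ≡.refl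

Node : ℕ → Set
Node N = Σ (Subset N) Graph

nodes : ∀ N → List (Node N)
nodes N = cartesianProductWith (λ S M → S , decode S M) (subsets N) (matrices N)

_≋?_ : (G : Graph S) (H : Graph S′) → Dec (G ≋ H)
G ≋? H = map′ (λ (p , q) → mk≋ p q) (λ (mk≋ p q) → p , q) $ ≡-dec Bool._≟_ _ _ ×-dec Fin.all? (λ u → Fin.all? (λ w → adj G u w Bool.≟ adj H u w))

-- Equality counts as a step so that walks of length zero, which correspond to the constructor
-- `equal`, are covered.
_⟶_ : Node N → Node N → Set
(S , G) ⟶ (S′ , H) =
  G ≋ H ⊎ ∃ λ v → v ∈ S × (delete v G ≋ H ⊎ localComplement v G ≋ H)

_⟶?_ : ∀ (x y : Node N) → Dec (x ⟶ y)
(S , G) ⟶? (S′ , H) = (G ≋? H) ⊎-dec Fin.any? λ v →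
  (v ∈? S) ×-dec ((delete v G ≋? H) ⊎-dec (localComplement v G ≋? H))

⟶-resp : ∀ {x x′ y y′ : Node N} → proj₂ x ≋ proj₂ x′ → proj₂ y ≋ proj₂ y′ → x ⟶ y → x′ ⟶ y′
⟶-resp p q (inj₁ e) = inj₁ (≋-trans (≋-sym p) (≋-trans e q))
⟶-resp p@(mk≋ ≡.refl _) q (inj₂ (v , m , inj₁ e)) =
  inj₂ (v , m , inj₁ (≋-trans (delete-cong v (≋-sym p)) (≋-trans e q)))
⟶-resp p@(mk≋ ≡.refl _) q (inj₂ (v , m , inj₂ e)) =
  inj₂ (v , m , inj₂ (≋-trans (localComplement-cong v (≋-sym p)) (≋-trans e q)))

-- As in the Floyd–Warshall algorithm: walks all of whose intermediate nodes
-- are in the list.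
Walk : List (Node N) → Node N → Node N → Set
Walk []       x y = x ⟶ y
Walk (z ∷ zs) x y = Walk zs x y ⊎ (Walk zs x z × Walk zs z y)

walk? : ∀ (zs : List (Node N)) x y → Dec (Walk zs x y)
walk? []       x y = x ⟶? y
walk? (z ∷ zs) x y = walk? zs x y ⊎-dec (walk? zs x z ×-dec walk? zs z y)

step⇒walk : ∀ (zs : List (Node N)) {x y} → x ⟶ y → Walk zs x y
step⇒walk []       s = s
step⇒walk (z ∷ zs) s = inj₁ (step⇒walk zs s)

walk-resp : ∀ (zs : List (Node N)) {x x′ y y′} → proj₂ x ≋ proj₂ x′ → proj₂ y ≋ proj₂ y′ →
            Walk zs x y → Walk zs x′ y′
walk-resp []       p q s              = ⟶-resp p q s
walk-resp (z ∷ zs) p q (inj₁ s)       = inj₁ (walk-resp zs p q s)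
walk-resp (z ∷ zs) p q (inj₂ (s , t)) =
  inj₂ (walk-resp zs p ≋-refl s , walk-resp zs ≋-refl q t)

-- If `z` is the pivot, each half is cut down to its part before the first or after the last visit
-- to `z`. At another pivot visited by both halves, everything between the first and the last visit
-- is cut out, possibly together with `z`.
walk-join : ∀ {zs : List (Node N)} {x y z} → z ∈ˡ zs → Walk zs x z → Walk zs z y → Walk zs x y
walk-join (here ≡.refl) s t = inj₂ ([ (λ p → p) , proj₁ ] s , [ (λ p → p) , proj₂ ] t)
walk-join (there m) (inj₁ s)       (inj₁ t)       = inj₁ (walk-join m s t)
walk-join (there m) (inj₁ s)       (inj₂ (t , u)) = inj₂ (walk-join m s t , u)
walk-join (there m) (inj₂ (r , s)) (inj₁ t)       = inj₂ (r , walk-join m s t)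
walk-join (there m) (inj₂ (r , s)) (inj₂ (t , u)) = inj₂ (r , u)

walk⇒minor : ∀ (zs : List (Node N)) {x y} → Walk zs x y → proj₂ y IsVertexMinorOf proj₂ x
walk⇒minor [] (inj₁ (mk≋ e r))               = equal e r
walk⇒minor [] (inj₂ (v , m , inj₁ (mk≋ e r)))  = deletion v m (equal e r)
walk⇒minor [] (inj₂ (v , m , inj₂ (mk≋ e r)))  = complement v m (equal e r)
walk⇒minor (z ∷ zs) (inj₁ s)                  = walk⇒minor zs s
walk⇒minor (z ∷ zs) (inj₂ (s , t))            = minor-trans (walk⇒minor zs t) (walk⇒minor zs s)

-- The middle node itself need not occur in `nodes`, but its decoded copy does, and walks respect
-- `≋`.
walk-trans : ∀ {x y z : Node N} → Walk (nodes N) x y → Walk (nodes N) y z → Walk (nodes N) x z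
walk-trans {y = S , G} s t = walk-join
  (∈-cartesianProductWith⁺ _ (∈-subsets S) (∈-vectors ∈-subsets (encode G)))
  (walk-resp (nodes _) ≋-refl (decode-encode G) s) (walk-resp (nodes _) (decode-encode G) ≋-refl t)

minor⇒walk : ∀ {N} {S T : Subset N} {H : Graph T} {G : Graph S} → H IsVertexMinorOf G → Walk (nodes N) (S , G) (T , H)
minor⇒walk (equal e r)        = step⇒walk (nodes _) (inj₁ (mk≋ e r))
minor⇒walk (deletion v m p)   =
  walk-trans (step⇒walk (nodes _) (inj₂ (v , m , inj₁ ≋-refl))) (minor⇒walk p)
minor⇒walk (complement v m p) =
  walk-trans (step⇒walk (nodes _) (inj₂ (v , m , inj₂ ≋-refl))) (minor⇒walk p)

_isVertexMinorOf?_ : (H : Graph T) (G : Graph S) → Dec (H IsVertexMinorOf G)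
H isVertexMinorOf? G = map′ (walk⇒minor (nodes _)) minor⇒walk (walk? (nodes _) (_ , G) (_ , H))

-- Up to `≋` there is at most one candidate for each matrix of bits, and being a vertex-major
-- depends on the candidate only up to `≋`.
hasCommonVertexMajor? : ∀ (G G′ : Graph (⊤ {n})) k → Dec (HasCommonVertexMajor G G′ k)
hasCommonVertexMajor? {n} G G′ k = map′ (λ a → let M , p = Any.satisfied a in decode ⊤ M , p)
  (λ (Ĝ , p , q) → lose (∈-vectors ∈-subsets (encode Ĝ))
    (minor-respʳ (≋-sym (decode-encode Ĝ)) p , minor-respʳ (≋-sym (decode-encode Ĝ)) q))
  (Any.any? (λ M → (embed k G isVertexMinorOf? decode ⊤ M) ×-dec (embed k G′ isVertexMinorOf? decode ⊤ M))
    (matrices (n + k)))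

least : ∀ {ℓ} {P : ℕ → Set ℓ} → (∀ k → Dec (P k)) → ∀ k → P k → ∃ (IsMinimum P)
least P? zero    p = zero , p , λ _ _ → z≤n
least {P = P} P? (suc k) p with P? zero
... | yes p₀ = zero , p₀ , λ _ _ → z≤n
... | no ¬p₀ with least (P? ∘ suc) k p
...   | m , q , min = suc m , q , λ { zero r → contradiction r ¬p₀ ; (suc j) r → s≤s (min j r) }

-- Common vertex-majors

module _ {n : ℕ} where

  meets : Fin n × Fin n → Fin n → Bool
  meets (p , q) u = does (p ≟ u) ∨ does (q ≟ u)

  -- Ancilla `a` is joined just to the ends of the pair `e a`, or to a single vertex if the ends
  -- coincide. `S` records the ancillas that have not been removed yet.
  withAncillas : Graph (⊤ {n}) → (Fin k → Fin n × Fin n) → (S : Subset k) → Graph (⊤ {n} ++ S)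
  withAncillas {k} g e S = record
    { adj    = λ u w → adj′ (splitAt n u) (splitAt n w)
    ; symm   = λ u w → symm′ (splitAt n u) (splitAt n w)
    ; irrefl = λ u → irrefl′ (splitAt n u)
    ; adj⇒∈  = λ {u} {w} p → true⇒∈ (≡.trans (lookup-splitAt n ⊤ S u) (support (splitAt n u) (splitAt n w) p))
    }
    where
    adj′ : Fin n ⊎ Fin k → Fin n ⊎ Fin k → Bool
    adj′ (inj₁ u) (inj₁ w) = adj g u w
    adj′ (inj₁ u) (inj₂ a) = lookup S a ∧ meets (e a) u
    adj′ (inj₂ a) (inj₁ u) = lookup S a ∧ meets (e a) u
    adj′ (inj₂ _) (inj₂ _) = false

    symm′ : ∀ u w → adj′ u w ≡ adj′ w u
    symm′ (inj₁ u) (inj₁ w) = symm g u w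
    symm′ (inj₁ _) (inj₂ _) = ≡.refl
    symm′ (inj₂ _) (inj₁ _) = ≡.refl
    symm′ (inj₂ _) (inj₂ _) = ≡.refl

    irrefl′ : ∀ u → adj′ u u ≡ false
    irrefl′ (inj₁ u) = irrefl g u
    irrefl′ (inj₂ _) = ≡.refl

    support : ∀ u w → adj′ u w ≡ true → [ lookup (⊤ {n}) , lookup S ] u ≡ true
    support (inj₁ u) w        p = lookup-replicate u true
    support (inj₂ a) (inj₁ w) p = proj₁ (∧-true (lookup S a) _ p)

  -- Written in the shape of a local complementation at a vertex whose neighbours are the ends of
  -- `e`, so that both unfold alike. If the ends coincide, nothing changes.
  toggle : Fin n × Fin n → Graph (⊤ {n}) → Graph (⊤ {n})
  toggle e g = record
    { adj    = λ u w → adj g u w xor ((meets e u ∧ meets e w) ∧ not (does (u ≟ w)))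
    ; symm   = λ u w → ≡.cong₂ _xor_ (symm g u w)
        (≡.cong₂ _∧_ (Bool.∧-comm (meets e u) _) (≡.cong not (does-sym u w)))
    ; irrefl = λ u → ≡.cong₂ _xor_ (irrefl g u)
        (≡.trans (≡.cong (λ b → (meets e u ∧ meets e u) ∧ not b) (dec-true (u ≟ u) ≡.refl)) (Bool.∧-zeroʳ _))
    ; adj⇒∈  = λ _ → ∈⊤
    }

  withAncillas-⊥ : ∀ (g : Graph (⊤ {n})) (e : Fin k → Fin n × Fin n) → withAncillas g e ⊥ ≋ embed k g
  withAncillas-⊥ {k} g e = mk≋ ≡.refl same
    where
    same : ∀ u w → adj (withAncillas g e ⊥) u w ≡ adj (embed k g) u w
    same u w with splitAt n u | splitAt n w
    ... | inj₁ _ | inj₁ _ = ≡.refl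
    ... | inj₁ x | inj₂ a = ≡.cong (_∧ meets (e a) x) (lookup-replicate a false)
    ... | inj₂ a | inj₁ x = ≡.cong (_∧ meets (e a) x) (lookup-replicate a false)
    ... | inj₂ _ | inj₂ _ = ≡.refl

  module _ {k : ℕ} (e : Fin k → Fin n × Fin n) (g : Graph (⊤ {n})) {S : Subset k} where

    private
      Γ = withAncillas g e S

    lookup-remaining : ∀ a u → lookup ((⊤ {n} ++ S) - (n ↑ʳ a)) u
                     ≡ [ (λ _ → true) , lookup (S - a) ] (splitAt n u)
    lookup-remaining a u rewrite ++-- (⊤ {n}) S a | lookup-splitAt n ⊤ (S - a) u with splitAt n u
    ... | inj₁ x = lookup-replicate x true
    ... | inj₂ b = ≡.refl

    remaining-ancilla : ∀ a b x → (lookup S b ∧ x) ∧ lookup (S - a) b ≡ lookup (S - a) b ∧ x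
    remaining-ancilla a b x rewrite lookup-- S a b with lookup S b
    ... | true  = Bool.∧-comm x _
    ... | false = ≡.refl

    delete-ancilla : ∀ a → delete (n ↑ʳ a) Γ ≋ withAncillas g e (S - a)
    delete-ancilla a = mk≋ (++-- ⊤ S a) same
      where
      same : ∀ u w → adj (delete (n ↑ʳ a) Γ) u w ≡ adj (withAncillas g e (S - a)) u w
      same u w rewrite lookup-remaining a u | lookup-remaining a w with splitAt n u | splitAt n w
      ... | inj₁ _ | inj₁ _ = Bool.∧-identityʳ _
      ... | inj₁ _ | inj₂ b = remaining-ancilla a b _
      ... | inj₂ b | inj₁ x rewrite Bool.∧-identityʳ (lookup (S - a) b) = remaining-ancilla a b _
      ... | inj₂ _ | inj₂ _ = ≡.refl

    ↑ˡ-does : ∀ (u w : Fin (n + k)) {x y} → splitAt n u ≡ inj₁ x → splitAt n w ≡ inj₁ y →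
              does (u ≟ w) ≡ does (x ≟ y)
    ↑ˡ-does u w {x} {y} p q with x ≟ y
    ... | yes ≡.refl = dec-true (u ≟ w) (≡.trans (≡.sym (splitAt⁻¹-↑ˡ p)) (splitAt⁻¹-↑ˡ q))
    ... | no x≢y   = dec-false (u ≟ w) λ { ≡.refl → x≢y (inj₁-injective (≡.trans (≡.sym p) q)) }

    -- No two ancillas are adjacent, so complementing at one affects only the pair of its ends and
    -- leaves the edges at the other ancillas alone.
    complement-ancilla : ∀ a → a ∈ S →
      delete (n ↑ʳ a) (localComplement (n ↑ʳ a) Γ) ≋ withAncillas (toggle (e a) g) e (S - a)
    complement-ancilla a a∈S = mk≋ (++-- ⊤ S a) same
      where
      same : ∀ u w → adj (delete (n ↑ʳ a) (localComplement (n ↑ʳ a) Γ)) u w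
                   ≡ adj (withAncillas (toggle (e a) g) e (S - a)) u w
      same u w rewrite lookup-remaining a u | lookup-remaining a w | splitAt-↑ʳ n k a
        with splitAt n u in p | splitAt n w in q
      ... | inj₁ x | inj₁ y rewrite ∈⇒true a∈S = ≡.trans (Bool.∧-identityʳ _)
        (≡.cong (λ b → adj g x y xor ((meets (e a) x ∧ meets (e a) y) ∧ not b)) (↑ˡ-does u w p q))
      ... | inj₁ x | inj₂ b rewrite Bool.∧-zeroʳ (lookup S a ∧ meets (e a) x)
                                  | Bool.xor-identityʳ (lookup S b ∧ meets (e b) x) = remaining-ancilla a b _
      ... | inj₂ b | inj₁ x rewrite Bool.xor-identityʳ (lookup S b ∧ meets (e b) x)
                                  | Bool.∧-identityʳ (lookup (S - a) b) = remaining-ancilla a b _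
      ... | inj₂ _ | inj₂ _ = ≡.refl

    remove-ancilla : ∀ {T} {h : Graph T} a → a ∈ S →
      h IsVertexMinorOf withAncillas g e (S - a) → h IsVertexMinorOf Γ
    remove-ancilla a a∈S m = deletion (n ↑ʳ a) n↑a∈ (minor-respʳ (delete-ancilla a) m)
      where
      n↑a∈ : n ↑ʳ a ∈ ⊤ {n} ++ S
      n↑a∈ = true⇒∈ (≡.trans (lookup-++ʳ (⊤ {n}) S a) (∈⇒true a∈S))

    remove-ancilla′ : ∀ {T} {h : Graph T} a → a ∈ S →
      h IsVertexMinorOf withAncillas (toggle (e a) g) e (S - a) → h IsVertexMinorOf Γ
    remove-ancilla′ a a∈S m = complement (n ↑ʳ a) n↑a∈
      (deletion (n ↑ʳ a) n↑a∈ (minor-respʳ (complement-ancilla a a∈S) m))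
      where
      n↑a∈ : n ↑ʳ a ∈ ⊤ {n} ++ S
      n↑a∈ = true⇒∈ (≡.trans (lookup-++ʳ (⊤ {n}) S a) (∈⇒true a∈S))

  toggle-ends : ∀ (g : Graph (⊤ {n})) {p q} → p ≢ q → adj (toggle (p , q) g) p q ≡ not (adj g p q)
  toggle-ends g {p} {q} p≢q
    rewrite dec-true (p ≟ p) ≡.refl | dec-true (q ≟ q) ≡.refl | dec-false (p ≟ q) p≢q
          = Bool.xor-comm (adj g p q) true

  toggle-others : ∀ (g : Graph (⊤ {n})) {p q u w} → (u ≡ p → w ≢ q) → (u ≡ q → w ≢ p) →
                  adj (toggle (p , q) g) u w ≡ adj g u w
  toggle-others g {p} {q} {u} {w} ≢₁ ≢₂ with p ≟ u | q ≟ u | p ≟ w | q ≟ w | u ≟ w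
  ... | _        | _        | _        | _        | yes ≡.refl =
    ≡.trans (≡.cong (adj g u w xor_) (Bool.∧-zeroʳ _)) (Bool.xor-identityʳ _)
  ... | yes ≡.refl | _        | _        | yes ≡.refl | no _   = contradiction ≡.refl (≢₁ ≡.refl)
  ... | yes ≡.refl | _        | yes ≡.refl | no _     | no u≢w = contradiction ≡.refl u≢w
  ... | yes ≡.refl | _        | no _     | no _     | no _   = Bool.xor-identityʳ _
  ... | no _     | yes ≡.refl | yes ≡.refl | _        | no _   = contradiction ≡.refl (≢₂ ≡.refl)
  ... | no _     | yes ≡.refl | no _     | yes ≡.refl | no u≢w = contradiction ≡.refl u≢w
  ... | no _     | yes ≡.refl | no _     | no _     | no _   = Bool.xor-identityʳ _
  ... | no _     | no _     | _        | _        | no _   = Bool.xor-identityʳ _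

  module _ {k : ℕ} (e : Fin k → Fin n × Fin n) (h : Graph (⊤ {n})) where

    Correct : Graph (⊤ {n}) → Fin n × Fin n → Set
    Correct g (u , w) = adj g u w ≡ adj h u w

    -- Removing an ancilla fixes the pair of its ends: if the pair is wrong,
    -- complement locally at the ancilla first.
    adapt : ∀ (as : List (Fin k)) (g : Graph (⊤ {n})) (S : Subset k) →
            (∀ {a} → a ∈ S → a ∈ˡ as) → (∀ x → Correct g x ⊎ ∃ λ a → a ∈ S × e a ≡ x) →
            embed k h IsVertexMinorOf withAncillas g e S
    adapt [] g S all cor with ≡.refl ← Empty-unique {p = S} (λ { (_ , m) → case all m of λ () }) =
      minor-respʳ (withAncillas-⊥ g e) (equal ≡.refl same)
      where
      correct : ∀ x → Correct g x
      correct x with cor x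
      ... | inj₁ c           = c
      ... | inj₂ (a , m , _) with () ← all m

      same : ∀ u w → adj (embed k g) u w ≡ adj (embed k h) u w
      same u w with splitAt n u | splitAt n w
      ... | inj₁ x | inj₁ y = correct (x , y)
      ... | inj₁ _ | inj₂ _ = ≡.refl
      ... | inj₂ _ | inj₁ _ = ≡.refl
      ... | inj₂ _ | inj₂ _ = ≡.refl
    adapt (a ∷ as) g S all cor with a ∈? S
    ... | no a∉S = adapt as g S rest cor
      where
      rest : ∀ {b} → b ∈ S → b ∈ˡ as
      rest m with all m
      ... | here ≡.refl = contradiction m a∉S
      ... | there p   = p
    ... | yes a∈S with adj g (proj₁ (e a)) (proj₂ (e a)) Bool.≟ adj h (proj₁ (e a)) (proj₂ (e a))
    ...   | yes c = remove-ancilla e g a a∈S (adapt as g (S - a) rest cor′)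
      where
      rest : ∀ {b} → b ∈ S - a → b ∈ˡ as
      rest m with all (p-x⊆p a m)
      ... | here ≡.refl = contradiction m (x∉p-x a)
      ... | there p   = p

      cor′ : ∀ x → Correct g x ⊎ ∃ λ b → b ∈ S - a × e b ≡ x
      cor′ x with cor x
      ... | inj₁ d = inj₁ d
      ... | inj₂ (b , m , ≡.refl) with b ≟ a
      ...   | yes ≡.refl = inj₁ c
      ...   | no b≢a   = inj₂ (b , x∈p∧x≢y⇒x∈p-y m b≢a , ≡.refl)
    ...   | no ¬c = remove-ancilla′ e g a a∈S (adapt as (toggle (e a) g) (S - a) rest cor′)
      where
      rest : ∀ {b} → b ∈ S - a → b ∈ˡ as
      rest m with all (p-x⊆p a m)
      ... | here ≡.refl = contradiction m (x∉p-x a)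
      ... | there p   = p

      p = proj₁ (e a)
      q = proj₂ (e a)

      -- A pair of equal ends is never wrong, since neither graph has loops. So the toggle really
      -- flips an edge.
      p≢q : p ≢ q
      p≢q p≡q = ¬c (≡.subst (λ x → adj g p x ≡ adj h p x) p≡q (≡.trans (irrefl g p) (≡.sym (irrefl h p))))

      fixed : adj (toggle (e a) g) p q ≡ adj h p q
      fixed = ≡.trans (toggle-ends g p≢q) (≡.sym (Bool.¬-not (¬c ∘ ≡.sym)))

      cor′ : ∀ x → Correct (toggle (e a) g) x ⊎ ∃ λ b → b ∈ S - a × e b ≡ x
      -- The toggle alters the pair of ends in both orders. Symmetry of the two graphs makes the
      -- reversed pair correct as well; all other pairs keep their status.
      cor′ (u , w) with (p ≟ u) ×-dec (q ≟ w) | (q ≟ u) ×-dec (p ≟ w)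
      ... | yes (≡.refl , ≡.refl) | _ = inj₁ fixed
      ... | no _ | yes (≡.refl , ≡.refl) =
        inj₁ (≡.trans (symm (toggle (e a) g) u w) (≡.trans fixed (symm h p q)))
      ... | no ≢₁ | no ≢₂ with cor (u , w)
      ...   | inj₁ d = inj₁ (≡.trans (toggle-others g {p} {q} (λ { ≡.refl ≡.refl → ≢₁ (≡.refl , ≡.refl) }) (λ { ≡.refl ≡.refl → ≢₂ (≡.refl , ≡.refl) })) d)
      ...   | inj₂ (b , m , r) with b ≟ a
      ...     | yes ≡.refl = contradiction (≡.cong proj₁ r , ≡.cong proj₂ r) ≢₁
      ...     | no b≢a   = inj₂ (b , x∈p∧x≢y⇒x∈p-y m b≢a , r)

++-⊤ : ∀ n → ⊤ {n} ++ ⊤ {k} ≡ ⊤ {n + k}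
++-⊤ zero    = ≡.refl
++-⊤ (suc n) = ≡.cong (true ∷_) (++-⊤ n)

-- One ancilla for each ordered pair is far from optimal, but any number with the property bounds
-- the search for the minimum.
commonVertexMajor : ∀ (G G′ : Graph (⊤ {n})) → HasCommonVertexMajor G G′ (n * n)
commonVertexMajor {n} G G′ = cast (++-⊤ n) (withAncillas G (remQuot n) ⊤) , minor G , minor G′
  where
  cast : ∀ {N} {S T : Subset N} → S ≡ T → Graph S → Graph T
  cast ≡.refl G = G

  cast-≋ : ∀ {N} {S T : Subset N} (e : S ≡ T) (G : Graph S) → cast e G ≋ G
  cast-≋ ≡.refl G = ≋-refl

  minor : ∀ h → embed (n * n) h IsVertexMinorOf cast (++-⊤ n) (withAncillas G (remQuot n) ⊤)
  minor h = minor-respʳ (cast-≋ (++-⊤ n) _) (adapt (remQuot n) h (allFin _) G ⊤ (λ _ → ∈-allFin _)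
    (λ (u , w) → inj₂ (combine u w , ∈⊤ , remQuot-combine u w)))

graphDistance : ∀ (G G′ : Graph (⊤ {n})) → ∃ (GraphDistance G G′)
graphDistance G G′ = least (hasCommonVertexMajor? G G′) _ (commonVertexMajor G G′)

-- Parities of degrees and edge numbers

module ⊕ = Sum (CommutativeRing.+-commutativeMonoid Bool.xor-∧-commutativeRing)

⨁ : (Fin N → Bool) → Bool
⨁ = ⊕.sum

⨁-cong : {f g : Fin N → Bool} → f ≗ g → ⨁ f ≡ ⨁ g
⨁-cong = ⊕.sum-cong-≗

⨁-xor : (f g : Fin N → Bool) → ⨁ (λ w → f w xor g w) ≡ ⨁ f xor ⨁ g
⨁-xor = ⊕.∑-distrib-+

⨁-false : ⨁ {N} (λ _ → false) ≡ false
⨁-false {zero}  = ≡.refl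
⨁-false {suc N} = ⨁-false {N}

⨁-single : ∀ (v : Fin N) b → ⨁ (λ w → does (v ≟ w) ∧ b) ≡ b
⨁-single {suc N} zero    b = ≡.trans (≡.cong (b xor_) (⨁-false {N})) (Bool.xor-identityʳ b)
⨁-single {suc N} (suc v) b = ⨁-single v b

-- The parity of the number of pairs u < w with a u w.
pairs : (Fin N → Fin N → Bool) → Bool
pairs {zero}  a = false
pairs {suc N} a = ⨁ (λ w → a zero (suc w)) xor pairs (λ u w → a (suc u) (suc w))

pairs-cong : {a b : Fin N → Fin N → Bool} → (∀ u w → a u w ≡ b u w) → pairs a ≡ pairs b
pairs-cong {zero}  p = ≡.refl
pairs-cong {suc N} p = ≡.cong₂ _xor_ (⨁-cong (p zero ∘ suc)) (pairs-cong (λ u w → p (suc u) (suc w)))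

pairs-xor : (a b : Fin N → Fin N → Bool) → pairs (λ u w → a u w xor b u w) ≡ pairs a xor pairs b
pairs-xor {zero}  a b = ≡.refl
pairs-xor {suc N} a b = ≡.trans
  (≡.cong₂ _xor_ (⨁-xor (a zero ∘ suc) (b zero ∘ suc)) (pairs-xor (λ u w → a (suc u) (suc w)) _))
  (xor-solve 4 (λ p q r s → (p :⊕ q) :⊕ (r :⊕ s) :≡ (p :⊕ r) :⊕ (q :⊕ s)) ≡.refl
    (⨁ (a zero ∘ suc)) (⨁ (b zero ∘ suc)) _ _)

pairs-false : pairs {N} (λ _ _ → false) ≡ false
pairs-false {zero}  = ≡.refl
pairs-false {suc N} = ≡.cong₂ _xor_ (⨁-false {N}) (pairs-false {N})

-- The symmetric matrix of the star with centre `v` and leaves given by `c`: what an induced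
-- subgraph gains when `v` is added to it.
star : Fin N → (Fin N → Bool) → Fin N → Fin N → Bool
star v c u w = (does (v ≟ u) ∧ c w) xor (does (v ≟ w) ∧ c u)

pairs-star : ∀ (v : Fin N) c → c v ≡ false → pairs (star v c) ≡ ⨁ c
pairs-star {suc N} zero c p = begin
  ⨁ (λ w → c (suc w) xor false) xor pairs {N} (λ _ _ → false)
    ≡⟨ ≡.cong₂ _xor_ (⨁-cong (λ w → Bool.xor-identityʳ (c (suc w)))) (pairs-false {N}) ⟩
  ⨁ (c ∘ suc) xor false ≡⟨ Bool.xor-identityʳ _ ⟩
  ⨁ (c ∘ suc)           ≡⟨ ≡.cong (_xor ⨁ (c ∘ suc)) p ⟨
  ⨁ c                   ∎
  where open ≡.≡-Reasoning
pairs-star {suc N} (suc v) c p = ≡.cong₂ _xor_ (⨁-single v (c zero)) (pairs-star v (c ∘ suc) p)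

-- The parity of the binomial coefficient (m choose 2), for m the number of ones in `c`: the number
-- of pairs that a local complementation toggles among m neighbours.
choose₂ : (Fin N → Bool) → Bool
choose₂ c = pairs (λ u w → (c u ∧ c w) ∧ not (does (u ≟ w)))

choose₂-suc : (c : Fin (suc N) → Bool) → choose₂ c ≡ (c zero ∧ ⨁ (c ∘ suc)) xor choose₂ (c ∘ suc)
choose₂-suc {N} c = ≡.cong (_xor choose₂ (c ∘ suc)) (≡.trans (⨁-cong {N} (λ w → Bool.∧-identityʳ (c zero ∧ c (suc w)))) (row (c zero)))
  where
  row : ∀ b → ⨁ (λ w → b ∧ c (suc w)) ≡ b ∧ ⨁ (c ∘ suc)
  row true  = ≡.refl
  row false = ⨁-false {N}

module _ {S : Subset N} (G : Graph S) where

  edges : Subset N → Bool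
  edges B = pairs (adj (induced G B))

  degree : Fin N → Subset N → Bool
  degree v B = ⨁ (λ w → adj G v w ∧ lookup B w)

  -- Putting `v` into the set adds exactly the star from `v` to its neighbours in `B`. The degree
  -- does not depend on whether `B` contains `v`, as `v` is not its own neighbour.
  edges-insert : ∀ v B → edges (B [ v ]≔ true) ≡ edges (B [ v ]≔ false) xor degree v B
  edges-insert v B = ≡.trans (pairs-cong split)
    (≡.trans (pairs-xor (adj (induced G (B [ v ]≔ false))) (star v c)) (≡.cong (edges (B [ v ]≔ false) xor_) (pairs-star v c c-v)))
    where
    c : Fin N → Bool
    c w = adj G v w ∧ lookup B w

    c-v : c v ≡ false
    c-v = ≡.cong (_∧ lookup B v) (irrefl G v)

    split : ∀ u w → adj (induced G (B [ v ]≔ true)) u w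
                  ≡ adj (induced G (B [ v ]≔ false)) u w xor star v c u w
    split u w with v ≟ u | v ≟ w
    ... | yes ≡.refl | yes ≡.refl rewrite irrefl G v = ≡.refl
    ... | yes ≡.refl | no v≢w
      rewrite lookup∘update v B true | lookup∘update v B false
            | lookup∘update′ (v≢w ∘ ≡.sym) B true
            | Bool.∧-zeroʳ (adj G v w) | Bool.xor-identityʳ (c w) = ≡.refl
    ... | no v≢u   | yes ≡.refl
      rewrite lookup∘update v B true | lookup∘update v B false
            | lookup∘update′ (v≢u ∘ ≡.sym) B true | lookup∘update′ (v≢u ∘ ≡.sym) B false
            | Bool.∧-zeroʳ (lookup B u) | Bool.∧-identityʳ (lookup B u)
            | Bool.∧-zeroʳ (adj G u v) | symm G u v = ≡.refl
    ... | no v≢u   | no v≢w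
      rewrite lookup∘update′ (v≢u ∘ ≡.sym) B true | lookup∘update′ (v≢u ∘ ≡.sym) B false
            | lookup∘update′ (v≢w ∘ ≡.sym) B true | lookup∘update′ (v≢w ∘ ≡.sym) B false = ≡.sym (Bool.xor-identityʳ _)

  degree-update : ∀ v u B b → degree v (B [ u ]≔ b) ≡ degree v (B [ u ]≔ false) xor (adj G v u ∧ b)
  degree-update v u B b = ≡.trans (⨁-cong split)
    (≡.trans (⨁-xor _ (λ w → does (u ≟ w) ∧ (adj G v u ∧ b))) (≡.cong (degree v (B [ u ]≔ false) xor_) (⨁-single u _)))
    where
    split : ∀ w → adj G v w ∧ lookup (B [ u ]≔ b) w
                ≡ (adj G v w ∧ lookup (B [ u ]≔ false) w) xor (does (u ≟ w) ∧ (adj G v u ∧ b))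
    split w with u ≟ w
    ... | yes ≡.refl rewrite lookup∘update u B b | lookup∘update u B false | Bool.∧-zeroʳ (adj G v u) = ≡.refl
    ... | no u≢w rewrite lookup∘update′ (u≢w ∘ ≡.sym) B b | lookup∘update′ (u≢w ∘ ≡.sym) B false = ≡.sym (Bool.xor-identityʳ _)

-- The pairs toggled inside `B` are those of distinct neighbours of `v` in `B`. Entry by entry this
-- is an identity of polynomials over the field with two elements.
edges-localComplement : ∀ {S : Subset N} (G : Graph S) v B →
  edges (localComplement v G) B ≡ edges G B xor choose₂ (λ w → adj G v w ∧ lookup B w)
edges-localComplement {N} G v B = ≡.trans (pairs-cong λ u w →
    xor-solve 6 (λ a x y b c d → (a :⊕ (x :∧ y) :∧ d) :∧ (b :∧ c) :≡ a :∧ (b :∧ c) :⊕ ((x :∧ b) :∧ (y :∧ c)) :∧ d) ≡.refl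
      (adj G u w) (adj G v u) (adj G v w) (lookup B u) (lookup B w) (not (does (u ≟ w))))
  (pairs-xor (adj (induced G B)) _)

odd : ℕ → Bool
odd zero    = false
odd (suc n) = not (odd n)

odd-+ : ∀ m n → odd (m + n) ≡ odd m xor odd n
odd-+ zero    n = ≡.refl
odd-+ (suc m) n = ≡.trans (≡.cong not (odd-+ m n)) (Bool.not-distribˡ-xor (odd m) (odd n))

module Σℕ = Sum +-0-commutativeMonoid

odd-sum : (f : Fin N → ℕ) → odd (Σℕ.sum f) ≡ ⨁ (odd ∘ f)
odd-sum {zero}  f = ≡.refl
odd-sum {suc N} f = ≡.trans (odd-+ (f zero) _) (≡.cong (odd (f zero) xor_) (odd-sum (f ∘ suc)))

odd-indicator : ∀ b → odd (if b then 1 else 0) ≡ b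
odd-indicator true  = ≡.refl
odd-indicator false = ≡.refl

-- An amplitude depends only on the parity of the edge count, so the double sum over naturals can be
-- traded for a sum of bits.
odd-edgeCount : ∀ {S : Subset N} (G : Graph S) → odd (edgeCount G) ≡ pairs (adj G)
odd-edgeCount {N} G = ≡.trans (odd-sum {N} _)
  (≡.trans (⨁-cong {N} λ u → ≡.trans (odd-sum {N} _)
    (⨁-cong {N} {g = λ w → does (u <? w) ∧ adj G u w} λ w → odd-indicator _)) (go (adj G)))
  where
  go : ∀ {N} (a : Fin N → Fin N → Bool) → ⨁ (λ u → ⨁ (λ w → does (u <? w) ∧ a u w)) ≡ pairs a
  go {zero}  a = ≡.refl
  go {suc N} a = ≡.cong (⨁ (λ w → a zero (suc w)) xor_) (go (λ u w → a (suc u) (suc w)))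

module _ {c ℓ₁ ℓ₂} (K : ComplexField c ℓ₁ ℓ₂) where

  open ComplexField K hiding (zero; _-_)

  open SetoidReasoning setoid hiding (stop)

  R : CommutativeRing c ℓ₁
  R = record { isCommutativeRing = isCommutativeRing }

  open CommutativeRing R using (semiring; ring; commutativeSemiring; +-abelianGroup; *-commutativeMonoid)
  open RingProperties ring using (-‿distribˡ-*; -‿distribʳ-*; -0#≈0#; -‿involutive)
  open AbelianGroupProperties +-abelianGroup using (⁻¹-∙-comm)
  open Mult semiring using (×-homo-+; ×1-homo-*)
  open Apartness (HeytingField.heytingCommutativeRing heytingField)
    using (1#0; x#0y#0→xy#0; #-congʳ; invertibleˡ⇒#; x-0≈x)

  -- Gaussian integers

  infix 8 -ᵍ_
  Gauss : Set
  Gauss = ℤ × ℤ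

  ιℤ : ℤ → Carrier
  ιℤ (+ n)     = n ×ᶜ 1#
  ιℤ -[1+ n ]  = -ᶜ (suc n ×ᶜ 1#)

  -‿+-comm : ∀ x y → (-ᶜ x) +ᶜ (-ᶜ y) ≈ -ᶜ (x +ᶜ y)
  -‿+-comm = ⁻¹-∙-comm

  ιℤ-⊖ : ∀ m n → ιℤ (m ⊖ n) ≈ (m ×ᶜ 1#) +ᶜ (-ᶜ (n ×ᶜ 1#))
  ιℤ-⊖ zero    zero    = sym (-‿inverseʳ 0#)
  ιℤ-⊖ zero    (suc n) = sym (+-identityˡ _)
  ιℤ-⊖ (suc m) zero    = sym (trans (+-congˡ -0#≈0#) (+-identityʳ _))
  ιℤ-⊖ (suc m) (suc n) = begin
    ιℤ (suc m ⊖ suc n)     ≡⟨ ≡.cong ιℤ (ℤ.[1+m]⊖[1+n]≡m⊖n m n) ⟩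
    ιℤ (m ⊖ n)             ≈⟨ ιℤ-⊖ m n ⟩
    a +ᶜ (-ᶜ b)            ≈⟨ +-identityˡ _ ⟨
    0# +ᶜ (a +ᶜ (-ᶜ b))    ≈⟨ +-congʳ (-‿inverseʳ 1#) ⟨
    (1# +ᶜ (-ᶜ 1#)) +ᶜ (a +ᶜ (-ᶜ b))
      ≈⟨ solve 4 (λ p q r s → (p :+ q) :+ (r :+ s) := (p :+ r) :+ (q :+ s)) refl 1# (-ᶜ 1#) a (-ᶜ b) ⟩
    (1# +ᶜ a) +ᶜ ((-ᶜ 1#) +ᶜ (-ᶜ b)) ≈⟨ +-congˡ (-‿+-comm 1# b) ⟩
    (1# +ᶜ a) +ᶜ (-ᶜ (1# +ᶜ b)) ∎
    where
    open SemiringSolver commutativeSemiring using (solve; _:+_; _:=_)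
    a = m ×ᶜ 1#
    b = n ×ᶜ 1#

  ιℤ-+ : ∀ a b → ιℤ (a ℤ.+ b) ≈ ιℤ a +ᶜ ιℤ b
  ιℤ-+ (+ m)    (+ n)    = ×-homo-+ 1# m n
  ιℤ-+ (+ m)    -[1+ n ] = ιℤ-⊖ m (suc n)
  ιℤ-+ -[1+ m ] (+ n)    = trans (ιℤ-⊖ n (suc m)) (+-comm _ _)
  ιℤ-+ -[1+ m ] -[1+ n ] = begin
    -ᶜ (suc (suc (m ℕ.+ n)) ×ᶜ 1#)          ≡⟨ ≡.cong (λ k → -ᶜ (k ×ᶜ 1#)) (ℕ-lemma m n) ⟩
    -ᶜ ((suc m ℕ.+ suc n) ×ᶜ 1#)            ≈⟨ -‿cong (×-homo-+ 1# (suc m) (suc n)) ⟩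
    -ᶜ ((suc m ×ᶜ 1#) +ᶜ (suc n ×ᶜ 1#))     ≈⟨ -‿+-comm _ _ ⟨
    (-ᶜ (suc m ×ᶜ 1#)) +ᶜ (-ᶜ (suc n ×ᶜ 1#)) ∎
    where
    ℕ-lemma : ∀ m n → suc (suc (m ℕ.+ n)) ≡ suc m ℕ.+ suc n
    ℕ-lemma zero    n = ≡.refl
    ℕ-lemma (suc m) n = ≡.cong suc (ℕ-lemma m n)

  ιℤ-neg : ∀ a → ιℤ (ℤ.- a) ≈ -ᶜ ιℤ a
  ιℤ-neg (+ zero)  = sym -0#≈0#
  ιℤ-neg (+ suc n) = refl
  ιℤ-neg -[1+ n ]  = sym (-‿involutive _)

  ιℤ-*ℕ : ∀ a n → ιℤ (a ℤ.* + n) ≈ ιℤ a *ᶜ ιℤ (+ n)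
  ιℤ-*ℕ a zero    = trans (reflexive (≡.cong ιℤ (ℤ.*-zeroʳ a))) (sym (zeroʳ _))
  ιℤ-*ℕ a (suc n) = begin
    ιℤ (a ℤ.* + suc n)               ≡⟨ ≡.cong ιℤ (ℤ.*-suc a (+ n)) ⟩
    ιℤ (a ℤ.+ a ℤ.* + n)             ≈⟨ ιℤ-+ a (a ℤ.* + n) ⟩
    ιℤ a +ᶜ ιℤ (a ℤ.* + n)           ≈⟨ +-cong (sym (*-identityʳ _)) (ιℤ-*ℕ a n) ⟩
    (ιℤ a *ᶜ 1#) +ᶜ (ιℤ a *ᶜ ιℤ (+ n)) ≈⟨ distribˡ _ _ _ ⟨
    ιℤ a *ᶜ (1# +ᶜ ιℤ (+ n))         ∎

  ιℤ-* : ∀ a b → ιℤ (a ℤ.* b) ≈ ιℤ a *ᶜ ιℤ b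
  ιℤ-* a (+ n)    = ιℤ-*ℕ a n
  ιℤ-* a -[1+ n ] = begin
    ιℤ (a ℤ.* ℤ.- (+ suc n))   ≡⟨ ≡.cong ιℤ (ℤ.neg-distribʳ-* a (+ suc n)) ⟨
    ιℤ (ℤ.- (a ℤ.* + suc n))   ≈⟨ ιℤ-neg (a ℤ.* + suc n) ⟩
    -ᶜ ιℤ (a ℤ.* + suc n)      ≈⟨ -‿cong (ιℤ-*ℕ a (suc n)) ⟩
    -ᶜ (ιℤ a *ᶜ ιℤ (+ suc n))  ≈⟨ -‿distribʳ-* _ _ ⟩
    ιℤ a *ᶜ (-ᶜ ιℤ (+ suc n))  ∎

  _+ᵍ_ _*ᵍ_ : Gauss → Gauss → Gauss
  (a , b) +ᵍ (c , d) = a ℤ.+ c , b ℤ.+ d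
  (a , b) *ᵍ (c , d) = a ℤ.* c ℤ.+ ℤ.- (b ℤ.* d) , a ℤ.* d ℤ.+ b ℤ.* c

  -ᵍ_ conjᵍ : Gauss → Gauss
  -ᵍ (a , b)    = ℤ.- a , ℤ.- b
  conjᵍ (a , b) = a , ℤ.- b

  0ᵍ 1ᵍ -1ᵍ iᵍ : Gauss
  0ᵍ  = + 0 , + 0
  1ᵍ  = + 1 , + 0
  -1ᵍ = -[1+ 0 ] , + 0
  iᵍ  = + 0 , + 1

  gauss : RawRing 0ℓ 0ℓ
  gauss = record { Carrier = Gauss ; _≈_ = _≡_ ; _+_ = _+ᵍ_ ; _*_ = _*ᵍ_ ; -_ = -ᵍ_ ; 0# = 0ᵍ ; 1# = 1ᵍ }

  ι : Gauss → Carrier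
  ι (a , b) = ιℤ a +ᶜ (ιℤ b *ᶜ i)

  module _ where
    open SemiringSolver commutativeSemiring using (solve; _:+_; _:*_; _:=_)

    ι-+ : ∀ z w → ι (z +ᵍ w) ≈ ι z +ᶜ ι w
    ι-+ (a , b) (c , d) = trans (+-cong (ιℤ-+ a c) (*-congʳ (ιℤ-+ b d)))
      (solve 5 (λ a b c d i → (a :+ c) :+ ((b :+ d) :* i) := (a :+ b :* i) :+ (c :+ d :* i)) refl
        (ιℤ a) (ιℤ b) (ιℤ c) (ιℤ d) i)

    -- Writing negation as a product with i² brings both sides of `ι-*` into the language of
    -- semirings, where `i` can be treated as a variable.
    -≈*i² : ∀ x → -ᶜ x ≈ x *ᶜ (i *ᶜ i)
    -≈*i² x = begin
      -ᶜ x             ≈⟨ -‿cong (*-identityʳ x) ⟨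
      -ᶜ (x *ᶜ 1#)     ≈⟨ -‿distribʳ-* x 1# ⟩
      x *ᶜ (-ᶜ 1#)     ≈⟨ *-congˡ i²≈-1 ⟨
      x *ᶜ (i *ᶜ i)    ∎

    ι-* : ∀ z w → ι (z *ᵍ w) ≈ ι z *ᶜ ι w
    ι-* (a , b) (c , d) = begin
      ιℤ (a ℤ.* c ℤ.+ ℤ.- (b ℤ.* d)) +ᶜ (ιℤ (a ℤ.* d ℤ.+ b ℤ.* c) *ᶜ i)
        ≈⟨ +-cong (trans (ιℤ-+ (a ℤ.* c) _) (+-cong (ιℤ-* a c)
             (trans (ιℤ-neg (b ℤ.* d)) (trans (-≈*i² _) (*-congʳ (ιℤ-* b d))))))
           (*-congʳ (trans (ιℤ-+ (a ℤ.* d) (b ℤ.* c)) (+-cong (ιℤ-* a d) (ιℤ-* b c)))) ⟩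
      ((ιℤ a *ᶜ ιℤ c) +ᶜ ((ιℤ b *ᶜ ιℤ d) *ᶜ (i *ᶜ i))) +ᶜ (((ιℤ a *ᶜ ιℤ d) +ᶜ (ιℤ b *ᶜ ιℤ c)) *ᶜ i)
        ≈⟨ solve 5 (λ a b c d i → (a :* c :+ (b :* d) :* (i :* i)) :+ (a :* d :+ b :* c) :* i
                               := (a :+ b :* i) :* (c :+ d :* i)) refl (ιℤ a) (ιℤ b) (ιℤ c) (ιℤ d) i ⟩
      ι (a , b) *ᶜ ι (c , d) ∎

    ι-neg : ∀ z → ι (-ᵍ z) ≈ -ᶜ ι z
    ι-neg (a , b) = begin
      ιℤ (ℤ.- a) +ᶜ (ιℤ (ℤ.- b) *ᶜ i)    ≈⟨ +-cong (ιℤ-neg a) (*-congʳ (ιℤ-neg b)) ⟩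
      (-ᶜ ιℤ a) +ᶜ ((-ᶜ ιℤ b) *ᶜ i)      ≈⟨ +-congˡ (-‿distribˡ-* _ _) ⟨
      (-ᶜ ιℤ a) +ᶜ (-ᶜ (ιℤ b *ᶜ i))      ≈⟨ -‿+-comm _ _ ⟩
      -ᶜ ι (a , b)                       ∎

    ι-0 : ι 0ᵍ ≈ 0#
    ι-0 = trans (+-identityˡ _) (zeroˡ i)

    ι-1 : ι 1ᵍ ≈ 1#
    ι-1 = trans (+-cong (+-identityʳ 1#) (zeroˡ i)) (+-identityʳ 1#)

    ι--1 : ι -1ᵍ ≈ -ᶜ 1#
    ι--1 = trans (ι-neg 1ᵍ) (-‿cong ι-1)

    ι-i : ι iᵍ ≈ i
    ι-i = trans (+-identityˡ _) (trans (*-congʳ (+-identityʳ 1#)) (*-identityˡ i))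

    conj-cong : ∀ {x y} → x ≈ y → conj x ≈ conj y
    conj-cong = IsRingHomomorphism.⟦⟧-cong conj-homomorphism

    conj-+ : ∀ x y → conj (x +ᶜ y) ≈ conj x +ᶜ conj y
    conj-+ = IsRingHomomorphism.+-homo conj-homomorphism

    conj-* : ∀ x y → conj (x *ᶜ y) ≈ conj x *ᶜ conj y
    conj-* = IsRingHomomorphism.*-homo conj-homomorphism

    conj-1 : conj 1# ≈ 1#
    conj-1 = IsRingHomomorphism.1#-homo conj-homomorphism

    conj-ℕ : ∀ n → conj (n ×ᶜ 1#) ≈ n ×ᶜ 1#
    conj-ℕ zero    = IsRingHomomorphism.0#-homo conj-homomorphism
    conj-ℕ (suc n) = trans (conj-+ 1# _) (+-cong conj-1 (conj-ℕ n))

    conj-ℤ : ∀ a → conj (ιℤ a) ≈ ιℤ a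
    conj-ℤ (+ n)    = conj-ℕ n
    conj-ℤ -[1+ n ] = trans (IsRingHomomorphism.-‿homo conj-homomorphism _) (-‿cong (conj-ℕ (suc n)))

    conj-ι : ∀ z → conj (ι z) ≈ ι (conjᵍ z)
    conj-ι (a , b) = begin
      conj (ιℤ a +ᶜ (ιℤ b *ᶜ i))            ≈⟨ trans (conj-+ _ _) (+-cong (conj-ℤ a) (trans (conj-* _ _) (*-cong (conj-ℤ b) conj-i))) ⟩
      ιℤ a +ᶜ (ιℤ b *ᶜ (-ᶜ i))              ≈⟨ +-congˡ (trans (sym (-‿distribʳ-* _ _)) (-‿distribˡ-* _ _)) ⟩
      ιℤ a +ᶜ ((-ᶜ ιℤ b) *ᶜ i)              ≈⟨ +-congˡ (*-congʳ (ιℤ-neg b)) ⟨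
      ιℤ a +ᶜ (ιℤ (ℤ.- b) *ᶜ i)             ∎

  gaussMorphism : gauss -Raw-AlmostCommutative⟶ fromCommutativeRing R
  gaussMorphism = record
    { ⟦_⟧ = ι ; +-homo = ι-+ ; *-homo = ι-* ; -‿homo = ι-neg ; 0-homo = ι-0 ; 1-homo = ι-1 }

  _≟ᵍ_ : ∀ (z w : Gauss) → Maybe (ι z ≈ ι w)
  (a , b) ≟ᵍ (c , d) with a ℤ.≟ c | b ℤ.≟ d
  ... | yes ≡.refl | yes ≡.refl = just refl
  ... | _          | _          = nothing

  module Solver = RingSolver gauss (fromCommutativeRing R) gaussMorphism _≟ᵍ_

  -- Scalars apart from zero

  #0⇒inverse : ∀ {x} → x # 0# → ∃ λ x⁻¹ → x⁻¹ *ᶜ x ≈ 1#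
  #0⇒inverse x#0 with x⁻¹ , p , _ ← #⇒invertible x#0 = x⁻¹ , trans (*-congˡ (sym (x-0≈x _))) p

  inverse⇒#0 : ∀ {x} y → y *ᶜ x ≈ 1# → x # 0#
  inverse⇒#0 y p = invertibleˡ⇒# (y , trans (*-congˡ (x-0≈x _)) p)

  *#0⇒#0ʳ : ∀ {x y} → x *ᶜ y # 0# → y # 0#
  *#0⇒#0ʳ xy#0 with z , p ← #0⇒inverse xy#0 = inverse⇒#0 (z *ᶜ _) (trans (*-assoc _ _ _) p)

  #0⇒≉0 : ∀ {x} → x # 0# → ¬ x ≈ 0#
  #0⇒≉0 x#0 x≈0 = proj₂ (tight _ _) x≈0 x#0

  -- The norm of `z` is a positive integer, hence nonzero in characteristic zero, and a factor of a
  -- nonzero product is nonzero. For a concrete `z` the norm equation holds by evaluation.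
  ι#0 : ∀ z n → conjᵍ z *ᵍ z ≡ (+ suc n , + 0) → ι z # 0#
  ι#0 z n p = *#0⇒#0ʳ (#-congʳ
    (trans (trans (sym (trans (+-congˡ (zeroˡ i)) (+-identityʳ _))) (reflexive (≡.cong ι (≡.sym p)))) (ι-* (conjᵍ z) z))
    (characteristic-zero n))

  cancelˡ : ∀ {x y z} → x # 0# → x *ᶜ y ≈ x *ᶜ z → y ≈ z
  cancelˡ {x} {y} {z} x#0 p with x⁻¹ , q ← #0⇒inverse x#0 =
    trans (sym (undo y)) (trans (*-congˡ p) (undo z))
    where
    undo : ∀ w → x⁻¹ *ᶜ (x *ᶜ w) ≈ w
    undo w = trans (sym (*-assoc _ _ _)) (trans (*-congʳ q) (*-identityˡ w))

  open Quantum K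
  open Solver using (solve; _:+_; _:*_; _:=_; con)

  -- Signs and phases

  sign : Bool → Gauss
  sign b = if b then -1ᵍ else 1ᵍ

  sgn : Bool → Carrier
  sgn b = ι (sign b)

  sgn-xor : ∀ a b → sgn (a xor b) ≈ sgn a *ᶜ sgn b
  sgn-xor a b = trans (reflexive (≡.cong ι (homo a b))) (ι-* (sign a) (sign b))
    where
    homo : ∀ a b → sign (a xor b) ≡ sign a *ᵍ sign b
    homo true  true  = ≡.refl
    homo true  false = ≡.refl
    homo false true  = ≡.refl
    homo false false = ≡.refl

  sgn#0 : ∀ b → sgn b # 0#
  sgn#0 true  = ι#0 -1ᵍ 0 ≡.refl
  sgn#0 false = ι#0 1ᵍ 0 ≡.refl

  sgn² : ∀ b → sgn b *ᶜ sgn b ≈ 1#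
  sgn² b = trans (sym (sgn-xor b b)) (trans (reflexive (≡.cong sgn (Bool.xor-same b))) ι-1)

  module Prod = Sum *-commutativeMonoid

  ∏ : (Fin N → Carrier) → Carrier
  ∏ = Prod.sum

  ∏-cong : {f g : Fin N → Carrier} → (∀ w → f w ≈ g w) → ∏ f ≈ ∏ g
  ∏-cong = Prod.sum-cong-≋

  ∏-* : (f g : Fin N → Carrier) → ∏ (λ w → f w *ᶜ g w) ≈ ∏ f *ᶜ ∏ g
  ∏-* = Prod.∑-distrib-+

  ∏-1 : ∏ {N} (λ _ → 1#) ≈ 1#
  ∏-1 {N} = Prod.sum-replicate-zero N

  ∏-sgn : (f : Fin N → Bool) → ∏ (sgn ∘ f) ≈ sgn (⨁ f)
  ∏-sgn {zero}  f = sym ι-1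
  ∏-sgn {suc N} f = trans (*-congˡ (∏-sgn (f ∘ suc))) (sym (sgn-xor (f zero) _))

  ∏#0 : {f : Fin N → Carrier} → (∀ w → f w # 0#) → ∏ f # 0#
  ∏#0 {zero}  p = 1#0
  ∏#0 {suc N} p = x#0y#0→xy#0 (p zero) (∏#0 (p ∘ suc))

  phase : Gauss → Bool → Carrier
  phase z b = ι (if b then z else 1ᵍ)

  sgn-^ : ∀ n → (-ᶜ 1#) ^ n ≈ sgn (odd n)
  sgn-^ zero    = sym ι-1
  sgn-^ (suc n) = begin
    (-ᶜ 1#) *ᶜ ((-ᶜ 1#) ^ n)   ≈⟨ *-cong (sym ι--1) (sgn-^ n) ⟩
    sgn true *ᶜ sgn (odd n)    ≈⟨ sgn-xor true (odd n) ⟨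
    sgn (not (odd n))          ∎

  graphState-edges : ∀ {S : Subset N} (G : Graph S) B → graphState G B ≈ sgn (edges G B)
  graphState-edges G B = trans (sgn-^ (edgeCount (induced G B)))
    (reflexive (≡.cong sgn (odd-edgeCount (induced G B))))

  graphState#0 : ∀ {S : Subset N} (G : Graph S) B → graphState G B # 0#
  graphState#0 G B = #-congʳ (sym (graphState-edges G B)) (sgn#0 (edges G B))

  graphState-cong : ∀ {S T : Subset N} {G : Graph S} {H : Graph T} {B} →
                    (∀ u w → adj (induced G B) u w ≡ adj (induced H B) u w) → graphState G B ≈ graphState H B
  graphState-cong {G = G} {H} {B} p = trans (graphState-edges G B)
    (trans (reflexive (≡.cong sgn (pairs-cong p))) (sym (graphState-edges H B)))

  -- The stabilizer of the graph state at `v` in terms of amplitudes: X at `v` acts like Z on all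
  -- neighbours of `v`.
  graphState-insert : ∀ {S : Subset N} (G : Graph S) v B →
    graphState G (B [ v ]≔ true) ≈ sgn (degree G v B) *ᶜ graphState G (B [ v ]≔ false)
  graphState-insert G v B = begin
    graphState G (B [ v ]≔ true)                           ≈⟨ graphState-edges G (B [ v ]≔ true) ⟩
    sgn (edges G (B [ v ]≔ true))                          ≡⟨ ≡.cong sgn (edges-insert G v B) ⟩
    sgn (edges G (B [ v ]≔ false) xor degree G v B)        ≈⟨ sgn-xor (edges G (B [ v ]≔ false)) (degree G v B) ⟩
    sgn (edges G (B [ v ]≔ false)) *ᶜ sgn (degree G v B)   ≈⟨ *-comm _ _ ⟩
    sgn (degree G v B) *ᶜ sgn (edges G (B [ v ]≔ false))   ≈⟨ *-congˡ (graphState-edges G (B [ v ]≔ false)) ⟨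
    sgn (degree G v B) *ᶜ graphState G (B [ v ]≔ false)    ∎

  -- Contraction of a state with a product of row vectors

  Row : Set c
  Row = Bool → Carrier

  contract : (Fin N → Row) → State N → Carrier
  contract {zero}  r ψ = ψ []
  contract {suc N} r ψ = (r zero false *ᶜ contract (r ∘ suc) (ψ ∘ (false ∷_)))
                      +ᶜ (r zero true  *ᶜ contract (r ∘ suc) (ψ ∘ (true ∷_)))

  contract-cong : ∀ {r r′ : Fin N → Row} {ψ φ : State N} → (∀ v b → r v b ≈ r′ v b) →
                  (∀ B → ψ B ≈ φ B) → contract r ψ ≈ contract r′ φ
  contract-cong {zero}  p q = q []
  contract-cong {suc N} p q =
    +-cong (*-cong (p zero false) (contract-cong (p ∘ suc) (q ∘ (false ∷_))))
           (*-cong (p zero true)  (contract-cong (p ∘ suc) (q ∘ (true ∷_))))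

  contract-+ : ∀ (r : Fin N → Row) (ψ φ : State N) x y →
    contract r (λ B → (x *ᶜ ψ B) +ᶜ (y *ᶜ φ B)) ≈ (x *ᶜ contract r ψ) +ᶜ (y *ᶜ contract r φ)
  contract-+ {zero}  r ψ φ x y = refl
  contract-+ {suc N} r ψ φ x y = trans
    (+-cong (*-congˡ (contract-+ (r ∘ suc) _ _ x y)) (*-congˡ (contract-+ (r ∘ suc) _ _ x y)))
    (solve 8 (λ p q x y a b c d → p :* (x :* a :+ y :* b) :+ q :* (x :* c :+ y :* d)
                               := x :* (p :* a :+ q :* c) :+ y :* (p :* b :+ q :* d)) refl
      (r zero false) (r zero true) x y _ _ _ _)

  contract-scale : ∀ (r : Fin N → Row) (ψ : State N) x → contract r (λ B → x *ᶜ ψ B) ≈ x *ᶜ contract r ψ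
  contract-scale {zero}  r ψ x = refl
  contract-scale {suc N} r ψ x = trans
    (+-cong (*-congˡ (contract-scale (r ∘ suc) _ x)) (*-congˡ (contract-scale (r ∘ suc) _ x)))
    (solve 5 (λ p q x a c → p :* (x :* a) :+ q :* (x :* c) := x :* (p :* a :+ q :* c)) refl
      (r zero false) (r zero true) x _ _)

  -- A product of diagonal one-qubit operators can be moved from the state to the rows.
  contract-∏ : ∀ (r d : Fin N → Row) (ψ : State N) →
    contract r (λ B → ∏ (λ w → d w (lookup B w)) *ᶜ ψ B) ≈ contract (λ w b → r w b *ᶜ d w b) ψ
  contract-∏ {zero}  r d ψ = *-identityˡ _
  contract-∏ {suc N} r d ψ = +-cong (term false) (term true)
    where
    term : ∀ b → r zero b *ᶜ contract (r ∘ suc) (λ B → (d zero b *ᶜ ∏ (λ w → d (suc w) (lookup B w))) *ᶜ ψ (b ∷ B))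
               ≈ (r zero b *ᶜ d zero b) *ᶜ contract (λ w b → r (suc w) b *ᶜ d (suc w) b) (ψ ∘ (b ∷_))
    term b = begin
      r zero b *ᶜ contract (r ∘ suc) (λ B → (d zero b *ᶜ ∏ (λ w → d (suc w) (lookup B w))) *ᶜ ψ (b ∷ B))
        ≈⟨ *-congˡ (contract-cong {N} (λ _ _ → refl) (λ B → *-assoc (d zero b) _ (ψ (b ∷ B)))) ⟩
      r zero b *ᶜ contract (r ∘ suc) (λ B → d zero b *ᶜ (∏ (λ w → d (suc w) (lookup B w)) *ᶜ ψ (b ∷ B)))
        ≈⟨ *-congˡ (contract-scale (r ∘ suc) _ (d zero b)) ⟩
      r zero b *ᶜ (d zero b *ᶜ contract (r ∘ suc) (λ B → ∏ (λ w → d (suc w) (lookup B w)) *ᶜ ψ (b ∷ B)))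
        ≈⟨ *-assoc _ _ _ ⟨
      (r zero b *ᶜ d zero b) *ᶜ contract (r ∘ suc) (λ B → ∏ (λ w → d (suc w) (lookup B w)) *ᶜ ψ (b ∷ B))
        ≈⟨ *-congˡ (contract-∏ (r ∘ suc) (d ∘ suc) (ψ ∘ (b ∷_))) ⟩
      (r zero b *ᶜ d zero b) *ᶜ contract (λ w b → r (suc w) b *ᶜ d (suc w) b) (ψ ∘ (b ∷_)) ∎

  contract-rows : ∀ (r : Fin N → Row) (x : Fin N → Carrier) (ψ : State N) →
    contract (λ w b → r w b *ᶜ x w) ψ ≈ ∏ x *ᶜ contract r ψ
  contract-rows r x ψ = trans (sym (contract-∏ r (λ w _ → x w) ψ)) (contract-scale r ψ (∏ x))

  infixl 6 _[_↦_]
  _[_↦_] : ∀ {ℓ} {A : Set ℓ} → (Fin N → A) → Fin N → A → Fin N → A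
  (r [ v ↦ ρ ]) w = if does (v ≟ w) then ρ else r w

  ↦-same : ∀ {ℓ} {A : Set ℓ} (r : Fin N → A) v ρ → (r [ v ↦ ρ ]) v ≡ ρ
  ↦-same r v ρ rewrite dec-true (v ≟ v) ≡.refl = ≡.refl

  ↦-other : ∀ {ℓ} {A : Set ℓ} (r : Fin N → A) {v w} ρ → v ≢ w → (r [ v ↦ ρ ]) w ≡ r w
  ↦-other r {v} {w} ρ p rewrite dec-false (v ≟ w) p = ≡.refl

  contract-linear : ∀ (r : Fin N → Row) v (ρ τ : Row) x y (ψ : State N) →
    contract (r [ v ↦ (λ b → (x *ᶜ ρ b) +ᶜ (y *ᶜ τ b)) ]) ψ
      ≈ (x *ᶜ contract (r [ v ↦ ρ ]) ψ) +ᶜ (y *ᶜ contract (r [ v ↦ τ ]) ψ)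
  contract-linear {suc N} r zero    ρ τ x y ψ =
    solve 8 (λ x y a b c d p q → (x :* a :+ y :* b) :* p :+ (x :* c :+ y :* d) :* q
                              := x :* (a :* p :+ c :* q) :+ y :* (b :* p :+ d :* q)) refl
      x y (ρ false) (τ false) (ρ true) (τ true) _ _
  contract-linear {suc N} r (suc v) ρ τ x y ψ = trans
    (+-cong (*-congˡ (contract-linear (r ∘ suc) v ρ τ x y _)) (*-congˡ (contract-linear (r ∘ suc) v ρ τ x y _)))
    (solve 8 (λ p q x y a b c d → p :* (x :* a :+ y :* b) :+ q :* (x :* c :+ y :* d)
                               := x :* (p :* a :+ q :* c) :+ y :* (p :* b :+ q :* d)) refl
      (r zero false) (r zero true) x y _ _ _ _)

  infixl 7 _⊙_
  _⊙_ : Row → Matrix → Row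
  (ρ ⊙ M) b = (ρ false *ᶜ M false b) +ᶜ (ρ true *ᶜ M true b)

  contract-applyGate : ∀ (r : Fin N → Row) M v (ψ : State N) →
    contract r (applyGate M v ψ) ≈ contract (r [ v ↦ r v ⊙ M ]) ψ
  contract-applyGate {suc N} r M zero    ψ = trans
    (+-cong (*-congˡ (contract-+ (r ∘ suc) _ _ _ _)) (*-congˡ (contract-+ (r ∘ suc) _ _ _ _)))
    (solve 8 (λ p q a b c d x y → p :* (a :* x :+ b :* y) :+ q :* (c :* x :+ d :* y)
                               := (p :* a :+ q :* c) :* x :+ (p :* b :+ q :* d) :* y) refl
      (r zero false) (r zero true) (M false false) (M false true) (M true false) (M true true) _ _)
  contract-applyGate {suc N} r M (suc v) ψ =
    +-cong (*-congˡ (contract-applyGate (r ∘ suc) M v _)) (*-congˡ (contract-applyGate (r ∘ suc) M v _))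

  -- The second argument is true for the eigenvalue -1.
  bra : Axis → Bool → Bool → Gauss
  bra X s     false = 1ᵍ
  bra X s     true  = sign s
  bra Y s     false = 1ᵍ
  bra Y false true  = -ᵍ iᵍ
  bra Y true  true  = iᵍ
  bra Z false false = 1ᵍ
  bra Z false true  = 0ᵍ
  bra Z true  false = 0ᵍ
  bra Z true  true  = 1ᵍ

  ⟨_,_∣ : Axis → Bool → Row
  ⟨ a , s ∣ b = ι (bra a s b)

  ⟨0∣ ⟨1∣ : Row
  ⟨0∣ = ⟨ Z , false ∣
  ⟨1∣ = ⟨ Z , true ∣

  -- A matrix with two equal rows makes `applyGate` the partial inner product with that row,
  -- whatever the bit at `v`. Measurements are later treated as gates by the same device.
  applyGate-⟨Z∣ : ∀ (v : Fin N) s (ψ : State N) B → applyGate (λ _ → ⟨ Z , s ∣) v ψ B ≈ ψ (B [ v ]≔ s)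
  applyGate-⟨Z∣ v false ψ B = solve 2 (λ x y → con 1ᵍ :* x :+ con 0ᵍ :* y := x) refl _ _
  applyGate-⟨Z∣ v true  ψ B = solve 2 (λ x y → con 0ᵍ :* x :+ con 1ᵍ :* y := y) refl _ _

  contract-⟨Z∣ : ∀ (r : Fin N → Row) v s (ψ : State N) →
    contract (r [ v ↦ ⟨ Z , s ∣ ]) ψ ≈ contract (r [ v ↦ ⟨0∣ ]) (λ B → ψ (B [ v ]≔ s))
  contract-⟨Z∣ r v s ψ = sym (begin
    contract (r [ v ↦ ⟨0∣ ]) (λ B → ψ (B [ v ]≔ s))
      ≈⟨ contract-cong (λ _ _ → refl) (λ B → sym (applyGate-⟨Z∣ v s ψ B)) ⟩
    contract (r [ v ↦ ⟨0∣ ]) (applyGate (λ _ → ⟨ Z , s ∣) v ψ)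
      ≈⟨ contract-applyGate (r [ v ↦ ⟨0∣ ]) (λ _ → ⟨ Z , s ∣) v ψ ⟩
    contract (r [ v ↦ ⟨0∣ ] [ v ↦ (r [ v ↦ ⟨0∣ ]) v ⊙ (λ _ → ⟨ Z , s ∣) ]) ψ
      ≈⟨ contract-cong rows (λ _ → refl) ⟩
    contract (r [ v ↦ ⟨ Z , s ∣ ]) ψ ∎)
    where
    rows : ∀ w b → (r [ v ↦ ⟨0∣ ] [ v ↦ (r [ v ↦ ⟨0∣ ]) v ⊙ (λ _ → ⟨ Z , s ∣) ]) w b ≈ (r [ v ↦ ⟨ Z , s ∣ ]) w b
    -- `⟨0∣` has the entries 1 and 0, so its product with a matrix of two equal rows is that row.
    rows w b rewrite ↦-same r v ⟨0∣ with does (v ≟ w)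
    ... | true  = solve 1 (λ x → con 1ᵍ :* x :+ con 0ᵍ :* x := x) refl _
    ... | false = refl

  -- Local complementation is a local Clifford operation

  -- Roots up to a scalar: `√X` is 1 + iX, whose square is 2iX. It is left unnormalized to stay
  -- within the Gaussian integers.
  √X √Z : Bool → Bool → Gauss
  √X false false = 1ᵍ
  √X false true  = iᵍ
  √X true  false = iᵍ
  √X true  true  = 1ᵍ
  √Z false false = 1ᵍ
  √Z false true  = 0ᵍ
  √Z true  false = 0ᵍ
  √Z true  true  = iᵍ

  ιᴹ : (Bool → Bool → Gauss) → Matrix
  ιᴹ M a b = ι (M a b)

  1+i : Carrier
  1+i = ι (1ᵍ +ᵍ iᵍ)

  -- For m ones in f, 1 + i (-1)^m = (1 + i) (-i)^m (-1)^(m choose 2).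
  gaussSum : (f : Fin N → Bool) →
    ι 1ᵍ +ᶜ (ι iᵍ *ᶜ sgn (⨁ f)) ≈ 1+i *ᶜ (∏ (phase (-ᵍ iᵍ) ∘ f) *ᶜ sgn (choose₂ f))
  gaussSum {zero}  f = trans (solve 0 (con 1ᵍ :+ con iᵍ :* con 1ᵍ := con (1ᵍ +ᵍ iᵍ) :* (con 1ᵍ :* con 1ᵍ)) refl)
    (*-congˡ (*-congʳ ι-1))
  gaussSum {suc N} f rewrite choose₂-suc f with f zero
  ... | false = trans (gaussSum (f ∘ suc))
    (solve 2 (λ p s → con (1ᵍ +ᵍ iᵍ) :* (p :* s) := con (1ᵍ +ᵍ iᵍ) :* ((con 1ᵍ :* p) :* s)) refl _ _)
  ... | true  = begin
    ι 1ᵍ +ᶜ (ι iᵍ *ᶜ sgn (true xor σ′))            ≈⟨ +-cong ι-1 (*-congˡ (sgn-xor true σ′)) ⟩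
    1# +ᶜ (ι iᵍ *ᶜ (sgn true *ᶜ s))                ≈⟨ +-congʳ (sgn² σ′) ⟨
    -- With s² = 1, the sum 1 - is factors as (-is)(1 + is). Here -i is the phase of the new one in
    -- `f`, and s the change of the binomial parity.
    (s *ᶜ s) +ᶜ (ι iᵍ *ᶜ (sgn true *ᶜ s))
      ≈⟨ solve 1 (λ s → s :* s :+ con iᵍ :* (con -1ᵍ :* s) := (con (-ᵍ iᵍ) :* s) :* (con 1ᵍ :+ con iᵍ :* s)) refl s ⟩
    (ι (-ᵍ iᵍ) *ᶜ s) *ᶜ (ι 1ᵍ +ᶜ (ι iᵍ *ᶜ s))      ≈⟨ *-congˡ (gaussSum (f ∘ suc)) ⟩
    (ι (-ᵍ iᵍ) *ᶜ s) *ᶜ (1+i *ᶜ (P *ᶜ C))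
      ≈⟨ solve 4 (λ s a p c → (con (-ᵍ iᵍ) :* s) :* (a :* (p :* c)) := a :* ((con (-ᵍ iᵍ) :* p) :* (s :* c))) refl s _ P C ⟩
    1+i *ᶜ ((ι (-ᵍ iᵍ) *ᶜ P) *ᶜ (s *ᶜ C))          ≈⟨ *-congˡ (*-congˡ (sgn-xor σ′ _)) ⟨
    1+i *ᶜ ((ι (-ᵍ iᵍ) *ᶜ P) *ᶜ sgn (σ′ xor choose₂ (f ∘ suc))) ∎
    where
    σ′ = ⨁ (f ∘ suc)
    s  = sgn σ′
    P  = ∏ (phase (-ᵍ iᵍ) ∘ f ∘ suc)
    C  = sgn (choose₂ (f ∘ suc))

  module _ {V : Subset N} (G : Graph V) (v : Fin N) where

    -- By the stabilizer at `v`, the operator X at `v` multiplies the amplitude at `B` by the sign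
    -- of the degree, so 1 + iX multiplies it by a number.
    applyGate-√X : ∀ B → applyGate (ιᴹ √X) v (graphState G) B
                       ≈ (ι 1ᵍ +ᶜ (ι iᵍ *ᶜ sgn (degree G v B))) *ᶜ graphState G B
    applyGate-√X B = trans (+-congˡ (*-congˡ (graphState-insert G v B))) (go (lookup B v) ≡.refl)
      where
      g = graphState G (B [ v ]≔ false)
      s = sgn (degree G v B)

      B≡ : ∀ {b} → lookup B v ≡ b → B [ v ]≔ b ≡ B
      B≡ p = ≡.trans (≡.cong (B [ v ]≔_) (≡.sym p)) ([]≔-lookup B v)

      go : ∀ b → lookup B v ≡ b → (ι (√X b false) *ᶜ g) +ᶜ (ι (√X b true) *ᶜ (s *ᶜ g))
           ≈ (ι 1ᵍ +ᶜ (ι iᵍ *ᶜ s)) *ᶜ graphState G B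
      go false p = begin
        (ι 1ᵍ *ᶜ g) +ᶜ (ι iᵍ *ᶜ (s *ᶜ g))
          ≈⟨ solve 2 (λ s g → con 1ᵍ :* g :+ con iᵍ :* (s :* g) := (con 1ᵍ :+ con iᵍ :* s) :* g) refl s g ⟩
        (ι 1ᵍ +ᶜ (ι iᵍ *ᶜ s)) *ᶜ g               ≈⟨ *-congˡ (reflexive (≡.cong (graphState G) (B≡ p))) ⟩
        (ι 1ᵍ +ᶜ (ι iᵍ *ᶜ s)) *ᶜ graphState G B    ∎
      go true p = begin
        (ι iᵍ *ᶜ g) +ᶜ (ι 1ᵍ *ᶜ (s *ᶜ g))
          ≈⟨ +-congʳ (*-congˡ (trans (*-congʳ (sgn² (degree G v B))) (*-identityˡ g))) ⟨
        (ι iᵍ *ᶜ ((s *ᶜ s) *ᶜ g)) +ᶜ (ι 1ᵍ *ᶜ (s *ᶜ g))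
          ≈⟨ solve 2 (λ s g → con iᵍ :* ((s :* s) :* g) :+ con 1ᵍ :* (s :* g) := (con 1ᵍ :+ con iᵍ :* s) :* (s :* g)) refl s g ⟩
        (ι 1ᵍ +ᶜ (ι iᵍ *ᶜ s)) *ᶜ (s *ᶜ g)
          ≈⟨ *-congˡ (trans (sym (graphState-insert G v B)) (reflexive (≡.cong (graphState G) (B≡ p)))) ⟩
        (ι 1ᵍ +ᶜ (ι iᵍ *ᶜ s)) *ᶜ graphState G B    ∎

    -- By `gaussSum`, the factor produced by `√X` consists of a phase -i for each neighbour in `B`
    -- and the sign of a binomial parity. The phases i cancel the former; the latter is the sign by
    -- which the two graph states differ.
    graphState-localComplement : ∀ B →
      ∏ (λ w → phase iᵍ (adj G v w ∧ lookup B w)) *ᶜ applyGate (ιᴹ √X) v (graphState G) B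
        ≈ 1+i *ᶜ graphState (localComplement v G) B
    graphState-localComplement B = begin
      P *ᶜ applyGate (ιᴹ √X) v (graphState G) B
        ≈⟨ *-congˡ (trans (applyGate-√X B) (*-congʳ (gaussSum f))) ⟩
      P *ᶜ ((1+i *ᶜ (P′ *ᶜ C)) *ᶜ graphState G B)
        ≈⟨ solve 5 (λ p q a c g → p :* ((a :* (q :* c)) :* g) := (p :* q) :* (a :* (c :* g))) refl P P′ _ C _ ⟩
      (P *ᶜ P′) *ᶜ (1+i *ᶜ (C *ᶜ graphState G B))
        ≈⟨ *-cong unit (*-congˡ lc) ⟩
      1# *ᶜ (1+i *ᶜ graphState (localComplement v G) B) ≈⟨ *-identityˡ _ ⟩
      1+i *ᶜ graphState (localComplement v G) B ∎
      where
      f : Fin N → Bool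
      f w = adj G v w ∧ lookup B w

      P  = ∏ (phase iᵍ ∘ f)
      P′ = ∏ (phase (-ᵍ iᵍ) ∘ f)
      C  = sgn (choose₂ f)

      cancel : ∀ b → phase iᵍ b *ᶜ phase (-ᵍ iᵍ) b ≈ 1#
      cancel true  = trans (sym (ι-* iᵍ (-ᵍ iᵍ))) ι-1
      cancel false = trans (sym (ι-* 1ᵍ 1ᵍ)) ι-1

      unit : P *ᶜ P′ ≈ 1#
      unit = trans (sym (∏-* (phase iᵍ ∘ f) (phase (-ᵍ iᵍ) ∘ f))) (trans (∏-cong (cancel ∘ f)) (∏-1 {N}))

      lc : C *ᶜ graphState G B ≈ graphState (localComplement v G) B
      lc = begin
        C *ᶜ graphState G B                       ≈⟨ *-comm _ _ ⟩
        graphState G B *ᶜ C                       ≈⟨ *-congʳ (graphState-edges G B) ⟩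
        sgn (edges G B) *ᶜ C                      ≈⟨ sgn-xor (edges G B) (choose₂ f) ⟨
        sgn (edges G B xor choose₂ f)             ≡⟨ ≡.cong sgn (edges-localComplement G v B) ⟨
        sgn (edges (localComplement v G) B)       ≈⟨ graphState-edges (localComplement v G) B ⟨
        graphState (localComplement v G) B        ∎

  -- The two rows of `E` lie on the two eigenlines of the axis `a`, and `t` tells which of them row
  -- `false` is on. The nonzero factors of the rows are independent of each other.
  Directed : Axis → Bool → Matrix → Set (c ⊔ ℓ₁ ⊔ ℓ₂)
  Directed a t E = ∀ β → ∃ λ x → x # 0# × ∀ b → E β b ≈ x *ᶜ ⟨ a , t xor β ∣ b

  𝟙ᵍ : Bool → Bool → Gauss
  𝟙ᵍ false false = 1ᵍ
  𝟙ᵍ false true  = 0ᵍ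
  𝟙ᵍ true  false = 0ᵍ
  𝟙ᵍ true  true  = 1ᵍ

  -- The gates of local complementation, by whether a vertex is the centre and
  -- whether it is a neighbour of the centre, and their action on the axes.
  lcGate : Bool → Bool → Bool → Bool → Gauss
  lcGate true  _     = √X
  lcGate false true  = √Z
  lcGate false false = 𝟙ᵍ

  turn : Bool → Bool → Axis → Axis
  turn true  _     X = X
  turn true  _     Y = Z
  turn true  _     Z = Y
  turn false true  X = Y
  turn false true  Y = X
  turn false true  Z = Z
  turn false false a = a

  -- Phrased within the Gaussian integers, so that every instance is checked by evaluation. The norm
  -- of `g` certifies that its image in the field is nonzero.
  Carries : (Bool → Bool → Gauss) → Axis → Axis → Set
  Carries L a a′ = ∃ λ t → ∀ s → ∃ λ g → (∃ λ n → conjᵍ g *ᵍ g ≡ (+ suc n , + 0)) ×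
    ∀ b → (bra a s false *ᵍ L false b) +ᵍ (bra a s true *ᵍ L true b) ≡ g *ᵍ bra a′ (t xor s) b

  lcGate-carries : ∀ p q a → Carries (lcGate p q) a (turn p q a)
  lcGate-carries true  _     X = false , λ
    { false → 1ᵍ +ᵍ iᵍ , (1 , ≡.refl) , λ { false → ≡.refl ; true → ≡.refl }
    ; true → 1ᵍ +ᵍ (-ᵍ iᵍ) , (1 , ≡.refl) , λ { false → ≡.refl ; true → ≡.refl } }
  lcGate-carries true  _     Y = false , λ
    { false → 1ᵍ +ᵍ 1ᵍ , (3 , ≡.refl) , λ { false → ≡.refl ; true → ≡.refl }
    ; true → iᵍ +ᵍ iᵍ , (3 , ≡.refl) , λ { false → ≡.refl ; true → ≡.refl } }
  lcGate-carries true  _     Z = true , λ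
    { false → 1ᵍ , (0 , ≡.refl) , λ { false → ≡.refl ; true → ≡.refl }
    ; true → iᵍ , (0 , ≡.refl) , λ { false → ≡.refl ; true → ≡.refl } }
  lcGate-carries false true  X = true , λ
    { false → 1ᵍ , (0 , ≡.refl) , λ { false → ≡.refl ; true → ≡.refl }
    ; true → 1ᵍ , (0 , ≡.refl) , λ { false → ≡.refl ; true → ≡.refl } }
  lcGate-carries false true  Y = false , λ
    { false → 1ᵍ , (0 , ≡.refl) , λ { false → ≡.refl ; true → ≡.refl }
    ; true → 1ᵍ , (0 , ≡.refl) , λ { false → ≡.refl ; true → ≡.refl } }
  lcGate-carries false true  Z = false , λ
    { false → 1ᵍ , (0 , ≡.refl) , λ { false → ≡.refl ; true → ≡.refl }
    ; true → iᵍ , (0 , ≡.refl) , λ { false → ≡.refl ; true → ≡.refl } }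
  lcGate-carries false false X = false , λ
    { false → 1ᵍ , (0 , ≡.refl) , λ { false → ≡.refl ; true → ≡.refl }
    ; true → 1ᵍ , (0 , ≡.refl) , λ { false → ≡.refl ; true → ≡.refl } }
  lcGate-carries false false Y = false , λ
    { false → 1ᵍ , (0 , ≡.refl) , λ { false → ≡.refl ; true → ≡.refl }
    ; true → 1ᵍ , (0 , ≡.refl) , λ { false → ≡.refl ; true → ≡.refl } }
  lcGate-carries false false Z = false , λ
    { false → 1ᵍ , (0 , ≡.refl) , λ { false → ≡.refl ; true → ≡.refl }
    ; true → 1ᵍ , (0 , ≡.refl) , λ { false → ≡.refl ; true → ≡.refl } }

  directed-⊙ : ∀ {L a a′ t E} → Directed a t E → Carries L a a′ → ∃ λ t′ → Directed a′ t′ (λ β → E β ⊙ ιᴹ L)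
  directed-⊙ {L} {a} {a′} {t} {E} d (t₀ , carries) = t₀ xor t , λ β → go β (d β) (carries (t xor β))
    where
    go : ∀ β → _ → _ → _
    go β (x , x#0 , p) (g , (n , norm) , q) = x *ᶜ ι g , x#0y#0→xy#0 x#0 (ι#0 g n norm) , λ b → begin
      (E β false *ᶜ ι (L false b)) +ᶜ (E β true *ᶜ ι (L true b))
        ≈⟨ +-cong (*-congʳ (p false)) (*-congʳ (p true)) ⟩
      ((x *ᶜ ι (bra a s false)) *ᶜ ι (L false b)) +ᶜ ((x *ᶜ ι (bra a s true)) *ᶜ ι (L true b))
        ≈⟨ solve 5 (λ x p q r s → (x :* p) :* q :+ (x :* r) :* s := x :* (p :* q :+ r :* s)) refl x _ _ _ _ ⟩
      x *ᶜ ((ι (bra a s false) *ᶜ ι (L false b)) +ᶜ (ι (bra a s true) *ᶜ ι (L true b)))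
        ≈⟨ *-congˡ (+-cong (ι-* (bra a s false) (L false b)) (ι-* (bra a s true) (L true b))) ⟨
      x *ᶜ (ι (bra a s false *ᵍ L false b) +ᶜ ι (bra a s true *ᵍ L true b))
        ≈⟨ *-congˡ (ι-+ (bra a s false *ᵍ L false b) (bra a s true *ᵍ L true b)) ⟨
      x *ᶜ ι ((bra a s false *ᵍ L false b) +ᵍ (bra a s true *ᵍ L true b))
        ≡⟨ ≡.cong (λ z → x *ᶜ ι z) (≡.trans (q b) (≡.cong (λ s → g *ᵍ bra a′ s b) (≡.sym (Bool.xor-assoc t₀ t β)))) ⟩
      x *ᶜ ι (g *ᵍ bra a′ ((t₀ xor t) xor β) b)
        ≈⟨ trans (*-congˡ (ι-* g (bra a′ ((t₀ xor t) xor β) b))) (sym (*-assoc _ _ _)) ⟩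
      (x *ᶜ ι g) *ᶜ ⟨ a′ , (t₀ xor t) xor β ∣ b ∎
      where
      s = t xor β

  module _ {V : Subset N} (G : Graph V) (v : Fin N) where

    private
      G* = localComplement v G

    localComplement-centre : ∀ w → adj G* v w ≡ adj G v w
    localComplement-centre w rewrite irrefl G v = Bool.xor-identityʳ _

    localComplement-involutive : ∀ u w → adj (localComplement v G*) u w ≡ adj G u w
    localComplement-involutive u w rewrite localComplement-centre u | localComplement-centre w =
      ≡.trans (Bool.xor-assoc (adj G u w) x x)
        (≡.trans (≡.cong (adj G u w xor_) (Bool.xor-same x)) (Bool.xor-identityʳ _))
      where
      x = (adj G v u ∧ adj G v w) ∧ not (does (u ≟ w))

    -- Complementing twice gives `G` back, so `graphState-localComplement` for the complement
    -- expresses the state of `G`. Its phases and `√X` then pass from the state to the rows.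
    contract-localComplement : ∀ (r : Fin N → Row) →
      1+i *ᶜ contract r (graphState G)
        ≈ contract (λ w → r w ⊙ ιᴹ (lcGate (does (v ≟ w)) (adj G v w))) (graphState G*)
    contract-localComplement r = begin
      1+i *ᶜ contract r (graphState G)                   ≈⟨ contract-scale r (graphState G) 1+i ⟨
      contract r (λ B → 1+i *ᶜ graphState G B)           ≈⟨ contract-cong (λ _ _ → refl) unfold ⟩
      contract r (λ B → ∏ (λ w → phase iᵍ (adj G v w ∧ lookup B w)) *ᶜ φ B)
        ≈⟨ contract-∏ r (λ w b → phase iᵍ (adj G v w ∧ b)) φ ⟩
      contract r′ φ                                      ≈⟨ contract-applyGate r′ (ιᴹ √X) v (graphState G*) ⟩
      contract (r′ [ v ↦ r′ v ⊙ ιᴹ √X ]) (graphState G*) ≈⟨ contract-cong rows (λ _ → refl) ⟩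
      contract (λ w → r w ⊙ ιᴹ (lcGate (does (v ≟ w)) (adj G v w))) (graphState G*) ∎
      where
      φ = applyGate (ιᴹ √X) v (graphState G*)

      r′ : Fin N → Row
      r′ w b = r w b *ᶜ phase iᵍ (adj G v w ∧ b)

      unfold : ∀ B → 1+i *ᶜ graphState G B ≈ ∏ (λ w → phase iᵍ (adj G v w ∧ lookup B w)) *ᶜ φ B
      unfold B = begin
        1+i *ᶜ graphState G B
          ≈⟨ *-congˡ (graphState-cong {G = localComplement v G*} {H = G} {B = B} (λ u w → ≡.cong (_∧ _) (localComplement-involutive u w))) ⟨
        1+i *ᶜ graphState (localComplement v G*) B
          ≈⟨ graphState-localComplement G* v B ⟨
        ∏ (λ w → phase iᵍ (adj G* v w ∧ lookup B w)) *ᶜ φ B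
          ≈⟨ *-congʳ (∏-cong {N} (λ w → reflexive (≡.cong (λ a → phase iᵍ (a ∧ lookup B w)) (localComplement-centre w)))) ⟩
        ∏ (λ w → phase iᵍ (adj G v w ∧ lookup B w)) *ᶜ φ B ∎

      rows : ∀ w b → (r′ [ v ↦ r′ v ⊙ ιᴹ √X ]) w b ≈ (r w ⊙ ιᴹ (lcGate (does (v ≟ w)) (adj G v w))) b
      rows w b with v ≟ w
      rows w b | yes ≡.refl rewrite irrefl G v = +-cong (*-congʳ (unit false)) (*-congʳ (unit true))
        where
        unit : ∀ b → r v b *ᶜ ι 1ᵍ ≈ r v b
        unit b = trans (*-congˡ ι-1) (*-identityʳ _)
      rows w b     | no _ with adj G v w
      rows w false | no _ | true  = solve 2 (λ x y → x :* con 1ᵍ := x :* con 1ᵍ :+ y :* con 0ᵍ) refl _ _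
      rows w true  | no _ | true  = solve 2 (λ x y → y :* con iᵍ := x :* con 0ᵍ :+ y :* con iᵍ) refl _ _
      rows w false | no _ | false = solve 2 (λ x y → x :* con 1ᵍ := x :* con 1ᵍ :+ y :* con 0ᵍ) refl _ _
      rows w true  | no _ | false = solve 2 (λ x y → y :* con 1ᵍ := x :* con 0ᵍ :+ y :* con 1ᵍ) refl _ _

  -- Up to a factor, the amplitudes of H are the overlaps of G with products of
  -- Pauli eigenvectors; the axis at w is b w.
  record Presentation {T : Subset N} (H : Graph T) {V : Subset N} (G : Graph V) (b : Fin N → Axis) :
                      Set (c ⊔ ℓ₁ ⊔ ℓ₂) where
    constructor presentation
    field
      rows       : Fin N → Matrix
      shift      : Fin N → Bool
      directed   : ∀ w → Directed (b w) (shift w) (rows w)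
      factor     : Carrier
      factor#0   : factor # 0#
      amplitudes : ∀ B → B ⊆ T → factor *ᶜ graphState H B ≈ contract (λ w → rows w (lookup B w)) (graphState G)

  complement-presentation : ∀ {T V : Subset N} {H : Graph T} {G : Graph V} {b} v → Presentation H G b →
    Presentation H (localComplement v G) (λ w → turn (does (v ≟ w)) (adj G v w) (b w))
  complement-presentation {G = G} {b = b} v (presentation E t d y y#0 amp) = record
    { rows       = λ w β → E w β ⊙ ιᴹ (lcGate (does (v ≟ w)) (adj G v w))
    ; shift      = λ w → proj₁ (turned w)
    ; directed   = λ w → proj₂ (turned w)
    ; factor     = 1+i *ᶜ y
    ; factor#0   = x#0y#0→xy#0 (ι#0 (1ᵍ +ᵍ iᵍ) 1 ≡.refl) y#0
    ; amplitudes = λ B B⊆T → trans (*-assoc _ _ _) (trans (*-congˡ (amp B B⊆T)) (contract-localComplement G v _))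
    }
    where
    turned : ∀ w → ∃ λ t′ → Directed (turn (does (v ≟ w)) (adj G v w) (b w)) t′
      (λ β → E w β ⊙ ιᴹ (lcGate (does (v ≟ w)) (adj G v w)))
    turned w = directed-⊙ {lcGate (does (v ≟ w)) (adj G v w)} {b w} {turn (does (v ≟ w)) (adj G v w) (b w)} {t w} {E w}
      (d w) (lcGate-carries (does (v ≟ w)) (adj G v w) (b w))

  module _ {T V : Subset N} {H : Graph T} {G : Graph V} {b : Fin N → Axis} (p : Presentation H G b) (v : Fin N)
           (b-v : b v ≡ X) (nbrs : ∀ w → adj G v w ≡ true → b w ≡ Z) where

    open Presentation p renaming (rows to E; shift to t; directed to d; factor to y)

    private
      -- The parity of the number of neighbours of v projected on |1⟩.
      ones : Subset N → Bool
      ones B = ⨁ (λ w → adj G v w ∧ (t w xor lookup B w))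

      row : Subset N → Fin N → Row
      row B w = E w (lookup B w)

      x : Bool → Carrier
      x β = proj₁ (d v β)

      E-v : ∀ β b → E v β b ≈ x β *ᶜ ⟨ X , t v xor β ∣ b
      E-v β b = trans (proj₂ (proj₂ (d v β)) b) (reflexive (≡.cong (λ a → x β *ᶜ ⟨ a , t v xor β ∣ b) b-v))

      C : Subset N → Carrier
      C B = contract (row B [ v ↦ ⟨0∣ ]) (graphState G)

      -- Switching `v` on multiplies an amplitude by a sign for each neighbour that is on. As the
      -- row at a neighbour is a multiple of `⟨0∣` or `⟨1∣`, it fixes the bit there, and the sign
      -- becomes a constant.
      contract-⟨1∣ : ∀ B → contract (row B [ v ↦ ⟨1∣ ]) (graphState G) ≈ sgn (ones B) *ᶜ C B
      contract-⟨1∣ B = begin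
        contract (row B [ v ↦ ⟨1∣ ]) (graphState G)
          ≈⟨ contract-⟨Z∣ (row B) v true (graphState G) ⟩
        contract r₀ (λ B′ → graphState G (B′ [ v ]≔ true))
          ≈⟨ contract-cong {N} (λ _ _ → refl) (λ B′ → trans (graphState-insert G v B′)
               (*-congʳ (sym (∏-sgn (λ w → adj G v w ∧ lookup B′ w))))) ⟩
        contract r₀ (λ B′ → ∏ (λ w → sgn (adj G v w ∧ lookup B′ w)) *ᶜ graphState G (B′ [ v ]≔ false))
          ≈⟨ contract-∏ r₀ (λ w b → sgn (adj G v w ∧ b)) (λ B′ → graphState G (B′ [ v ]≔ false)) ⟩
        contract (λ w b → r₀ w b *ᶜ sgn (adj G v w ∧ b)) (λ B′ → graphState G (B′ [ v ]≔ false))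
          ≈⟨ contract-cong {N} absorb (λ _ → refl) ⟩
        contract (λ w b → r₀ w b *ᶜ κ w) (λ B′ → graphState G (B′ [ v ]≔ false))
          ≈⟨ contract-rows r₀ κ _ ⟩
        ∏ κ *ᶜ contract r₀ (λ B′ → graphState G (B′ [ v ]≔ false))
          ≈⟨ *-cong (∏-sgn (λ w → adj G v w ∧ (t w xor lookup B w))) (sym (contract-⟨Z∣ (row B) v false (graphState G))) ⟩
        sgn (ones B) *ᶜ C B ∎
        where
        r₀ = row B [ v ↦ ⟨0∣ ]

        κ : Fin N → Carrier
        κ w = sgn (adj G v w ∧ (t w xor lookup B w))

        ⟨Z∣-sgn : ∀ s b → ⟨ Z , s ∣ b *ᶜ sgn b ≈ ⟨ Z , s ∣ b *ᶜ sgn s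
        ⟨Z∣-sgn false false = refl
        ⟨Z∣-sgn false true  = solve 0 (con 0ᵍ :* con -1ᵍ := con 0ᵍ :* con 1ᵍ) refl
        ⟨Z∣-sgn true  false = solve 0 (con 0ᵍ :* con 1ᵍ := con 0ᵍ :* con -1ᵍ) refl
        ⟨Z∣-sgn true  true  = refl

        absorb : ∀ w b → r₀ w b *ᶜ sgn (adj G v w ∧ b) ≈ r₀ w b *ᶜ κ w
        absorb w b with v ≟ w | adj G v w in eq
        ... | yes ≡.refl | true  with () ← ≡.trans (≡.sym eq) (irrefl G v)
        ... | _          | false = refl
        ... | no _       | true  with z , _ , q ← d w (lookup B w) = begin
          E w (lookup B w) b *ᶜ sgn b                     ≈⟨ *-congʳ (trans (q b) (reflexive (≡.cong (λ a → z *ᶜ ⟨ a , s ∣ b) (nbrs w eq)))) ⟩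
          (z *ᶜ ⟨ Z , s ∣ b) *ᶜ sgn b                     ≈⟨ *-assoc _ _ _ ⟩
          z *ᶜ (⟨ Z , s ∣ b *ᶜ sgn b)                     ≈⟨ *-congˡ (⟨Z∣-sgn s b) ⟩
          z *ᶜ (⟨ Z , s ∣ b *ᶜ sgn s)                     ≈⟨ *-assoc _ _ _ ⟨
          (z *ᶜ ⟨ Z , s ∣ b) *ᶜ sgn s                     ≈⟨ *-congʳ (trans (q b) (reflexive (≡.cong (λ a → z *ᶜ ⟨ a , s ∣ b) (nbrs w eq)))) ⟨
          E w (lookup B w) b *ᶜ sgn s                     ∎
          where
          s = t w xor lookup B w

      -- The row at `v` is a multiple of `⟨0∣` plus or minus `⟨1∣`, and the contributions of the two
      -- differ only by the sign in `contract-⟨1∣`.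
      amplitude : ∀ B → contract (row B) (graphState G)
        ≈ (x (lookup B v) *ᶜ C B) +ᶜ (x (lookup B v) *ᶜ (sgn ((t v xor lookup B v) xor ones B) *ᶜ C B))
      amplitude B = begin
        contract (row B) (graphState G)
          ≈⟨ contract-cong {N} split (λ _ → refl) ⟩
        contract (row B [ v ↦ (λ b → (z *ᶜ ⟨0∣ b) +ᶜ ((z *ᶜ sgn s) *ᶜ ⟨1∣ b)) ]) (graphState G)
          ≈⟨ contract-linear (row B) v ⟨0∣ ⟨1∣ z (z *ᶜ sgn s) (graphState G) ⟩
        (z *ᶜ C B) +ᶜ ((z *ᶜ sgn s) *ᶜ contract (row B [ v ↦ ⟨1∣ ]) (graphState G))
          ≈⟨ +-congˡ (*-congˡ (contract-⟨1∣ B)) ⟩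
        (z *ᶜ C B) +ᶜ ((z *ᶜ sgn s) *ᶜ (sgn (ones B) *ᶜ C B))
          ≈⟨ +-congˡ (solve 4 (λ z s m q → (z :* s) :* (m :* q) := z :* ((s :* m) :* q)) refl z _ _ _) ⟩
        (z *ᶜ C B) +ᶜ (z *ᶜ ((sgn s *ᶜ sgn (ones B)) *ᶜ C B))
          ≈⟨ +-congˡ (*-congˡ (*-congʳ (sgn-xor s (ones B)))) ⟨
        (z *ᶜ C B) +ᶜ (z *ᶜ (sgn (s xor ones B) *ᶜ C B)) ∎
        where
        s = t v xor lookup B v
        z = x (lookup B v)

        split : ∀ w b → row B w b ≈ (row B [ v ↦ (λ b → (z *ᶜ ⟨0∣ b) +ᶜ ((z *ᶜ sgn s) *ᶜ ⟨1∣ b)) ]) w b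
        split w b with v ≟ w
        ... | no _ = refl
        split w false | yes ≡.refl = trans (E-v (lookup B v) false)
          (solve 2 (λ z s → z :* con 1ᵍ := z :* con 1ᵍ :+ (z :* s) :* con 0ᵍ) refl z (sgn s))
        split w true  | yes ≡.refl = trans (E-v (lookup B v) true)
          (solve 2 (λ z s → z :* s := z :* con 0ᵍ :+ (z :* s) :* con 1ᵍ) refl z (sgn s))

      -- Otherwise the two terms of `amplitude` cancel, whereas a graph state has no vanishing
      -- amplitude.
      nonzero : ∀ B → B ⊆ T → (t v xor lookup B v) xor ones B ≡ false
      nonzero B B⊆T = Bool.¬-not λ s≡true → #0⇒≉0 (x#0y#0→xy#0 factor#0 (graphState#0 H B))
        (trans (amplitudes B B⊆T) (trans (amplitude B) (cancel (x (lookup B v)) (C B) s≡true)))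
        where
        cancel : ∀ z q {s} → s ≡ true → (z *ᶜ q) +ᶜ (z *ᶜ (sgn s *ᶜ q)) ≈ 0#
        cancel z q ≡.refl = trans (solve 2 (λ z q → z :* q :+ z :* (con -1ᵍ :* q) := con 0ᵍ) refl z q) ι-0

      -- If `v` were in `T`, then `nonzero` would apply to the empty set and to the set of `v`
      -- alone. Between them the bit of `v` changes but `ones` does not, since `v` is not its own
      -- neighbour.
      ∉T : ¬ v ∈ T
      ∉T v∈T = case ≡.trans (≡.sym nonzero₁) (≡.cong not nonzero₀) of λ ()
        where
        nonzero₀ : t v xor ones ⊥ ≡ false
        nonzero₀ = ≡.trans (≡.cong (_xor ones ⊥) (≡.sym
            (≡.trans (≡.cong (t v xor_) (lookup-replicate v false)) (Bool.xor-identityʳ (t v)))))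
          (nonzero ⊥ (⊥-elim ∘ ∉⊥))

        same : ones (⊥ [ v ]≔ true) ≡ ones ⊥
        same = ⨁-cong {N} term
          where
          term : ∀ w → adj G v w ∧ (t w xor lookup (⊥ [ v ]≔ true) w) ≡ adj G v w ∧ (t w xor lookup ⊥ w)
          term w with v ≟ w
          ... | yes ≡.refl rewrite irrefl G v = ≡.refl
          ... | no v≢w rewrite lookup∘update′ (v≢w ∘ ≡.sym) ⊥ true = ≡.refl

        B⊆T : ⊥ [ v ]≔ true ⊆ T
        B⊆T {w} m with v ≟ w
        ... | yes ≡.refl = v∈T
        ... | no v≢w = contradiction
          (true⇒∈ {S = ⊥} (≡.trans (≡.sym (lookup∘update′ (v≢w ∘ ≡.sym) ⊥ true)) (∈⇒true m))) (∉⊥ {x = w})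

        nonzero₁ : not (t v xor ones ⊥) ≡ false
        nonzero₁ = ≡.trans (≡.trans (≡.cong (not ∘ (t v xor_)) (≡.sym same))
            (≡.trans (Bool.not-distribˡ-xor (t v) _) (≡.cong (_xor ones (⊥ [ v ]≔ true))
              (≡.sym (≡.trans (≡.cong (t v xor_) (lookup∘update v ⊥ true)) (Bool.xor-comm (t v) true))))))
          (nonzero (⊥ [ v ]≔ true) B⊆T)

    -- Once its neighbours are projected on |0⟩ or |1⟩, v is left in the state
    -- |+⟩ or |-⟩.  As no amplitude of H vanishes, this is always the state whose
    -- overlap with the row at v is nonzero, and then |0⟩ does as well.
    isolated-presentation : Presentation H G (b [ v ↦ Z ])
    isolated-presentation = record
      { rows       = E′
      ; shift      = t [ v ↦ false ]
      ; directed   = directed′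
      ; factor     = y
      ; factor#0   = factor#0
      ; amplitudes = λ B B⊆T → trans (amplitudes B B⊆T) (trans (amplitude B)
          (amp B (∉⇒false (∉T ∘ B⊆T)) (nonzero B B⊆T) (∉⇒false (∉T ∘ B⊆T))))
      }
      where
      -- The two terms of `amplitude` are now equal, so the row at `v` acts as twice `x false` times
      -- `⟨0∣`, kept as a sum to match `contract-linear`. As `v` is outside `T`, row `true` is free
      -- and is filled with `⟨1∣` to stay directed.
      ρ : Matrix
      ρ β b = (x false *ᶜ ⟨ Z , β ∣ b) +ᶜ (x false *ᶜ ⟨ Z , β ∣ b)

      E′ : Fin N → Matrix
      E′ = E [ v ↦ ρ ]

      directed′ : ∀ w → Directed ((b [ v ↦ Z ]) w) ((t [ v ↦ false ]) w) (E′ w)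
      directed′ w with v ≟ w
      ... | yes _ = λ β → ι (1ᵍ +ᵍ 1ᵍ) *ᶜ x false ,
        x#0y#0→xy#0 (ι#0 (1ᵍ +ᵍ 1ᵍ) 3 ≡.refl) (proj₁ (proj₂ (d v false))) ,
        λ b → solve 2 (λ x p → x :* p :+ x :* p := (con (1ᵍ +ᵍ 1ᵍ) :* x) :* p) refl (x false) _
      ... | no _  = d w

      rows′ : ∀ B → lookup B v ≡ false → ∀ w b → (row B [ v ↦ ρ false ]) w b ≈ E′ w (lookup B w) b
      rows′ B p w b with v ≟ w
      ... | yes ≡.refl = reflexive (≡.cong (λ β → ρ β b) (≡.sym p))
      ... | no _       = refl

      amp : ∀ B {β s} → β ≡ false → s ≡ false → lookup B v ≡ false →
        (x β *ᶜ C B) +ᶜ (x β *ᶜ (sgn s *ᶜ C B)) ≈ contract (λ w → E′ w (lookup B w)) (graphState G)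
      amp B ≡.refl ≡.refl p = begin
        (x false *ᶜ C B) +ᶜ (x false *ᶜ (sgn false *ᶜ C B))
          ≈⟨ +-congˡ (*-congˡ (trans (*-congʳ ι-1) (*-identityˡ _))) ⟩
        (x false *ᶜ C B) +ᶜ (x false *ᶜ C B)
          ≈⟨ contract-linear (row B) v ⟨0∣ ⟨0∣ (x false) (x false) (graphState G) ⟨
        contract (row B [ v ↦ ρ false ]) (graphState G)
          ≈⟨ contract-cong {N} (rows′ B p) (λ _ → refl) ⟩
        contract (λ w → E′ w (lookup B w)) (graphState G) ∎

  -- The case in which all axes are Z

  contract-basis : ∀ (s : Fin N → Bool) (ψ : State N) → contract (λ w → ⟨ Z , s w ∣) ψ ≈ ψ (tabulate s)
  contract-basis {zero}  s ψ = refl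
  contract-basis {suc N} s ψ with s zero
  ... | false = trans (solve 2 (λ x y → con 1ᵍ :* x :+ con 0ᵍ :* y := x) refl _ _)
                      (contract-basis (s ∘ suc) (ψ ∘ (false ∷_)))
  ... | true  = trans (solve 2 (λ x y → con 0ᵍ :* x :+ con 1ᵍ :* y := y) refl _ _)
                      (contract-basis (s ∘ suc) (ψ ∘ (true ∷_)))

  sgn-distinct : ¬ sgn false ≈ sgn true
  sgn-distinct p = #0⇒≉0 (ι#0 (1ᵍ +ᵍ 1ᵍ) 3 ≡.refl)
    (trans (ι-+ 1ᵍ 1ᵍ) (trans (+-congˡ p) (trans (sym (ι-+ 1ᵍ -1ᵍ)) ι-0)))

  sgn-injective : ∀ {a b} → sgn a ≈ sgn b → a ≡ b
  sgn-injective {true}  {true}  _ = ≡.refl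
  sgn-injective {false} {false} _ = ≡.refl
  sgn-injective {true}  {false} p = contradiction (sym p) sgn-distinct
  sgn-injective {false} {true}  p = contradiction p sgn-distinct

  module _ {V : Subset N} (G : Graph V) {u w : Fin N} (C : Subset N) where

    edgesAt : Bool → Bool → Bool
    edgesAt a b = edges G (C [ w ]≔ a [ u ]≔ b)

    -- The parity of the edges is a quadratic form in the indicator of the vertex set; its mixed
    -- second difference at `u` and `w` is the coefficient of that pair.
    edgesAt-sum : (edgesAt true true xor edgesAt false false) xor (edgesAt true false xor edgesAt false true) ≡ adj G u w
    edgesAt-sum
      rewrite edges-insert G u (C [ w ]≔ true) | edges-insert G u (C [ w ]≔ false)
            | degree-update G u w C true | Bool.∧-identityʳ (adj G u w) =
      xor-solve 4 (λ p q d a → ((p :⊕ (d :⊕ a)) :⊕ q)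
          :⊕ (p :⊕ (q :⊕ d)) :≡ a) ≡.refl
        (edgesAt true false) (edgesAt false false) (degree G u (C [ w ]≔ false)) (adj G u w)

    -- Flipping one of the bits everywhere only permutes the four corners of the second difference.
    edgesAt-shift : ∀ s t → (edgesAt (s xor true) (t xor true) xor edgesAt (s xor false) (t xor false))
                        xor (edgesAt (s xor true) (t xor false) xor edgesAt (s xor false) (t xor true)) ≡ adj G u w
    edgesAt-shift s t = ≡.trans (go s t) edgesAt-sum
      where
      p = edgesAt true true
      q = edgesAt true false
      r = edgesAt false true
      z = edgesAt false false

      go : ∀ s t → (edgesAt (s xor true) (t xor true) xor edgesAt (s xor false) (t xor false))
               xor (edgesAt (s xor true) (t xor false) xor edgesAt (s xor false) (t xor true))
                 ≡ (p xor z) xor (q xor r)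
      go false false = ≡.refl
      go false true  = Bool.xor-comm (q xor r) (p xor z)
      go true  false = ≡.trans (≡.cong₂ _xor_ (Bool.xor-comm r q) (Bool.xor-comm z p)) (Bool.xor-comm (q xor r) (p xor z))
      go true  true  = ≡.cong₂ _xor_ (Bool.xor-comm z p) (Bool.xor-comm r q)

  xor-exchange : ∀ s s′ r r′ → s xor r′ ≡ r xor s′ → s xor s′ ≡ r xor r′
  xor-exchange false s′    false r′    q = ≡.sym q
  xor-exchange false false true  true  q = ≡.refl
  xor-exchange false true  true  false q = ≡.refl
  xor-exchange true  false false true  q = ≡.refl
  xor-exchange true  true  false false q = ≡.refl
  xor-exchange true  s′    true  r′    q = ≡.sym q

  -- Multiplied crosswise, both equations carry the same factor `y` times `p`. Cancelling it leaves
  -- a relation between signs alone, although the factors are unknown.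
  cross : ∀ {y p : Carrier} (s s′ r r′ : Bool) → y # 0# → p # 0# →
          y *ᶜ sgn s ≈ p *ᶜ sgn r → y *ᶜ sgn s′ ≈ p *ᶜ sgn r′ → s xor s′ ≡ r xor r′
  cross {y} {p} s s′ r r′ y#0 p#0 e e′ = xor-exchange s s′ r r′ (sgn-injective (cancelˡ (x#0y#0→xy#0 y#0 p#0) (begin
    (y *ᶜ p) *ᶜ sgn (s xor r′)              ≈⟨ *-congˡ (sgn-xor s r′) ⟩
    (y *ᶜ p) *ᶜ (sgn s *ᶜ sgn r′)           ≈⟨ solve 4 (λ y p a b → (y :* p) :* (a :* b) := (y :* a) :* (p :* b)) refl y p _ _ ⟩
    (y *ᶜ sgn s) *ᶜ (p *ᶜ sgn r′)           ≈⟨ *-cong e (sym e′) ⟩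
    (p *ᶜ sgn r) *ᶜ (y *ᶜ sgn s′)           ≈⟨ solve 4 (λ y p a b → (p :* a) :* (y :* b) := (y :* p) :* (a :* b)) refl y p _ _ ⟩
    (y *ᶜ p) *ᶜ (sgn r *ᶜ sgn s′)           ≈⟨ *-congˡ (sgn-xor r s′) ⟨
    (y *ᶜ p) *ᶜ sgn (r xor s′)              ∎)))

  module _ {T V : Subset N} {H : Graph T} {G : Graph V} {b : Fin N → Axis} (p : Presentation H G b)
           (b≡Z : ∀ w → b w ≡ Z) where

    open Presentation p renaming (rows to E; shift to t; directed to d; factor to y)

    private
      x : Fin N → Bool → Carrier
      x w β = proj₁ (d w β)

      -- With only Z axes the overlap is a single amplitude of `G`, taken at the translate of `B` by
      -- `t`, times the factors of the rows.
      translated : ∀ B → B ⊆ T → y *ᶜ sgn (edges H B)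
        ≈ ∏ (λ v → x v (lookup B v)) *ᶜ sgn (edges G (tabulate (λ v → t v xor lookup B v)))
      translated B B⊆T = begin
        y *ᶜ sgn (edges H B)                                ≈⟨ *-congˡ (graphState-edges H B) ⟨
        y *ᶜ graphState H B                                 ≈⟨ amplitudes B B⊆T ⟩
        contract (λ v → E v (lookup B v)) (graphState G)    ≈⟨ contract-cong {N} rows′ (λ _ → refl) ⟩
        contract (λ v b → ⟨ Z , s v ∣ b *ᶜ x v (lookup B v)) (graphState G) ≈⟨ contract-rows (λ v → ⟨ Z , s v ∣) (λ v → x v (lookup B v)) _ ⟩
        P *ᶜ contract (λ v → ⟨ Z , s v ∣) (graphState G)    ≈⟨ *-congˡ (contract-basis s (graphState G)) ⟩
        P *ᶜ graphState G (tabulate s)                      ≈⟨ *-congˡ (graphState-edges G (tabulate s)) ⟩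
        P *ᶜ sgn (edges G (tabulate s))                     ∎
        where
        s : Fin N → Bool
        s v = t v xor lookup B v

        P = ∏ (λ v → x v (lookup B v))

        rows′ : ∀ v b → E v (lookup B v) b ≈ ⟨ Z , s v ∣ b *ᶜ x v (lookup B v)
        rows′ v b = trans (proj₂ (proj₂ (d v (lookup B v))) b)
          (trans (reflexive (≡.cong (λ a → x v (lookup B v) *ᶜ ⟨ a , s v ∣ b) (b≡Z v))) (*-comm _ _))

      module _ {u w : Fin N} (u∈T : u ∈ T) (w∈T : w ∈ T) (u≢w : u ≢ w) where

        B : Bool → Bool → Subset N
        B a b = ⊥ [ w ]≔ a [ u ]≔ b

        B⊆T : ∀ a b → B a b ⊆ T
        B⊆T a b {v} m with v ≟ u | v ≟ w
        ... | yes ≡.refl | _          = u∈T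
        ... | no _       | yes ≡.refl = w∈T
        ... | no v≢u     | no v≢w     = contradiction (true⇒∈ {S = ⊥} (≡.trans (≡.sym
          (≡.trans (lookup∘update′ v≢u (⊥ [ w ]≔ a) b) (lookup∘update′ v≢w ⊥ a))) (∈⇒true m))) (∉⊥ {x = v})

        C : Subset N
        C = tabulate t

        translate : ∀ a b → tabulate (λ v → t v xor lookup (B a b) v) ≡ C [ w ]≔ (t w xor a) [ u ]≔ (t u xor b)
        translate a b = ≡.trans (tabulate-cong same) (tabulate∘lookup _)
          where
          same : ∀ v → t v xor lookup (B a b) v ≡ lookup (C [ w ]≔ (t w xor a) [ u ]≔ (t u xor b)) v
          same v with v ≟ u | v ≟ w
          ... | yes ≡.refl | _ rewrite lookup∘update v (⊥ [ w ]≔ a) b =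
            ≡.sym (lookup∘update v (C [ w ]≔ (t w xor a)) _)
          ... | no v≢u | yes ≡.refl
            rewrite lookup∘update′ v≢u (⊥ [ v ]≔ a) b | lookup∘update v ⊥ a
                  | lookup∘update′ v≢u (C [ v ]≔ (t v xor a)) (t u xor b) = ≡.sym (lookup∘update v C _)
          ... | no v≢u | no v≢w
            rewrite lookup∘update′ v≢u (⊥ [ w ]≔ a) b | lookup∘update′ v≢w ⊥ a
                  | lookup∘update′ v≢u (C [ w ]≔ (t w xor a)) (t u xor b) | lookup∘update′ v≢w C (t w xor a)
                  | lookup-replicate v false | lookup∘tabulate t v = Bool.xor-identityʳ (t v)

        P : Bool → Bool → Carrier
        P a b = ∏ (λ v → x v (lookup (B a b) v))

        e g : Bool → Bool → Bool
        e a b = edges H (B a b)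
        g a b = edges G (C [ w ]≔ (t w xor a) [ u ]≔ (t u xor b))

        at : ∀ a b → y *ᶜ sgn (e a b) ≈ P a b *ᶜ sgn (g a b)
        at a b = trans (translated (B a b) (B⊆T a b)) (*-congˡ (reflexive (≡.cong (sgn ∘ edges G) (translate a b))))

        pair : ∀ a b a′ b′ → (y *ᶜ y) *ᶜ sgn (e a b xor e a′ b′) ≈ (P a b *ᶜ P a′ b′) *ᶜ sgn (g a b xor g a′ b′)
        pair a b a′ b′ = begin
          (y *ᶜ y) *ᶜ sgn (e a b xor e a′ b′)                      ≈⟨ *-congˡ (sgn-xor (e a b) (e a′ b′)) ⟩
          (y *ᶜ y) *ᶜ (sgn (e a b) *ᶜ sgn (e a′ b′))               ≈⟨ regroup _ _ _ _ ⟩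
          (y *ᶜ sgn (e a b)) *ᶜ (y *ᶜ sgn (e a′ b′))               ≈⟨ *-cong (at a b) (at a′ b′) ⟩
          (P a b *ᶜ sgn (g a b)) *ᶜ (P a′ b′ *ᶜ sgn (g a′ b′))     ≈⟨ regroup _ _ _ _ ⟨
          (P a b *ᶜ P a′ b′) *ᶜ (sgn (g a b) *ᶜ sgn (g a′ b′))     ≈⟨ *-congˡ (sgn-xor (g a b) (g a′ b′)) ⟨
          (P a b *ᶜ P a′ b′) *ᶜ sgn (g a b xor g a′ b′)            ∎
          where
          regroup : ∀ y z a b → (y *ᶜ z) *ᶜ (a *ᶜ b) ≈ (y *ᶜ a) *ᶜ (z *ᶜ b)
          regroup = solve 4 (λ y z a b → (y :* z) :* (a :* b) := (y :* a) :* (z :* b)) refl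

        -- Vertex by vertex, the two products have the same factors.
        balanced : P true false *ᶜ P false true ≈ P true true *ᶜ P false false
        balanced = trans (sym (∏-* (F true false) (F false true)))
          (trans (∏-cong {N} same) (∏-* (F true true) (F false false)))
          where
          F : Bool → Bool → Fin N → Carrier
          F a b v = x v (lookup (B a b) v)

          same : ∀ v → x v (lookup (B true false) v) *ᶜ x v (lookup (B false true) v)
                     ≈ x v (lookup (B true true) v) *ᶜ x v (lookup (B false false) v)
          same v with v ≟ u
          ... | yes ≡.refl rewrite lookup∘update v (⊥ [ w ]≔ true) false | lookup∘update v (⊥ [ w ]≔ false) true
                                 | lookup∘update v (⊥ [ w ]≔ true) true | lookup∘update v (⊥ [ w ]≔ false) false = *-comm _ _
          ... | no v≢u     rewrite lookup∘update′ v≢u (⊥ [ w ]≔ true) false | lookup∘update′ v≢u (⊥ [ w ]≔ false) true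
                                 | lookup∘update′ v≢u (⊥ [ w ]≔ true) true | lookup∘update′ v≢u (⊥ [ w ]≔ false) false = refl

        P#0 : ∀ a b → P a b # 0#
        P#0 a b = ∏#0 (λ v → proj₁ (proj₂ (d v (lookup (B a b) v))))

        -- By `balanced`, the unknown factors at opposite corners have the same product, so `cross`
        -- makes the second differences of `H` and of the translated `G` equal. Either one is an
        -- adjacency.
        same-adj : adj G u w ≡ adj H u w
        same-adj = ≡.trans (≡.sym (edgesAt-shift G {u} {w} C (t w) (t u)))
          (≡.trans (≡.sym (cross (e true true xor e false false) (e true false xor e false true)
              (g true true xor g false false) (g true false xor g false true)
              (x#0y#0→xy#0 factor#0 factor#0) (x#0y#0→xy#0 (P#0 true true) (P#0 false false))
              (pair true true false false) (trans (pair true false false true) (*-congʳ balanced))))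
            (edgesAt-sum H {u} {w} ⊥))

    Z-presentation-agrees : ∀ {u w} → u ∈ T → w ∈ T → adj G u w ≡ adj H u w
    Z-presentation-agrees {u} {w} u∈T w∈T with u ≟ w
    ... | yes ≡.refl = ≡.trans (irrefl G u) (≡.sym (irrefl H u))
    ... | no u≢w     = same-adj u∈T w∈T u≢w

  -- Make the axes at the vertices of the list Z one by one, without moving an
  -- axis that is Z already.
  presentation⇒minor : ∀ {T : Subset N} {H : Graph T} {G : Graph (⊤ {N})} {b} → Presentation H G b → H IsVertexMinorOf G
  presentation⇒minor {N} {T} {H} {G} {b} p = sweep (allFin N) G b p (λ w _ → ∈-allFin w)
    where
    remaining : ∀ {v vs} {b b′ : Fin N → Axis} → (∀ w → b w ≢ Z → w ∈ˡ v ∷ vs) → b′ v ≡ Z →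
                (∀ w → w ≢ v → b w ≡ Z → b′ w ≡ Z) → (∀ w → b′ w ≢ Z → w ∈ˡ vs)
    remaining {v} {b = b} rest b′v keep w q with w ≟ v
    ... | yes ≡.refl = contradiction b′v q
    ... | no w≢v with rest w (q ∘ keep w w≢v)
    ...   | here w≡v = contradiction w≡v w≢v
    ...   | there m  = m

    turn-Z : ∀ a → turn false a Z ≡ Z
    turn-Z true  = ≡.refl
    turn-Z false = ≡.refl

    turned-Z : ∀ (G : Graph (⊤ {N})) v {b : Fin N → Axis} w → w ≢ v → b w ≡ Z →
               turn (does (v ≟ w)) (adj G v w) (b w) ≡ Z
    turned-Z G v w w≢v q rewrite q | dec-false (v ≟ w) (w≢v ∘ ≡.sym) = turn-Z (adj G v w)

    _≟Z : ∀ a → Dec (a ≡ Z)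
    X ≟Z = no λ ()
    Y ≟Z = no λ ()
    Z ≟Z = yes ≡.refl

    sweep : ∀ (vs : List (Fin N)) (G : Graph (⊤ {N})) b → Presentation H G b → (∀ w → b w ≢ Z → w ∈ˡ vs) →
            H IsVertexMinorOf G
    sweep [] G b p rest = agreeing-minor (λ _ → ∈⊤) (Z-presentation-agrees p (λ w → case b w ≟Z of
      λ { (yes q) → q ; (no q) → case rest w q of λ () }))

    sweep (v ∷ vs) G b p rest with b v in eq | Fin.any? (λ u → (adj G v u Bool.≟ true) ×-dec ¬? (b u ≟Z))
    ... | Z | _ = sweep vs G b p (remaining rest eq (λ _ _ q → q))
    ... | Y | _ = complement v ∈⊤ (sweep vs _ _ (complement-presentation v p) (remaining rest b′v (turned-Z G v)))
      where
      b′v : turn (does (v ≟ v)) (adj G v v) (b v) ≡ Z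
      b′v rewrite dec-true (v ≟ v) ≡.refl | eq = ≡.refl
    ... | X | no none = sweep vs G (b [ v ↦ Z ]) (isolated-presentation p v eq nbrs)
      (remaining rest (↦-same b v Z) (λ w w≢v q → ≡.trans (↦-other b Z (w≢v ∘ ≡.sym)) q))
      where
      nbrs : ∀ w → adj G v w ≡ true → b w ≡ Z
      nbrs w a with b w ≟Z
      ... | yes q = q
      ... | no q  = contradiction (w , a , q) none
    -- Complementing at `u` makes the axis at `v` a Y, and complementing at `v` then makes it Z. The
    -- centre is the only vertex whose axis Z is moved by a complementation, so an axis other than Z
    -- at `u` ensures that no Z is lost.
    ... | X | yes (u , a , bu≢Z) = complement u ∈⊤ (complement v ∈⊤
      (sweep vs _ _ (complement-presentation v (complement-presentation u p)) (remaining rest b″v keep)))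
      where
      b′ : Fin N → Axis
      b′ w = turn (does (u ≟ w)) (adj G u w) (b w)

      b″v : turn (does (v ≟ v)) (adj (localComplement u G) v v) (b′ v) ≡ Z
      b″v rewrite dec-true (v ≟ v) ≡.refl | dec-false (u ≟ v) (adj⇒≢ G a ∘ ≡.sym) | symm G u v | a | eq = ≡.refl

      keep : ∀ w → w ≢ v → b w ≡ Z → turn (does (v ≟ w)) (adj (localComplement u G) v w) (b′ w) ≡ Z
      keep w w≢v q = turned-Z (localComplement u G) v {b′} w w≢v (turned-Z G u {b} w (λ { ≡.refl → bu≢Z q }) q)

  -- Matrices

  ·-cong : ∀ {U U′ W W′ : Matrix} → U ≈ᴹ U′ → W ≈ᴹ W′ → U · W ≈ᴹ U′ · W′
  ·-cong p q a b = +-cong (*-cong (p a false) (q false b)) (*-cong (p a true) (q true b))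

  ·-assoc : ∀ (U V W : Matrix) → (U · V) · W ≈ᴹ U · (V · W)
  ·-assoc U V W a b = solve 8 (λ p q x y z w r s → (p :* x :+ q :* z) :* r :+ (p :* y :+ q :* w) :* s
                                                := p :* (x :* r :+ y :* s) :+ q :* (z :* r :+ w :* s)) refl
    (U a false) (U a true) (V false false) (V false true) (V true false) (V true true) (W false b) (W true b)

  ᴹ-trans : ∀ {U V W : Matrix} → U ≈ᴹ V → V ≈ᴹ W → U ≈ᴹ W
  ᴹ-trans p q a b = trans (p a b) (q a b)

  ᴹ-sym : ∀ {U V : Matrix} → U ≈ᴹ V → V ≈ᴹ U
  ᴹ-sym p a b = sym (p a b)

  ᴹ-refl : ∀ {U : Matrix} → U ≈ᴹ U
  ᴹ-refl a b = refl

  ·-identityˡ : ∀ (U : Matrix) → 𝟙 · U ≈ᴹ U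
  ·-identityˡ U false b = trans (+-cong (*-identityˡ _) (zeroˡ _)) (+-identityʳ _)
  ·-identityˡ U true  b = trans (+-cong (zeroˡ _) (*-identityˡ _)) (+-identityˡ _)

  ·-identityʳ : ∀ (U : Matrix) → U · 𝟙 ≈ᴹ U
  ·-identityʳ U a false = trans (+-cong (*-identityʳ _) (zeroʳ _)) (+-identityʳ _)
  ·-identityʳ U a true  = trans (+-cong (zeroʳ _) (*-identityʳ _)) (+-identityˡ _)

  •-cong : ∀ {x} {U W : Matrix} → U ≈ᴹ W → x • U ≈ᴹ x • W
  •-cong p a b = *-congˡ (p a b)

  ·-•ʳ : ∀ x (U W : Matrix) → U · (x • W) ≈ᴹ x • (U · W)
  ·-•ʳ x U W a b = solve 5 (λ x p q r s → p :* (x :* r) :+ q :* (x :* s) := x :* (p :* r :+ q :* s)) refl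
    x (U a false) (U a true) (W false b) (W true b)

  ·-•ˡ : ∀ x (U W : Matrix) → (x • U) · W ≈ᴹ x • (U · W)
  ·-•ˡ x U W a b = solve 5 (λ x p q r s → (x :* p) :* r :+ (x :* q) :* s := x :* (p :* r :+ q :* s)) refl
    x (U a false) (U a true) (W false b) (W true b)

  -- Pauli matrices

  σᵍ : Axis → Bool → Bool → Gauss
  σᵍ X false false = 0ᵍ
  σᵍ X false true  = 1ᵍ
  σᵍ X true  false = 1ᵍ
  σᵍ X true  true  = 0ᵍ
  σᵍ Y false false = 0ᵍ
  σᵍ Y false true  = -ᵍ iᵍ
  σᵍ Y true  false = iᵍ
  σᵍ Y true  true  = 0ᵍ
  σᵍ Z false false = 1ᵍ
  σᵍ Z false true  = 0ᵍ
  σᵍ Z true  false = 0ᵍ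
  σᵍ Z true  true  = -1ᵍ

  ι--i : ι (-ᵍ iᵍ) ≈ -ᶜ i
  ι--i = trans (ι-neg iᵍ) (-‿cong ι-i)

  σ≈ : ∀ a → σ a ≈ᴹ ιᴹ (σᵍ a)
  σ≈ X false false = sym ι-0
  σ≈ X false true  = sym ι-1
  σ≈ X true  false = sym ι-1
  σ≈ X true  true  = sym ι-0
  σ≈ Y false false = sym ι-0
  σ≈ Y false true  = sym ι--i
  σ≈ Y true  false = sym ι-i
  σ≈ Y true  true  = sym ι-0
  σ≈ Z false false = sym ι-1
  σ≈ Z false true  = sym ι-0
  σ≈ Z true  false = sym ι-0
  σ≈ Z true  true  = sym ι--1

  𝟙≈ : 𝟙 ≈ᴹ ιᴹ 𝟙ᵍ
  𝟙≈ false false = sym ι-1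
  𝟙≈ false true  = sym ι-0
  𝟙≈ true  false = sym ι-0
  𝟙≈ true  true  = sym ι-1

  infixl 7 _·ᵍ_
  _·ᵍ_ : (Bool → Bool → Gauss) → (Bool → Bool → Gauss) → Bool → Bool → Gauss
  (M ·ᵍ L) a b = (M a false *ᵍ L false b) +ᵍ (M a true *ᵍ L true b)

  ιᴹ-· : ∀ M L → ιᴹ (M ·ᵍ L) ≈ᴹ ιᴹ M · ιᴹ L
  ιᴹ-· M L a b = trans (ι-+ (M a false *ᵍ L false b) (M a true *ᵍ L true b))
    (+-cong (ι-* (M a false) (L false b)) (ι-* (M a true) (L true b)))

  σ² : ∀ a → σ a · σ a ≈ᴹ 𝟙
  σ² a = ᴹ-trans (·-cong (σ≈ a) (σ≈ a)) (ᴹ-trans (ᴹ-sym (ιᴹ-· (σᵍ a) (σᵍ a)))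
    (ᴹ-trans (λ r c → reflexive (≡.cong ι (square a r c))) (ᴹ-sym 𝟙≈)))
    where
    square : ∀ a r c → (σᵍ a ·ᵍ σᵍ a) r c ≡ 𝟙ᵍ r c
    square X false false = ≡.refl
    square X false true  = ≡.refl
    square X true  false = ≡.refl
    square X true  true  = ≡.refl
    square Y false false = ≡.refl
    square Y false true  = ≡.refl
    square Y true  false = ≡.refl
    square Y true  true  = ≡.refl
    square Z false false = ≡.refl
    square Z false true  = ≡.refl
    square Z true  false = ≡.refl
    square Z true  true  = ≡.refl

  bra-eigen : ∀ a s b → (⟨ a , s ∣ ⊙ σ a) b ≈ sgn s *ᶜ ⟨ a , s ∣ b
  bra-eigen a s b = trans (+-cong (*-congˡ (σ≈ a false b)) (*-congˡ (σ≈ a true b)))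
    (trans (+-cong (sym (ι-* (bra a s false) (σᵍ a false b))) (sym (ι-* (bra a s true) (σᵍ a true b))))
      (trans (sym (ι-+ (bra a s false *ᵍ σᵍ a false b) (bra a s true *ᵍ σᵍ a true b)))
        (trans (reflexive (≡.cong ι (eigen a s b))) (ι-* (sign s) (bra a s b)))))
    where
    eigen : ∀ a s b → (bra a s false *ᵍ σᵍ a false b) +ᵍ (bra a s true *ᵍ σᵍ a true b) ≡ sign s *ᵍ bra a s b
    eigen X false false = ≡.refl
    eigen X false true  = ≡.refl
    eigen X true  false = ≡.refl
    eigen X true  true  = ≡.refl
    eigen Y false false = ≡.refl
    eigen Y false true  = ≡.refl
    eigen Y true  false = ≡.refl
    eigen Y true  true  = ≡.refl
    eigen Z false false = ≡.refl
    eigen Z false true  = ≡.refl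
    eigen Z true  false = ≡.refl
    eigen Z true  true  = ≡.refl

  double-zero : ∀ {x} → x ≈ -ᶜ x → x ≈ 0#
  double-zero {x} p = cancelˡ (ι#0 (1ᵍ +ᵍ 1ᵍ) 3 ≡.refl) (begin
    ι (1ᵍ +ᵍ 1ᵍ) *ᶜ x   ≈⟨ solve 1 (λ x → con (1ᵍ +ᵍ 1ᵍ) :* x := x :+ x) refl x ⟩
    x +ᶜ x              ≈⟨ +-congˡ p ⟩
    x +ᶜ (-ᶜ x)         ≈⟨ -‿inverseʳ x ⟩
    0#                  ≈⟨ zeroʳ _ ⟨
    ι (1ᵍ +ᵍ 1ᵍ) *ᶜ 0#  ∎)

  -- The eigenspaces of a Pauli matrix are lines. For Z the entry that should vanish equals its own
  -- negative, which settles it since 2 is invertible.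
  eigenrow : ∀ a u (r : Row) → (∀ b → (r ⊙ σ a) b ≈ sgn u *ᶜ r b) → ∃ λ x → ∀ b → r b ≈ x *ᶜ ⟨ a , u ∣ b
  eigenrow X u r p = r false , λ
    { false → sym (trans (*-congˡ ι-1) (*-identityʳ _))
    ; true  → begin
        r true                                     ≈⟨ trans (+-cong (zeroʳ _) (*-identityʳ _)) (+-identityˡ _) ⟨
        (r ⊙ σ X) false                            ≈⟨ p false ⟩
        sgn u *ᶜ r false                           ≈⟨ *-comm _ _ ⟩
        r false *ᶜ sgn u                           ∎ }
  eigenrow Y u r p = r false , λ
    { false → sym (trans (*-congˡ ι-1) (*-identityʳ _))
    ; true  → cancelˡ (sgn#0 u) (begin
        sgn u *ᶜ r true                            ≈⟨ p true ⟨
        (r false *ᶜ (-ᶜ i)) +ᶜ (r true *ᶜ 0#)      ≈⟨ trans (+-congˡ (zeroʳ _)) (+-identityʳ _) ⟩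
        r false *ᶜ (-ᶜ i)                          ≈⟨ *-congˡ ι--i ⟨
        r false *ᶜ ι (-ᵍ iᵍ)                       ≈⟨ *-congˡ (trans (reflexive (≡.cong ι (signed-i u))) (ι-* (sign u) (bra Y u true))) ⟩
        r false *ᶜ (sgn u *ᶜ ⟨ Y , u ∣ true)       ≈⟨ solve 3 (λ x s y → x :* (s :* y) := s :* (x :* y)) refl (r false) (sgn u) (⟨ Y , u ∣ true) ⟩
        sgn u *ᶜ (r false *ᶜ ⟨ Y , u ∣ true)       ∎) }
    where
    signed-i : ∀ u → -ᵍ iᵍ ≡ sign u *ᵍ bra Y u true
    signed-i true  = ≡.refl
    signed-i false = ≡.refl
  eigenrow Z false r p = r false , λ
    { false → sym (trans (*-congˡ ι-1) (*-identityʳ _))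
    ; true  → trans (double-zero (begin
        r true                  ≈⟨ trans (*-congʳ ι-1) (*-identityˡ _) ⟨
        sgn false *ᶜ r true     ≈⟨ p true ⟨
        (r ⊙ σ Z) true          ≈⟨ Z-true r ⟩
        -ᶜ r true               ∎)) (sym (trans (*-congˡ ι-0) (zeroʳ _))) }
    where
    Z-true : ∀ (r : Row) → (r ⊙ σ Z) true ≈ -ᶜ r true
    Z-true r = trans (+-cong (zeroʳ _) (trans (sym (-‿distribʳ-* _ _)) (-‿cong (*-identityʳ _)))) (+-identityˡ _)
  eigenrow Z true r p = r true , λ
    { false → trans (double-zero (begin
        r false                 ≈⟨ trans (+-cong (*-identityʳ _) (zeroʳ _)) (+-identityʳ _) ⟨
        (r ⊙ σ Z) false         ≈⟨ p false ⟩
        sgn true *ᶜ r false     ≈⟨ trans (*-congʳ ι--1) (trans (sym (-‿distribˡ-* _ _)) (-‿cong (*-identityˡ _))) ⟩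
        -ᶜ r false              ∎)) (sym (trans (*-congˡ ι-0) (zeroʳ _)))
    ; true  → sym (trans (*-congˡ ι-1) (*-identityʳ _)) }

  i^-cases : ∀ k → (∃ λ t → (i ^ k) ≈ sgn t) ⊎ (∃ λ t → (i ^ k) ≈ ι iᵍ *ᶜ sgn t)
  i^-cases zero = inj₁ (false , sym ι-1)
  i^-cases (suc k) with i^-cases k
  ... | inj₁ (t , p) = inj₂ (t , *-cong (sym ι-i) p)
  ... | inj₂ (t , p) = inj₁ (not t , (begin
    i *ᶜ (i ^ k)                       ≈⟨ *-cong (sym ι-i) p ⟩
    ι iᵍ *ᶜ (ι iᵍ *ᶜ sgn t)            ≈⟨ solve 1 (λ s → con iᵍ :* (con iᵍ :* s) := con -1ᵍ :* s) refl (sgn t) ⟩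
    sgn true *ᶜ sgn t                  ≈⟨ sgn-xor true t ⟨
    sgn (not t)                        ∎))

  i^#0 : ∀ k → (i ^ k) # 0#
  i^#0 k with i^-cases k
  ... | inj₁ (t , p) = #-congʳ (sym p) (sgn#0 t)
  ... | inj₂ (t , p) = #-congʳ (sym p) (x#0y#0→xy#0 (ι#0 iᵍ 0 ≡.refl) (sgn#0 t))

  i^²≈1 : ∀ k → (i ^ k) *ᶜ (i ^ k) ≈ 1# → ∃ λ t → (i ^ k) ≈ sgn t
  i^²≈1 k p with i^-cases k
  ... | inj₁ r       = r
  ... | inj₂ (t , q) = contradiction (begin
    sgn false                                  ≈⟨ trans ι-1 (sym p) ⟩
    (i ^ k) *ᶜ (i ^ k)                         ≈⟨ *-cong q q ⟩
    (ι iᵍ *ᶜ sgn t) *ᶜ (ι iᵍ *ᶜ sgn t)         ≈⟨ solve 1 (λ s → (con iᵍ :* s) :* (con iᵍ :* s) := con -1ᵍ :* (s :* s)) refl (sgn t) ⟩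
    sgn true *ᶜ (sgn t *ᶜ sgn t)               ≈⟨ trans (*-congˡ (sgn² t)) (*-identityʳ _) ⟩
    sgn true                                   ∎) sgn-distinct

  -- Cliffords permute the Pauli axes

  0≉1 : ¬ 0# ≈ 1#
  0≉1 p = #0⇒≉0 1#0 (sym p)

  σ≉scalar : ∀ a x → ¬ σ a ≈ᴹ x • 𝟙
  σ≉scalar X x p = 0≉1 (sym (trans (p false true) (zeroʳ x)))
  σ≉scalar Y x p = #0⇒≉0 (ι#0 (-ᵍ iᵍ) 0 ≡.refl) (trans ι--i (trans (p false true) (zeroʳ x)))
  σ≉scalar Z x p = sgn-distinct (trans ι-1 (trans (p false false) (trans (sym (p true true)) (sym ι--1))))

  σ-distinct : ∀ a b x y → x # 0# → y # 0# → x • σ a ≈ᴹ y • σ b → a ≡ b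
  σ-distinct X X x y x#0 y#0 p = ≡.refl
  σ-distinct Y Y x y x#0 y#0 p = ≡.refl
  σ-distinct Z Z x y x#0 y#0 p = ≡.refl
  σ-distinct X Z x y x#0 y#0 p = contradiction (trans (sym (*-identityʳ y)) (trans (sym (p false false)) (zeroʳ x))) (#0⇒≉0 y#0)
  σ-distinct Y Z x y x#0 y#0 p = contradiction (trans (sym (*-identityʳ y)) (trans (sym (p false false)) (zeroʳ x))) (#0⇒≉0 y#0)
  σ-distinct Z X x y x#0 y#0 p = contradiction (trans (sym (*-identityʳ x)) (trans (p false false) (zeroʳ y))) (#0⇒≉0 x#0)
  σ-distinct Z Y x y x#0 y#0 p = contradiction (trans (sym (*-identityʳ x)) (trans (p false false) (zeroʳ y))) (#0⇒≉0 x#0)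
  σ-distinct X Y x y x#0 y#0 p = contradiction (double-zero (trans (sym (*-identityʳ x))
    (trans (p false true) (trans (sym (-‿distribʳ-* y i)) (-‿cong (trans (sym (p true false)) (*-identityʳ x))))))) (#0⇒≉0 x#0)
  σ-distinct Y X x y x#0 y#0 p = contradiction (double-zero (trans (sym (*-identityʳ y))
    (trans (sym (p false true)) (trans (sym (-‿distribʳ-* x i)) (-‿cong (trans (p true false) (*-identityʳ y))))))) (#0⇒≉0 y#0)

  index : Axis → Fin 3
  index X = zero
  index Y = suc zero
  index Z = suc (suc zero)

  index-injective : ∀ {a b} → index a ≡ index b → a ≡ b
  index-injective {X} {X} _ = ≡.refl
  index-injective {Y} {Y} _ = ≡.refl
  index-injective {Z} {Z} _ = ≡.refl

  -- Two of the four axes `b`, `π X`, `π Y`, `π Z` coincide, and by injectivity one of the two must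
  -- be `b`.
  axes-surjective : ∀ (π : Axis → Axis) → (∀ {a b} → π a ≡ π b → a ≡ b) → ∀ b → ∃ λ a → π a ≡ b
  axes-surjective π inj b = find (Fin.pigeonhole (n<1+n 3) f)
    where
    f : Fin 4 → Fin 3
    f zero                      = index b
    f (suc zero)                = index (π X)
    f (suc (suc zero))          = index (π Y)
    f (suc (suc (suc zero)))    = index (π Z)

    find : (∃ λ i → ∃ λ j → i Data.Fin.< j × f i ≡ f j) → ∃ λ a → π a ≡ b
    find (zero , suc zero , _ , p)             = X , ≡.sym (index-injective p)
    find (zero , suc (suc zero) , _ , p)       = Y , ≡.sym (index-injective p)
    find (zero , suc (suc (suc zero)) , _ , p) = Z , ≡.sym (index-injective p)
    find (suc zero , suc (suc zero) , _ , p)       = case inj (index-injective p) of λ ()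
    find (suc zero , suc (suc (suc zero)) , _ , p) = case inj (index-injective p) of λ ()
    find (suc (suc zero) , suc (suc (suc zero)) , _ , p) = case inj (index-injective p) of λ ()
    find (suc zero , suc zero , ℕ.s≤s () , _)
    find (suc (suc zero) , suc zero , ℕ.s≤s () , _)
    find (suc (suc zero) , suc (suc zero) , ℕ.s≤s (ℕ.s≤s ()) , _)
    find (suc (suc (suc zero)) , suc zero , ℕ.s≤s () , _)
    find (suc (suc (suc zero)) , suc (suc zero) , ℕ.s≤s (ℕ.s≤s ()) , _)
    find (suc (suc (suc zero)) , suc (suc (suc zero)) , ℕ.s≤s (ℕ.s≤s (ℕ.s≤s ())) , _)

  -- All that is remembered about the product of gates at a qubit. It is closed under products, and
  -- it determines the axis left behind by a later measurement.
  PermutesBras : Matrix → Set (c ⊔ ℓ₁ ⊔ ℓ₂)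
  PermutesBras D = ∀ a → ∃ λ a′ → ∃ λ t → Directed a′ t (λ s → ⟨ a , s ∣ ⊙ D)

  module _ {U : Matrix} (clifford : IsClifford U) where
    open IsClifford clifford

    private
      intertwine : ∀ a {M} → U · σ a · U † ≈ᴹ M → U · σ a ≈ᴹ M · U
      intertwine a {M} p = ᴹ-trans (ᴹ-sym (·-identityʳ (U · σ a))) (ᴹ-trans (·-cong (ᴹ-refl {U · σ a}) (ᴹ-sym U†U≈𝟙))
        (ᴹ-trans (ᴹ-sym (·-assoc (U · σ a) (U †) U)) (·-cong p (ᴹ-refl {U}))))

      cancel-U : ∀ {M L : Matrix} → U · M ≈ᴹ U · L → M ≈ᴹ L
      cancel-U {M} {L} p = ᴹ-trans (ᴹ-sym (undo M)) (ᴹ-trans (·-cong (ᴹ-refl {U †}) p) (undo L))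
        where
        undo : ∀ M → U † · (U · M) ≈ᴹ M
        undo M = ᴹ-trans (ᴹ-sym (·-assoc (U †) U M)) (ᴹ-trans (·-cong U†U≈𝟙 (ᴹ-refl {M})) (·-identityˡ M))

      -- If `U` conjugated `σ a` to a scalar, `σ a` would be that scalar itself, which excludes the
      -- `scalar` case. Moving the adjoint to the other side leaves an equation in `U` alone.
      conjugate : ∀ a → ∃ λ b → ∃ λ k → U · σ a ≈ᴹ (i ^ k) • (σ b · U)
      conjugate a with normalizes (σ a) (pauli 0 a (λ _ _ → sym (*-identityˡ _)))
      ... | pauli k b p = b , k , ᴹ-trans (intertwine a p) (·-•ˡ (i ^ k) (σ b) U)
      ... | scalar k p  = contradiction (cancel-U (ᴹ-trans (intertwine a p) (ᴹ-trans (·-•ˡ (i ^ k) 𝟙 U)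
        (ᴹ-trans (•-cong {i ^ k} {𝟙 · U} {U · 𝟙} (ᴹ-trans (·-identityˡ U) (ᴹ-sym (·-identityʳ U)))) (ᴹ-sym (·-•ʳ (i ^ k) U 𝟙))))))
        (σ≉scalar a (i ^ k))

      π : Axis → Axis
      π a = proj₁ (conjugate a)

      π-injective : ∀ {a b} → π a ≡ π b → a ≡ b
      π-injective {a} {b} q with conjugate a | conjugate b
      π-injective {a} {b} ≡.refl | d , k , p | _ , l , p′ =
        σ-distinct a b (i ^ l) (i ^ k) (i^#0 l) (i^#0 k) (cancel-U (λ r c → begin
          (U · ((i ^ l) • σ a)) r c                 ≈⟨ ·-•ʳ (i ^ l) U (σ a) r c ⟩
          (i ^ l) *ᶜ (U · σ a) r c                  ≈⟨ *-congˡ (p r c) ⟩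
          (i ^ l) *ᶜ ((i ^ k) *ᶜ (σ d · U) r c)     ≈⟨ solve 3 (λ l k s → l :* (k :* s) := k :* (l :* s)) refl (i ^ l) (i ^ k) ((σ d · U) r c) ⟩
          (i ^ k) *ᶜ ((i ^ l) *ᶜ (σ d · U) r c)     ≈⟨ *-congˡ (p′ r c) ⟨
          (i ^ k) *ᶜ (U · σ b) r c                  ≈⟨ ·-•ʳ (i ^ k) U (σ b) r c ⟨
          (U · ((i ^ k) • σ b)) r c                 ∎))

      -- Using the relation twice, with both Pauli matrices of square 1, gives x² U = U. So a phase
      -- that is a power of i is a sign, and eigenvalues go to eigenvalues.
      squared : ∀ {a b x} → U · σ a ≈ᴹ x • (σ b · U) → x *ᶜ x ≈ 1#
      squared {a} {b} {x} p = sym (trans (cancel-U {𝟙} {(x *ᶜ x) • 𝟙} (λ r c → begin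
        (U · 𝟙) r c                          ≈⟨ ·-cong (ᴹ-refl {U}) (ᴹ-sym (σ² a)) r c ⟩
        (U · (σ a · σ a)) r c                ≈⟨ ·-assoc U (σ a) (σ a) r c ⟨
        ((U · σ a) · σ a) r c                ≈⟨ ·-cong p (ᴹ-refl {σ a}) r c ⟩
        ((x • (σ b · U)) · σ a) r c          ≈⟨ ·-•ˡ x (σ b · U) (σ a) r c ⟩
        x *ᶜ ((σ b · U) · σ a) r c           ≈⟨ *-congˡ (·-assoc (σ b) U (σ a) r c) ⟩
        x *ᶜ (σ b · (U · σ a)) r c           ≈⟨ *-congˡ (·-cong (ᴹ-refl {σ b}) p r c) ⟩
        x *ᶜ (σ b · (x • (σ b · U))) r c     ≈⟨ *-congˡ (·-•ʳ x (σ b) (σ b · U) r c) ⟩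
        x *ᶜ (x *ᶜ (σ b · (σ b · U)) r c)    ≈⟨ *-assoc _ _ _ ⟨
        (x *ᶜ x) *ᶜ (σ b · (σ b · U)) r c    ≈⟨ *-congˡ (·-assoc (σ b) (σ b) U r c) ⟨
        (x *ᶜ x) *ᶜ ((σ b · σ b) · U) r c    ≈⟨ *-congˡ (·-cong (σ² b) (ᴹ-refl {U}) r c) ⟩
        (x *ᶜ x) *ᶜ (𝟙 · U) r c              ≈⟨ *-congˡ (trans (·-identityˡ U r c) (sym (·-identityʳ U r c))) ⟩
        (x *ᶜ x) *ᶜ (U · 𝟙) r c              ≈⟨ ·-•ʳ (x *ᶜ x) U 𝟙 r c ⟨
        (U · ((x *ᶜ x) • 𝟙)) r c             ∎) false false) (*-identityʳ _))

      -- A bra repeated as both rows of a matrix, so that the laws of matrix products apply to it.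
      bra-matrix : Axis → Bool → Matrix
      bra-matrix b s _ = ⟨ b , s ∣

      row-eigen : ∀ {a b x t} s → U · σ a ≈ᴹ x • (σ b · U) → x ≈ sgn t → ∀ c →
        ((⟨ b , s ∣ ⊙ U) ⊙ σ a) c ≈ sgn (t xor s) *ᶜ (⟨ b , s ∣ ⊙ U) c
      row-eigen {a} {b} {x} {t} s p q c = begin
        ((B · U) · σ a) false c              ≈⟨ ·-assoc B U (σ a) false c ⟩
        (B · (U · σ a)) false c              ≈⟨ ·-cong {B} {B} {U · σ a} {x • (σ b · U)} (ᴹ-refl {B}) p false c ⟩
        (B · (x • (σ b · U))) false c        ≈⟨ ·-•ʳ x B (σ b · U) false c ⟩
        x *ᶜ (B · (σ b · U)) false c         ≈⟨ *-cong q (sym (·-assoc B (σ b) U false c)) ⟩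
        sgn t *ᶜ ((B · σ b) · U) false c     ≈⟨ *-congˡ (·-cong {B · σ b} {sgn s • B} {U} {U} (λ _ → bra-eigen b s) (ᴹ-refl {U}) false c) ⟩
        sgn t *ᶜ ((sgn s • B) · U) false c   ≈⟨ *-congˡ (·-•ˡ (sgn s) B U false c) ⟩
        sgn t *ᶜ (sgn s *ᶜ (B · U) false c)  ≈⟨ *-assoc (sgn t) (sgn s) ((B · U) false c) ⟨
        (sgn t *ᶜ sgn s) *ᶜ (B · U) false c  ≈⟨ *-congʳ (sgn-xor t s) ⟨
        sgn (t xor s) *ᶜ (B · U) false c     ∎
        where
        B = bra-matrix b s

      nonzero-entry : ∀ b s → ∃ λ c → ⟨ b , s ∣ c # 0#
      nonzero-entry X s     = false , ι#0 1ᵍ 0 ≡.refl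
      nonzero-entry Y s     = false , ι#0 1ᵍ 0 ≡.refl
      nonzero-entry Z false = false , ι#0 1ᵍ 0 ≡.refl
      nonzero-entry Z true  = true , ι#0 1ᵍ 0 ≡.refl

      -- Multiplying by the adjoint of `U` recovers the original bra, so `x` divides all its
      -- entries, one of which is nonzero.
      multiple#0 : ∀ {a u} b s x → (∀ c → (⟨ b , s ∣ ⊙ U) c ≈ x *ᶜ ⟨ a , u ∣ c) → x # 0#
      multiple#0 {a} {u} b s x p = go (nonzero-entry b s)
        where
        A = bra-matrix a u
        B = bra-matrix b s

        recover : ∀ c → (A · U †) false c *ᶜ x ≈ ⟨ b , s ∣ c
        recover c = begin
          (A · U †) false c *ᶜ x      ≈⟨ *-comm ((A · U †) false c) x ⟩
          x *ᶜ (A · U †) false c      ≈⟨ ·-•ˡ x A (U †) false c ⟨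
          ((x • A) · U †) false c     ≈⟨ ·-cong {B · U} {x • A} {U †} {U †} (λ _ → p) (ᴹ-refl {U †}) false c ⟨
          ((B · U) · U †) false c     ≈⟨ ·-assoc B U (U †) false c ⟩
          (B · (U · U †)) false c     ≈⟨ ·-cong {B} {B} {U · U †} {𝟙} (ᴹ-refl {B}) UU†≈𝟙 false c ⟩
          (B · 𝟙) false c             ≈⟨ ·-identityʳ B false c ⟩
          ⟨ b , s ∣ c                 ∎

        go : (∃ λ c → ⟨ b , s ∣ c # 0#) → x # 0#
        go (c , e#0) = *#0⇒#0ʳ (#-congʳ (sym (recover c)) e#0)

      directed-axis : ∀ {a b x t} → U · σ a ≈ᴹ x • (σ b · U) → x ≈ sgn t → Directed a t (λ s → ⟨ b , s ∣ ⊙ U)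
      directed-axis {a} {b} {x} {t} p q s =
        proj₁ eigen , multiple#0 {a} {t xor s} b s (proj₁ eigen) (proj₂ eigen) , proj₂ eigen
        where
        eigen : ∃ λ y → ∀ c → (⟨ b , s ∣ ⊙ U) c ≈ y *ᶜ ⟨ a , t xor s ∣ c
        eigen = eigenrow a (t xor s) (⟨ b , s ∣ ⊙ U) (row-eigen {a} {b} {x} {t} s p q)

    -- Bras are multiplied by `U` from the right, so those of axis `b` go to the axis that
    -- conjugation sends to `b`. This is where surjectivity on the axes enters.
    clifford⇒permutesBras : PermutesBras U
    clifford⇒permutesBras b = preimage (axes-surjective π π-injective b)
      where
      image : ∀ a → ∃ λ t → Directed a t (λ s → ⟨ π a , s ∣ ⊙ U)
      image a = proj₁ unit , directed-axis {a} {π a} {i ^ e} {proj₁ unit} p (proj₂ unit)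
        where
        e : ℕ
        e = proj₁ (proj₂ (conjugate a))

        p : U · σ a ≈ᴹ (i ^ e) • (σ (π a) · U)
        p = proj₂ (proj₂ (conjugate a))

        unit : ∃ λ t → (i ^ e) ≈ sgn t
        unit = i^²≈1 e (squared {a} {π a} {i ^ e} p)

      preimage : ∀ {b} → (∃ λ a → π a ≡ b) → ∃ λ a′ → ∃ λ t → Directed a′ t (λ s → ⟨ b , s ∣ ⊙ U)
      preimage (a , ≡.refl) = a , image a

  permutesBras-· : ∀ {U D} → PermutesBras U → PermutesBras D → PermutesBras (U · D)
  permutesBras-· {U} {D} gU gD a = compose (gU a)
    where
    compose : (∃ λ a′ → ∃ λ t → Directed a′ t (λ s → ⟨ a , s ∣ ⊙ U)) →
              ∃ λ a″ → ∃ λ t → Directed a″ t (λ s → ⟨ a , s ∣ ⊙ (U · D))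
    compose (a′ , t , dU) = proj₁ (gD a′) , t′ xor t , λ s → proj₁ (dU s) *ᶜ proj₁ (dD (t xor s)) ,
      x#0y#0→xy#0 (proj₁ (proj₂ (dU s))) (proj₁ (proj₂ (dD (t xor s)))) , multiple s
      where
      a″ = proj₁ (gD a′)
      t′ = proj₁ (proj₂ (gD a′))
      dD = proj₂ (proj₂ (gD a′))

      multiple : ∀ s b → (⟨ a , s ∣ ⊙ (U · D)) b ≈ (proj₁ (dU s) *ᶜ proj₁ (dD (t xor s))) *ᶜ ⟨ a″ , (t′ xor t) xor s ∣ b
      multiple s b = begin
        (⟨ a , s ∣ ⊙ (U · D)) b                       ≈⟨ ·-assoc (λ _ → ⟨ a , s ∣) U D false b ⟨
        ((⟨ a , s ∣ ⊙ U) ⊙ D) b                       ≈⟨ +-cong (*-congʳ (proj₂ (proj₂ (dU s)) false)) (*-congʳ (proj₂ (proj₂ (dU s)) true)) ⟩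
        ((x • (λ _ → ⟨ a′ , t xor s ∣)) · D) false b  ≈⟨ ·-•ˡ x (λ _ → ⟨ a′ , t xor s ∣) D false b ⟩
        x *ᶜ (⟨ a′ , t xor s ∣ ⊙ D) b                 ≈⟨ *-congˡ (proj₂ (proj₂ (dD (t xor s))) b) ⟩
        x *ᶜ (y *ᶜ ⟨ a″ , t′ xor (t xor s) ∣ b)       ≡⟨ ≡.cong (λ u → x *ᶜ (y *ᶜ ⟨ a″ , u ∣ b)) (≡.sym (Bool.xor-assoc t′ t s)) ⟩
        x *ᶜ (y *ᶜ ⟨ a″ , (t′ xor t) xor s ∣ b)       ≈⟨ *-assoc x y _ ⟨
        (x *ᶜ y) *ᶜ ⟨ a″ , (t′ xor t) xor s ∣ b       ∎
        where
        x = proj₁ (dU s)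
        y = proj₁ (dD (t xor s))

  permutesBras-𝟙 : PermutesBras 𝟙
  permutesBras-𝟙 a = a , false , λ s → 1# , 1#0 , λ b →
    trans (·-identityʳ (λ _ → ⟨ a , s ∣) false b) (sym (*-identityˡ _))

  -- Subsets after changing one vertex

  ≔-⊆ : ∀ {S : Subset N} {v} b B → v ∈ S → B ⊆ S → B [ v ]≔ b ⊆ S
  ≔-⊆ {v = v} b B v∈S B⊆S {w} m with w ≟ v
  ... | yes ≡.refl = v∈S
  ... | no w≢v     = B⊆S (true⇒∈ (≡.trans (≡.sym (lookup∘update′ w≢v B b)) (∈⇒true m)))

  ≔-outside-⊆ : ∀ {S : Subset N} {v} B → B ⊆ S → B [ v ]≔ outside ⊆ S - v
  ≔-outside-⊆ {v = v} B B⊆S {w} m with w ≟ v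
  ... | yes ≡.refl with () ← ≡.trans (≡.sym (lookup∘update w B false)) (∈⇒true m)
  ... | no w≢v     = x∈p∧x≢y⇒x∈p-y (B⊆S (true⇒∈ (≡.trans (≡.sym (lookup∘update′ w≢v B false)) (∈⇒true m)))) w≢v

  applyGate-cong : ∀ {U W : Matrix} {v} {ψ φ : State N} B → U ≈ᴹ W →
    (∀ b → ψ (B [ v ]≔ b) ≈ φ (B [ v ]≔ b)) → applyGate U v ψ B ≈ applyGate W v φ B
  applyGate-cong B p q = +-cong (*-cong (p _ _) (q false)) (*-cong (p _ _) (q true))

  applyGate-· : ∀ (U W : Matrix) v (ψ : State N) B → applyGate U v (applyGate W v ψ) B ≈ applyGate (U · W) v ψ B
  applyGate-· U W v ψ B
    rewrite lookup∘update v B false | lookup∘update v B true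
          | []≔-idempotent {x = false} {y = false} B v | []≔-idempotent {x = false} {y = true} B v
          | []≔-idempotent {x = true} {y = false} B v | []≔-idempotent {x = true} {y = true} B v =
    solve 8 (λ p q a b c d x y → p :* (a :* x :+ b :* y) :+ q :* (c :* x :+ d :* y)
                              := (p :* a :+ q :* c) :* x :+ (p :* b :+ q :* d) :* y) refl
      (U (lookup B v) false) (U (lookup B v) true) (W false false) (W false true) (W true false) (W true true)
      (ψ (B [ v ]≔ false)) (ψ (B [ v ]≔ true))

  applyGate-𝟙 : ∀ v (ψ : State N) B → applyGate 𝟙 v ψ B ≈ ψ B
  applyGate-𝟙 v ψ B = go (lookup B v) ≡.refl
    where
    go : ∀ b → lookup B v ≡ b → (𝟙 b false *ᶜ ψ (B [ v ]≔ false)) +ᶜ (𝟙 b true *ᶜ ψ (B [ v ]≔ true)) ≈ ψ B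
    go false p = trans (trans (+-cong (*-identityˡ _) (zeroˡ _)) (+-identityʳ _))
      (reflexive (≡.cong ψ (≡.trans (≡.cong (B [ v ]≔_) (≡.sym p)) ([]≔-lookup B v))))
    go true  p = trans (trans (+-cong (zeroˡ _) (*-identityˡ _)) (+-identityˡ _))
      (reflexive (≡.cong ψ (≡.trans (≡.cong (B [ v ]≔_) (≡.sym p)) ([]≔-lookup B v))))

  -- Gates and measurements preserve nonzero states

  applyGate-nonzero : ∀ {S : Subset N} {U v ψ} → IsClifford U → v ∈ S → ¬ IsZero S ψ → ¬ IsZero S (applyGate U v ψ)
  applyGate-nonzero {U = U} {v} {ψ} clifford v∈S nz z = nz λ B B⊆S → begin
    ψ B                                    ≈⟨ applyGate-𝟙 v ψ B ⟨
    applyGate 𝟙 v ψ B                      ≈⟨ applyGate-cong {U = U † · U} {𝟙} {v} {ψ} {ψ} B (IsClifford.U†U≈𝟙 clifford) (λ _ → refl) ⟨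
    applyGate (U † · U) v ψ B              ≈⟨ applyGate-· (U †) U v ψ B ⟨
    applyGate (U †) v (applyGate U v ψ) B  ≈⟨ +-cong (*-congˡ (z _ (≔-⊆ false B v∈S B⊆S))) (*-congˡ (z _ (≔-⊆ true B v∈S B⊆S))) ⟩
    ((U †) (lookup B v) false *ᶜ 0#) +ᶜ ((U †) (lookup B v) true *ᶜ 0#) ≈⟨ +-cong (zeroʳ _) (zeroʳ _) ⟩
    0# +ᶜ 0#                               ≈⟨ +-identityˡ 0# ⟩
    0#                                     ∎

  negative : Sign → Bool
  negative Sign.+ = false
  negative Sign.- = true

  conj-eigenvector : ∀ a s b → conj (eigenvector a s b) ≈ ⟨ a , negative s ∣ b
  conj-eigenvector X s      false = trans conj-1 (sym ι-1)
  conj-eigenvector Y s      false = trans conj-1 (sym ι-1)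
  conj-eigenvector X Sign.+ true  = trans conj-1 (sym ι-1)
  conj-eigenvector X Sign.- true  = trans (conj-cong (sym ι--1)) (conj-ι -1ᵍ)
  conj-eigenvector Y Sign.+ true  = trans (conj-cong (sym ι-i)) (conj-ι iᵍ)
  conj-eigenvector Y Sign.- true  = trans (conj-cong (sym ι--i)) (conj-ι (-ᵍ iᵍ))
  conj-eigenvector Z Sign.+ false = trans (conj-cong (sym ι-1)) (conj-ι 1ᵍ)
  conj-eigenvector Z Sign.+ true  = trans (conj-cong (sym ι-0)) (conj-ι 0ᵍ)
  conj-eigenvector Z Sign.- false = trans (conj-cong (sym ι-0)) (conj-ι 0ᵍ)
  conj-eigenvector Z Sign.- true  = trans (conj-cong (sym ι-1)) (conj-ι 1ᵍ)

  afterOutcome-bra : ∀ a s v (ψ : State N) B → afterOutcome a s v ψ B ≈ applyGate (λ _ → ⟨ a , negative s ∣) v ψ B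
  afterOutcome-bra a s v ψ B = +-cong (*-congʳ (conj-eigenvector a s false)) (*-congʳ (conj-eigenvector a s true))

  -- The two eigenvectors of an axis form a basis. In `eliminate`, the combination of the two
  -- overlaps with coefficients `u` and `w` leaves one unknown, multiplied by `z`.
  bras-independent : ∀ a x y →
    (⟨ a , false ∣ false *ᶜ x) +ᶜ (⟨ a , false ∣ true *ᶜ y) ≈ 0# →
    (⟨ a , true ∣ false *ᶜ x) +ᶜ (⟨ a , true ∣ true *ᶜ y) ≈ 0# → x ≈ 0# × y ≈ 0#
  bras-independent a x y p q = go a p q
    where
    eliminate : ∀ {A B} u w z w′ → A ≈ 0# → B ≈ 0# → ι z # 0# → ι z *ᶜ w′ ≈ (ι u *ᶜ A) +ᶜ (ι w *ᶜ B) → w′ ≈ 0#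
    eliminate u w z w′ p q z#0 r = cancelˡ z#0 (trans r (trans (+-cong (trans (*-congˡ p) (zeroʳ _)) (trans (*-congˡ q) (zeroʳ _)))
      (trans (+-identityˡ 0#) (sym (zeroʳ _)))))

    go : ∀ a → (⟨ a , false ∣ false *ᶜ x) +ᶜ (⟨ a , false ∣ true *ᶜ y) ≈ 0# →
         (⟨ a , true ∣ false *ᶜ x) +ᶜ (⟨ a , true ∣ true *ᶜ y) ≈ 0# → x ≈ 0# × y ≈ 0#
    go X p q =
      eliminate 1ᵍ 1ᵍ (1ᵍ +ᵍ 1ᵍ) x p q (ι#0 (1ᵍ +ᵍ 1ᵍ) 3 ≡.refl)
        (solve 2 (λ x y → con (1ᵍ +ᵍ 1ᵍ) :* x := con 1ᵍ :* (con 1ᵍ :* x :+ con 1ᵍ :* y) :+ con 1ᵍ :* (con 1ᵍ :* x :+ con -1ᵍ :* y)) refl x y) ,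
      eliminate 1ᵍ -1ᵍ (1ᵍ +ᵍ 1ᵍ) y p q (ι#0 (1ᵍ +ᵍ 1ᵍ) 3 ≡.refl)
        (solve 2 (λ x y → con (1ᵍ +ᵍ 1ᵍ) :* y := con 1ᵍ :* (con 1ᵍ :* x :+ con 1ᵍ :* y) :+ con -1ᵍ :* (con 1ᵍ :* x :+ con -1ᵍ :* y)) refl x y)
    go Y p q =
      eliminate 1ᵍ 1ᵍ (1ᵍ +ᵍ 1ᵍ) x p q (ι#0 (1ᵍ +ᵍ 1ᵍ) 3 ≡.refl)
        (solve 2 (λ x y → con (1ᵍ +ᵍ 1ᵍ) :* x := con 1ᵍ :* (con 1ᵍ :* x :+ con (-ᵍ iᵍ) :* y) :+ con 1ᵍ :* (con 1ᵍ :* x :+ con iᵍ :* y)) refl x y) ,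
      eliminate iᵍ (-ᵍ iᵍ) (1ᵍ +ᵍ 1ᵍ) y p q (ι#0 (1ᵍ +ᵍ 1ᵍ) 3 ≡.refl)
        (solve 2 (λ x y → con (1ᵍ +ᵍ 1ᵍ) :* y := con iᵍ :* (con 1ᵍ :* x :+ con (-ᵍ iᵍ) :* y) :+ con (-ᵍ iᵍ) :* (con 1ᵍ :* x :+ con iᵍ :* y)) refl x y)
    go Z p q =
      eliminate 1ᵍ 0ᵍ 1ᵍ x p q (ι#0 1ᵍ 0 ≡.refl)
        (solve 2 (λ x y → con 1ᵍ :* x := con 1ᵍ :* (con 1ᵍ :* x :+ con 0ᵍ :* y) :+ con 0ᵍ :* (con 0ᵍ :* x :+ con 1ᵍ :* y)) refl x y) ,
      eliminate 0ᵍ 1ᵍ 1ᵍ y p q (ι#0 1ᵍ 0 ≡.refl)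
        (solve 2 (λ x y → con 1ᵍ :* y := con 0ᵍ :* (con 1ᵍ :* x :+ con 0ᵍ :* y) :+ con 1ᵍ :* (con 0ᵍ :* x :+ con 1ᵍ :* y)) refl x y)

  -- Removing `v` from `B` gives a set covered by the hypothesis; there both overlaps of the pair of
  -- amplitudes with `v` off and on vanish, hence so does the pair. One of the two amplitudes is the
  -- one at `B`.
  outcomes-zero : ∀ {S : Subset N} {a v ψ} → (∀ s → IsZero (S - v) (afterOutcome a s v ψ)) → IsZero S ψ
  outcomes-zero {a = a} {v} {ψ} z B B⊆S = go (lookup B v) ≡.refl
    where
    B₀ = B [ v ]≔ outside

    outcome : ∀ s → (⟨ a , negative s ∣ false *ᶜ ψ (B [ v ]≔ false)) +ᶜ (⟨ a , negative s ∣ true *ᶜ ψ (B [ v ]≔ true)) ≈ 0#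
    outcome s = begin
      (⟨ a , negative s ∣ false *ᶜ ψ (B [ v ]≔ false)) +ᶜ (⟨ a , negative s ∣ true *ᶜ ψ (B [ v ]≔ true))
        ≡⟨ ≡.cong₂ (λ B B′ → (⟨ a , negative s ∣ false *ᶜ ψ B) +ᶜ (⟨ a , negative s ∣ true *ᶜ ψ B′))
             ([]≔-idempotent B v) ([]≔-idempotent B v) ⟨
      applyGate (λ _ → ⟨ a , negative s ∣) v ψ B₀   ≈⟨ afterOutcome-bra a s v ψ B₀ ⟨
      afterOutcome a s v ψ B₀                       ≈⟨ z s B₀ (≔-outside-⊆ B B⊆S) ⟩
      0#                                            ∎

    both = bras-independent a (ψ (B [ v ]≔ false)) (ψ (B [ v ]≔ true)) (outcome Sign.+) (outcome Sign.-)

    restore : ∀ {b} → lookup B v ≡ b → B ≡ B [ v ]≔ b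
    restore ≡.refl = ≡.sym ([]≔-lookup B v)

    go : ∀ b → lookup B v ≡ b → ψ B ≈ 0#
    go false p = trans (reflexive (≡.cong ψ (restore p))) (proj₁ both)
    go true  p = trans (reflexive (≡.cong ψ (restore p))) (proj₂ both)

  -- Every protocol applies a product of one-qubit matrices

  Transforms : (Fin N → Matrix) → State N → State N → Set ℓ₁
  Transforms D ψ₀ ψ = ∀ B → ψ B ≈ contract (λ v → D v (lookup B v)) ψ₀

  -- Pure linearity, so `U` may also be the singular matrix with equal rows that stands for a
  -- measurement outcome.
  transforms-applyGate : ∀ {D : Fin N → Matrix} {ψ₀ ψ} U v → Transforms D ψ₀ ψ →
                         Transforms (D [ v ↦ U · D v ]) ψ₀ (applyGate U v ψ)
  transforms-applyGate {N} {D} {ψ₀} {ψ} U v p B = begin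
    (x *ᶜ ψ (B [ v ]≔ false)) +ᶜ (y *ᶜ ψ (B [ v ]≔ true))
      ≈⟨ +-cong (*-congˡ (at false)) (*-congˡ (at true)) ⟩
    (x *ᶜ contract (r [ v ↦ D v false ]) ψ₀) +ᶜ (y *ᶜ contract (r [ v ↦ D v true ]) ψ₀)
      ≈⟨ contract-linear r v (D v false) (D v true) x y ψ₀ ⟨
    contract (r [ v ↦ (U · D v) (lookup B v) ]) ψ₀
      ≈⟨ contract-cong {N} rows (λ _ → refl) ⟩
    contract (λ w → (D [ v ↦ U · D v ]) w (lookup B w)) ψ₀ ∎
    where
    x = U (lookup B v) false
    y = U (lookup B v) true

    r : Fin N → Row
    r w = D w (lookup B w)

    at : ∀ b → ψ (B [ v ]≔ b) ≈ contract (r [ v ↦ D v b ]) ψ₀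
    at b = trans (p (B [ v ]≔ b)) (contract-cong {N} rows (λ _ → refl))
      where
      rows : ∀ w a → D w (lookup (B [ v ]≔ b) w) a ≈ (r [ v ↦ D v b ]) w a
      rows w a with v ≟ w
      ... | yes ≡.refl = reflexive (≡.cong (λ β → D v β a) (lookup∘update v B b))
      ... | no v≢w     = reflexive (≡.cong (λ β → D w β a) (lookup∘update′ (v≢w ∘ ≡.sym) B b))

    rows : ∀ w b → (r [ v ↦ (U · D v) (lookup B v) ]) w b ≈ (D [ v ↦ U · D v ]) w (lookup B w) b
    rows w b with v ≟ w
    ... | yes ≡.refl = refl
    ... | no _       = refl

  -- No set of remaining qubits contains a measured one, so only row `false` of its matrix is
  -- meaningful. `E` completes this row by one on the opposite eigenline.
  Measured : Matrix → Set (c ⊔ ℓ₁ ⊔ ℓ₂)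
  Measured D = ∃ λ a → ∃ λ t → ∃ λ E → Directed a t E × (∀ b → E false b ≈ D false b)

  record Progress (S : Subset N) (D : Fin N → Matrix) : Set (c ⊔ ℓ₁ ⊔ ℓ₂) where
    field
      present  : ∀ {v} → v ∈ S → PermutesBras (D v)
      measured : ∀ {v} → ¬ v ∈ S → Measured (D v)

  open Progress

  progress-gate : ∀ {S : Subset N} {D U v} → v ∈ S → PermutesBras U → Progress S D → Progress S (D [ v ↦ U · D v ])
  progress-gate {N} {S} {D} {U} {v} v∈S g p = record { present = present′ ; measured = measured′ }
    where
    present′ : ∀ {w} → w ∈ S → PermutesBras ((D [ v ↦ U · D v ]) w)
    present′ {w} m with v ≟ w
    ... | yes ≡.refl = permutesBras-· {U} {D v} g (present p v∈S)
    ... | no _       = present p m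

    measured′ : ∀ {w} → ¬ w ∈ S → Measured ((D [ v ↦ U · D v ]) w)
    measured′ {w} m with v ≟ w
    ... | yes ≡.refl = contradiction v∈S m
    ... | no _       = measured p m

  progress-measure : ∀ {S : Subset N} {D v} a s → v ∈ S → Progress S D →
    Progress (S - v) (D [ v ↦ (λ _ b → conj (eigenvector a s b)) · D v ])
  progress-measure {N} {S} {D} {v} a s v∈S p = record { present = present′ ; measured = measured′ }
    where
    C : Matrix
    C _ b = conj (eigenvector a s b)

    outcome : Measured (C · D v)
    outcome = collapse (present p v∈S a)
      where
      collapse : (∃ λ a′ → ∃ λ t → Directed a′ t (λ s → ⟨ a , s ∣ ⊙ D v)) → Measured (C · D v)
      -- The completing row is the one that the other outcome would have left.
      collapse (a′ , t , d) = a′ , t xor negative s , (λ β → ⟨ a , negative s xor β ∣ ⊙ D v) , shifted , λ b →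
        trans (reflexive (≡.cong (λ u → (⟨ a , u ∣ ⊙ D v) b) (Bool.xor-identityʳ (negative s))))
          (sym (+-cong (*-congʳ (conj-eigenvector a s false)) (*-congʳ (conj-eigenvector a s true))))
        where
        shifted : Directed a′ (t xor negative s) (λ β → ⟨ a , negative s xor β ∣ ⊙ D v)
        shifted β = proj₁ (d (negative s xor β)) , proj₁ (proj₂ (d (negative s xor β))) , λ b →
          trans (proj₂ (proj₂ (d (negative s xor β))) b)
            (*-congˡ (reflexive (≡.cong (λ u → ⟨ a′ , u ∣ b) (≡.sym (Bool.xor-assoc t (negative s) β)))))

    present′ : ∀ {w} → w ∈ S - v → PermutesBras ((D [ v ↦ C · D v ]) w)
    present′ {w} m with v ≟ w
    ... | yes ≡.refl = contradiction m (x∉p-x v)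
    ... | no _       = present p (p-x⊆p v m)

    measured′ : ∀ {w} → ¬ w ∈ S - v → Measured ((D [ v ↦ C · D v ]) w)
    measured′ {w} m with v ≟ w
    ... | yes ≡.refl = outcome
    ... | no v≢w     = measured p (λ w∈S → m (x∈p∧x≢y⇒x∈p-y w∈S (v≢w ∘ ≡.sym)))

  -- Row `β` of a matrix is its product with the bra of |0⟩ or |1⟩, so the axis at a vertex of `T`
  -- is the image of Z. Elsewhere the axis left by the measurement is taken.
  progress-presentation : ∀ {T V : Subset N} {H : Graph T} {G : Graph V} {D ψ} → Progress T D →
    Transforms D (graphState G) ψ → SameRay T ψ (graphState H) → ∃ λ b → Presentation H G b
  progress-presentation {N} {T} {H = H} {G} {D} {ψ} p tr (x , x#0 , ray) = (λ w → proj₁ (final w)) , record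
    { rows       = λ w → proj₁ (proj₂ (proj₂ (final w)))
    ; shift      = λ w → proj₁ (proj₂ (final w))
    ; directed   = λ w → proj₁ (proj₂ (proj₂ (proj₂ (final w))))
    ; factor     = x
    ; factor#0   = x#0
    ; amplitudes = λ B B⊆T → trans (sym (ray B B⊆T)) (trans (tr B) (contract-cong {N}
        (λ w b → sym (proj₂ (proj₂ (proj₂ (proj₂ (final w)))) (lookup B w) (λ q → B⊆T (true⇒∈ q)) b)) (λ _ → refl)))
    }
    where
    Final : Fin N → Set (c ⊔ ℓ₁ ⊔ ℓ₂)
    Final w = ∃ λ a → ∃ λ t → ∃ λ E → Directed a t E × (∀ β → (β ≡ true → w ∈ T) → ∀ b → E β b ≈ D w β b)

    Z-rows : ∀ (M : Matrix) β b → (⟨ Z , β ∣ ⊙ M) b ≈ M β b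
    Z-rows M false b = solve 2 (λ x y → con 1ᵍ :* x :+ con 0ᵍ :* y := x) refl (M false b) (M true b)
    Z-rows M true  b = solve 2 (λ x y → con 0ᵍ :* x :+ con 1ᵍ :* y := y) refl (M false b) (M true b)

    final : ∀ w → Final w
    final w = decide (w ∈? T)
      where
      fromPresent : (∃ λ a → ∃ λ t → Directed a t (λ s → ⟨ Z , s ∣ ⊙ D w)) → Final w
      fromPresent (a , t , d) = a , t , _ , d , λ β _ → Z-rows (D w) β

      fromMeasured : ¬ w ∈ T → Measured (D w) → Final w
      fromMeasured w∉T (a , t , E , d , q) = a , t , E , d , λ
        { false _ → q ; true w∈T → contradiction (w∈T ≡.refl) w∉T }

      decide : Dec (w ∈ T) → Final w
      decide (yes w∈T) = fromPresent (present p w∈T Z)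
      decide (no w∉T)  = fromMeasured w∉T (measured p w∉T)

  -- Vertex-minors from protocols

  module _ {T : Subset N} (H : Graph T) (G : Graph (⊤ {N})) where

    -- Which outcomes have nonzero probability is not decided here; this costs
    -- a double negation.
    protocol⇒minor : ∀ {S : Subset N} (p : Protocol T S) {D ψ} → Progress S D → Transforms D (graphState G) ψ →
      ¬ IsZero S ψ → Yields p ψ (graphState H) → ¬ ¬ (H IsVertexMinorOf G)
    protocol⇒minor (stop ≡.refl) {D} {ψ} prog tr nz y k =
      k (presentation⇒minor (proj₂ (progress-presentation {H = H} {G} {D} {ψ} prog tr y)))
    protocol⇒minor (gate v v∈S U cl p) {D} {ψ} prog tr nz y =
      protocol⇒minor p (progress-gate {D = D} {U} v∈S (clifford⇒permutesBras cl) prog) (transforms-applyGate {D = D} {graphState G} {ψ} U v tr)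
        (applyGate-nonzero {ψ = ψ} cl v∈S nz) y
    protocol⇒minor {S} (measure v v∈S a p) {D} {ψ} prog tr nz y k =
      -- If the goal is refuted, no branch can have a nonzero state. Then both outcomes give zero,
      -- and so the state before the measurement was zero.
      ¬¬zero Sign.+ λ z₊ → ¬¬zero Sign.- λ z₋ → nz (outcomes-zero {S = S} {a} {v} {ψ} λ { Sign.+ → z₊ ; Sign.- → z₋ })
      where
      ¬¬zero : ∀ s → ¬ ¬ IsZero (S - v) (afterOutcome a s v ψ)
      ¬¬zero s nz′ = protocol⇒minor (p s) (progress-measure {D = D} a s v∈S prog)
        (transforms-applyGate {D = D} {graphState G} {ψ} (λ _ b → conj (eigenvector a s b)) v tr) nz′ (y s nz′) k

    -- The double negation is removed by deciding the vertex-minor relation. At the start all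
    -- matrices are the identity and the state is nonzero at the empty set.
    canPrepare⇒minor : CanPrepare H G → H IsVertexMinorOf G
    canPrepare⇒minor (p , y) = decidable-stable (H isVertexMinorOf? G) (protocol⇒minor p {λ _ → 𝟙}
      (record { present = λ _ → permutesBras-𝟙 ; measured = λ v∉⊤ → contradiction ∈⊤ v∉⊤ })
      initial (λ z → #0⇒≉0 (graphState#0 G ⊥) (z ⊥ (⊥-elim ∘ ∉⊥))) y)
      where
      initial : Transforms (λ _ → 𝟙) (graphState G) (graphState G)
      initial B = sym (trans (contract-cong {N} (λ w b → 𝟙-row (lookup B w) b) (λ _ → refl))
        (trans (contract-basis (lookup B) (graphState G)) (reflexive (≡.cong (graphState G) (tabulate∘lookup B)))))
        where
        𝟙-row : ∀ β b → 𝟙 β b ≈ ⟨ Z , β ∣ b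
        𝟙-row false false = sym ι-1
        𝟙-row false true  = sym ι-0
        𝟙-row true  false = sym ι-0
        𝟙-row true  true  = sym ι-1

  -- Clifford gates with Gaussian entries

  i^-+ : ∀ k l → (i ^ (k ℕ.+ l)) ≈ (i ^ k) *ᶜ (i ^ l)
  i^-+ zero    l = sym (*-identityˡ _)
  i^-+ (suc k) l = trans (*-congˡ (i^-+ k l)) (sym (*-assoc _ _ _))

  iᵍ^ : ℕ → Gauss
  iᵍ^ zero    = 1ᵍ
  iᵍ^ (suc k) = iᵍ *ᵍ iᵍ^ k

  i^≈ι : ∀ k → i ^ k ≈ ι (iᵍ^ k)
  i^≈ι zero    = sym ι-1
  i^≈ι (suc k) = trans (*-cong (sym ι-i) (i^≈ι k)) (sym (ι-* iᵍ (iᵍ^ k)))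

  infix 9 _†ᵍ
  _†ᵍ : (Bool → Bool → Gauss) → Bool → Bool → Gauss
  (M †ᵍ) a b = conjᵍ (M b a)

  module _ {M : Bool → Bool → Gauss} {n : Gauss} {h : Carrier}
    (h²n≈1 : (h *ᶜ h) *ᶜ ι n ≈ 1#) (conj-h : conj h ≈ h)
    (M†M : ∀ a b → (M †ᵍ ·ᵍ M) a b ≡ n *ᵍ 𝟙ᵍ a b) (MM† : ∀ a b → (M ·ᵍ M †ᵍ) a b ≡ n *ᵍ 𝟙ᵍ a b)
    (image : ∀ a → ∃ λ k → ∃ λ b → ∀ r c → (M ·ᵍ σᵍ a ·ᵍ M †ᵍ) r c ≡ n *ᵍ (iᵍ^ k *ᵍ σᵍ b r c)) where

    private
      U : Matrix
      U = h • ιᴹ M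

      U† : U † ≈ᴹ h • ιᴹ (M †ᵍ)
      U† a b = trans (conj-* h (ι (M b a))) (*-cong conj-h (conj-ι (M b a)))

      scale-· : ∀ (A B : Matrix) → (h • A) · (h • B) ≈ᴹ (h *ᶜ h) • (A · B)
      scale-· A B a b = trans (·-•ˡ h A (h • B) a b) (trans (*-congˡ (·-•ʳ h A B a b)) (sym (*-assoc h h _)))

      normalise : ∀ L g → L ≡ n *ᵍ g → (h *ᶜ h) *ᶜ ι L ≈ ι g
      normalise L g p = begin
        (h *ᶜ h) *ᶜ ι L            ≡⟨ ≡.cong (λ L → (h *ᶜ h) *ᶜ ι L) p ⟩
        (h *ᶜ h) *ᶜ ι (n *ᵍ g)     ≈⟨ trans (*-congˡ (ι-* n g)) (sym (*-assoc _ _ _)) ⟩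
        ((h *ᶜ h) *ᶜ ι n) *ᶜ ι g   ≈⟨ trans (*-congʳ h²n≈1) (*-identityˡ _) ⟩
        ι g                        ∎

      UU†≈𝟙 : U · U † ≈ᴹ 𝟙
      UU†≈𝟙 a b = begin
        (U · U †) a b                            ≈⟨ ·-cong {U} {U} {U †} {h • ιᴹ (M †ᵍ)} (ᴹ-refl {U}) U† a b ⟩
        (U · (h • ιᴹ (M †ᵍ))) a b                ≈⟨ scale-· (ιᴹ M) (ιᴹ (M †ᵍ)) a b ⟩
        (h *ᶜ h) *ᶜ (ιᴹ M · ιᴹ (M †ᵍ)) a b       ≈⟨ *-congˡ (ιᴹ-· M (M †ᵍ) a b) ⟨
        (h *ᶜ h) *ᶜ ι ((M ·ᵍ M †ᵍ) a b)          ≈⟨ normalise ((M ·ᵍ M †ᵍ) a b) (𝟙ᵍ a b) (MM† a b) ⟩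
        ι (𝟙ᵍ a b)                               ≈⟨ 𝟙≈ a b ⟨
        𝟙 a b                                    ∎

      U†U≈𝟙 : U † · U ≈ᴹ 𝟙
      U†U≈𝟙 a b = begin
        (U † · U) a b                            ≈⟨ ·-cong {U †} {h • ιᴹ (M †ᵍ)} {U} {U} U† (ᴹ-refl {U}) a b ⟩
        ((h • ιᴹ (M †ᵍ)) · U) a b                ≈⟨ scale-· (ιᴹ (M †ᵍ)) (ιᴹ M) a b ⟩
        (h *ᶜ h) *ᶜ (ιᴹ (M †ᵍ) · ιᴹ M) a b       ≈⟨ *-congˡ (ιᴹ-· (M †ᵍ) M a b) ⟨
        (h *ᶜ h) *ᶜ ι ((M †ᵍ ·ᵍ M) a b)          ≈⟨ normalise ((M †ᵍ ·ᵍ M) a b) (𝟙ᵍ a b) (M†M a b) ⟩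
        ι (𝟙ᵍ a b)                               ≈⟨ 𝟙≈ a b ⟨
        𝟙 a b                                    ∎

      image-σ : ∀ a r c → (U · σ a · U †) r c ≈ (i ^ proj₁ (image a)) *ᶜ σ (proj₁ (proj₂ (image a))) r c
      image-σ a r c = begin
        (U · σ a · U †) r c
          ≈⟨ ·-cong {U · σ a} {h • (ιᴹ M · ιᴹ (σᵍ a))} {U †} {h • ιᴹ (M †ᵍ)}
               (λ r c → trans (·-•ˡ h (ιᴹ M) (σ a) r c) (*-congˡ (·-cong {ιᴹ M} {ιᴹ M} {σ a} {ιᴹ (σᵍ a)} (ᴹ-refl {ιᴹ M}) (σ≈ a) r c))) U† r c ⟩
        ((h • (ιᴹ M · ιᴹ (σᵍ a))) · (h • ιᴹ (M †ᵍ))) r c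
          ≈⟨ scale-· (ιᴹ M · ιᴹ (σᵍ a)) (ιᴹ (M †ᵍ)) r c ⟩
        (h *ᶜ h) *ᶜ ((ιᴹ M · ιᴹ (σᵍ a)) · ιᴹ (M †ᵍ)) r c
          ≈⟨ *-congˡ (·-cong {ιᴹ (M ·ᵍ σᵍ a)} {ιᴹ M · ιᴹ (σᵍ a)} {ιᴹ (M †ᵍ)} {ιᴹ (M †ᵍ)} (ιᴹ-· M (σᵍ a)) (ᴹ-refl {ιᴹ (M †ᵍ)}) r c) ⟨
        (h *ᶜ h) *ᶜ (ιᴹ (M ·ᵍ σᵍ a) · ιᴹ (M †ᵍ)) r c
          ≈⟨ *-congˡ (ιᴹ-· (M ·ᵍ σᵍ a) (M †ᵍ) r c) ⟨
        (h *ᶜ h) *ᶜ ι ((M ·ᵍ σᵍ a ·ᵍ M †ᵍ) r c)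
          ≈⟨ normalise ((M ·ᵍ σᵍ a ·ᵍ M †ᵍ) r c) (iᵍ^ e *ᵍ σᵍ b r c) (proj₂ (proj₂ (image a)) r c) ⟩
        ι (iᵍ^ e *ᵍ σᵍ b r c)
          ≈⟨ ι-* (iᵍ^ e) (σᵍ b r c) ⟩
        ι (iᵍ^ e) *ᶜ ι (σᵍ b r c)
          ≈⟨ *-cong (i^≈ι e) (σ≈ b r c) ⟨
        (i ^ e) *ᶜ σ b r c ∎
        where
        e = proj₁ (image a)
        b = proj₁ (proj₂ (image a))

      conjugate-• : ∀ {P Q : Matrix} k → P ≈ᴹ (i ^ k) • Q → ∀ r c → (U · P · U †) r c ≈ (i ^ k) *ᶜ (U · Q · U †) r c
      conjugate-• {P} {Q} k p r c = trans
        (·-cong {U · P} {(i ^ k) • (U · Q)} {U †} {U †}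
          (λ r c → trans (·-cong {U} {U} {P} {(i ^ k) • Q} (ᴹ-refl {U}) p r c) (·-•ʳ (i ^ k) U Q r c)) (ᴹ-refl {U †}) r c)
        (·-•ˡ (i ^ k) (U · Q) (U †) r c)

    -- The conditions on `M` are finite computations with Gaussian integers, up to the squared
    -- length `n` of its rows; the real factor `h` with h² n = 1 then makes `M` unitary.
    gaussian-clifford : IsClifford U
    gaussian-clifford = record { U†U≈𝟙 = U†U≈𝟙 ; UU†≈𝟙 = UU†≈𝟙 ; normalizes = normalizes }
      where
      normalizes : ∀ P → InPauliGroup P → InPauliGroup (U · P · U †)
      normalizes P (scalar k p)  = scalar k λ r c → trans (conjugate-• {P} {𝟙} k p r c)
        (*-congˡ (trans (·-cong {U · 𝟙} {U} {U †} {U †} (·-identityʳ U) (ᴹ-refl {U †}) r c) (UU†≈𝟙 r c)))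
      normalizes P (pauli k a p) = pauli (k ℕ.+ proj₁ (image a)) (proj₁ (proj₂ (image a))) λ r c →
        trans (conjugate-• {P} {σ a} k p r c) (trans (*-congˡ (image-σ a r c))
          (trans (sym (*-assoc _ _ _)) (*-congʳ (sym (i^-+ k (proj₁ (image a)))))))

  table : ∀ {ℓ} {P : Bool → Bool → Set ℓ} → P false false → P false true → P true false → P true true → ∀ a b → P a b
  table p q r s false false = p
  table p q r s false true  = q
  table p q r s true  false = r
  table p q r s true  true  = s

  diagᵍ : Gauss → Bool → Bool → Gauss
  diagᵍ z false false = 1ᵍ
  diagᵍ z false true  = 0ᵍ
  diagᵍ z true  false = 0ᵍ
  diagᵍ z true  true  = z

  diag : Gauss → Matrix
  diag z = 1# • ιᴹ (diagᵍ z)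

  unit-scale : (1# *ᶜ 1#) *ᶜ ι 1ᵍ ≈ 1#
  unit-scale = trans (*-cong (*-identityˡ 1#) ι-1) (*-identityˡ 1#)

  diag-i-clifford : IsClifford (diag iᵍ)
  diag-i-clifford = gaussian-clifford {diagᵍ iᵍ} {1ᵍ} unit-scale conj-1
    (table ≡.refl ≡.refl ≡.refl ≡.refl) (table ≡.refl ≡.refl ≡.refl ≡.refl)
    -- For each axis: the exponent of i in the conjugate, 2 being a minus sign, and the axis of the
    -- conjugate.
    λ { X → 0 , Y , table ≡.refl ≡.refl ≡.refl ≡.refl
      ; Y → 2 , X , table ≡.refl ≡.refl ≡.refl ≡.refl
      ; Z → 0 , Z , table ≡.refl ≡.refl ≡.refl ≡.refl }

  diag--1-clifford : IsClifford (diag -1ᵍ)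
  diag--1-clifford = gaussian-clifford {diagᵍ -1ᵍ} {1ᵍ} unit-scale conj-1
    (table ≡.refl ≡.refl ≡.refl ≡.refl) (table ≡.refl ≡.refl ≡.refl ≡.refl)
    λ { X → 2 , X , table ≡.refl ≡.refl ≡.refl ≡.refl
      ; Y → 2 , Y , table ≡.refl ≡.refl ≡.refl ≡.refl
      ; Z → 0 , Z , table ≡.refl ≡.refl ≡.refl ≡.refl }

  private
    2ᵍ 4ᵍ : Gauss
    2ᵍ = + 2 , + 0
    4ᵍ = + 4 , + 0

  ½ : Carrier
  ½ = proj₁ (#0⇒inverse (ι#0 2ᵍ 3 ≡.refl))

  ½*2 : ½ *ᶜ ι 2ᵍ ≈ 1#
  ½*2 = proj₂ (#0⇒inverse (ι#0 2ᵍ 3 ≡.refl))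

  ½#0 : ½ # 0#
  ½#0 = inverse⇒#0 (ι 2ᵍ) (trans (*-comm _ _) ½*2)

  conj-½ : conj ½ ≈ ½
  conj-½ = cancelˡ (ι#0 2ᵍ 3 ≡.refl) (begin
    ι 2ᵍ *ᶜ conj ½            ≈⟨ *-comm _ _ ⟩
    conj ½ *ᶜ ι 2ᵍ            ≈⟨ *-congˡ (conj-ι 2ᵍ) ⟨
    conj ½ *ᶜ conj (ι 2ᵍ)     ≈⟨ conj-* ½ (ι 2ᵍ) ⟨
    conj (½ *ᶜ ι 2ᵍ)          ≈⟨ trans (conj-cong ½*2) conj-1 ⟩
    1#                        ≈⟨ trans (*-comm _ _) ½*2 ⟨
    ι 2ᵍ *ᶜ ½                 ∎)

  -- (1 + i) √X has norm 4 on the rows, so that no square root is needed to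
  -- make it unitary.
  √Xᵍ : Bool → Bool → Gauss
  √Xᵍ a b = (1ᵍ +ᵍ iᵍ) *ᵍ √X a b

  √X-gate : Matrix
  √X-gate = ½ • ιᴹ √Xᵍ

  √X-clifford : IsClifford √X-gate
  √X-clifford = gaussian-clifford {√Xᵍ} {4ᵍ} scale conj-½
    (table ≡.refl ≡.refl ≡.refl ≡.refl) (table ≡.refl ≡.refl ≡.refl ≡.refl)
    λ { X → 0 , X , table ≡.refl ≡.refl ≡.refl ≡.refl
      ; Y → 2 , Z , table ≡.refl ≡.refl ≡.refl ≡.refl
      ; Z → 0 , Y , table ≡.refl ≡.refl ≡.refl ≡.refl }
    where
    scale : (½ *ᶜ ½) *ᶜ ι 4ᵍ ≈ 1#
    scale = begin
      (½ *ᶜ ½) *ᶜ ι 4ᵍ             ≈⟨ solve 1 (λ h → (h :* h) :* con 4ᵍ := (h :* con 2ᵍ) :* (h :* con 2ᵍ)) refl ½ ⟩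
      (½ *ᶜ ι 2ᵍ) *ᶜ (½ *ᶜ ι 2ᵍ)   ≈⟨ *-cong ½*2 ½*2 ⟩
      1# *ᶜ 1#                     ≈⟨ *-identityˡ 1# ⟩
      1#                           ∎

  -- Protocols

  pointwise⇒sameRay : ∀ {S : Subset N} {ψ φ : State N} → (∀ B → B ⊆ S → ψ B ≈ φ B) → SameRay S ψ φ
  pointwise⇒sameRay p = 1# , 1#0 , λ B B⊆S → trans (p B B⊆S) (sym (*-identityˡ _))

  -- Two qubit sets occur so that the lemma also covers a measurement, after which `v` is gone.
  sameRay-applyGate : ∀ {S S′ : Subset N} U v {ψ′ ψ : State N} → (∀ {B} b → B ⊆ S′ → B [ v ]≔ b ⊆ S) →
    SameRay S ψ′ ψ → SameRay S′ (applyGate U v ψ′) (applyGate U v ψ)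
  sameRay-applyGate U v sub (x , x#0 , p) = x , x#0 , λ B B⊆S′ → trans
    (+-cong (*-congˡ (p (B [ v ]≔ false) (sub false B⊆S′))) (*-congˡ (p (B [ v ]≔ true) (sub true B⊆S′))))
    (solve 5 (λ x a b p q → a :* (x :* p) :+ b :* (x :* q) := x :* (a :* p :+ b :* q)) refl x _ _ _ _)

  yields-resp : ∀ {T S : Subset N} (p : Protocol T S) {ψ′ ψ φ} → SameRay S ψ′ ψ → Yields p ψ φ → Yields p ψ′ φ
  yields-resp (stop ≡.refl) (x , x#0 , q) (y , y#0 , r) =
    x *ᶜ y , x#0y#0→xy#0 x#0 y#0 , λ B B⊆S → trans (q B B⊆S) (trans (*-congˡ (r B B⊆S)) (sym (*-assoc _ _ _)))
  yields-resp (gate v v∈S U _ p) {ψ′} {ψ} ray y = yields-resp p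
    (sameRay-applyGate U v {ψ′} {ψ} (λ {B} b → ≔-⊆ b B v∈S) ray) y
  yields-resp {S = S} (measure v v∈S a p) {ψ′} {ψ} ray y s nz = yields-resp (p s) after
    (y s λ z → nz λ B B⊆ → trans (proj₂ (proj₂ after) B B⊆) (trans (*-congˡ (z B B⊆)) (zeroʳ _)))
    where
    after : SameRay (S - v) (afterOutcome a s v ψ′) (afterOutcome a s v ψ)
    after = sameRay-applyGate (λ _ b → conj (eigenvector a s b)) v {ψ′} {ψ}
      (λ {B} b B⊆ → ≔-⊆ b B v∈S (λ m → p-x⊆p v (B⊆ m))) ray

  applyGate-diag : ∀ z (v : Fin N) ψ B → applyGate (diag z) v ψ B ≈ phase z (lookup B v) *ᶜ ψ B
  applyGate-diag z v ψ B = go (lookup B v) ≡.refl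
    where
    go : ∀ b → lookup B v ≡ b → (diag z b false *ᶜ ψ (B [ v ]≔ false)) +ᶜ (diag z b true *ᶜ ψ (B [ v ]≔ true))
         ≈ phase z b *ᶜ ψ B
    go false p = begin
      ((1# *ᶜ ι 1ᵍ) *ᶜ ψ (B [ v ]≔ false)) +ᶜ ((1# *ᶜ ι 0ᵍ) *ᶜ ψ (B [ v ]≔ true))
        ≈⟨ solve 3 (λ o x y → (o :* con 1ᵍ) :* x :+ (o :* con 0ᵍ) :* y := o :* (con 1ᵍ :* x)) refl 1# _ _ ⟩
      1# *ᶜ (ι 1ᵍ *ᶜ ψ (B [ v ]≔ false))   ≈⟨ *-identityˡ _ ⟩
      ι 1ᵍ *ᶜ ψ (B [ v ]≔ false)           ≡⟨ ≡.cong (λ B → ι 1ᵍ *ᶜ ψ B) (≡.trans (≡.cong (B [ v ]≔_) (≡.sym p)) ([]≔-lookup B v)) ⟩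
      ι 1ᵍ *ᶜ ψ B                          ∎
    go true p = begin
      ((1# *ᶜ ι 0ᵍ) *ᶜ ψ (B [ v ]≔ false)) +ᶜ ((1# *ᶜ ι z) *ᶜ ψ (B [ v ]≔ true))
        ≈⟨ solve 4 (λ o x y z → (o :* con 0ᵍ) :* x :+ (o :* z) :* y := o :* (z :* y)) refl 1# _ _ (ι z) ⟩
      1# *ᶜ (ι z *ᶜ ψ (B [ v ]≔ true))     ≈⟨ *-identityˡ _ ⟩
      ι z *ᶜ ψ (B [ v ]≔ true)             ≡⟨ ≡.cong (λ B → ι z *ᶜ ψ B) (≡.trans (≡.cong (B [ v ]≔_) (≡.sym p)) ([]≔-lookup B v)) ⟩
      ι z *ᶜ ψ B                           ∎

  module _ {T S : Subset N} (z : Gauss) (clifford : IsClifford (diag z)) (c : Fin N → Bool)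
           (c⇒∈ : ∀ {w} → c w ≡ true → w ∈ S) where

    gateIf : ∀ w b → (b ≡ true → w ∈ S) → Protocol T S → Protocol T S
    gateIf w true  w∈S p = gate w (w∈S ≡.refl) (diag z) clifford p
    gateIf w false w∈S p = p

    gateIf-yields : ∀ w b w∈S p {ψ φ} → Yields p (λ B → phase z (b ∧ lookup B w) *ᶜ ψ B) φ →
                    Yields (gateIf w b w∈S p) ψ φ
    gateIf-yields w true  w∈S p {ψ} = yields-resp p (pointwise⇒sameRay λ B _ → applyGate-diag z w ψ B)
    gateIf-yields w false w∈S p {ψ} = yields-resp p (pointwise⇒sameRay λ B _ → sym (trans (*-congʳ ι-1) (*-identityˡ _)))

    -- Gates are placed along an arbitrary family of vertices, so that the recursion can drop the
    -- first index; the family of interest is the identity.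
    phases : ∀ {M} → (Fin M → Fin N) → Protocol T S → Protocol T S
    phases {zero}  f p = p
    phases {suc M} f p = gateIf (f zero) (c (f zero)) c⇒∈ (phases (f ∘ suc) p)

    phases-yields : ∀ {M} (f : Fin M → Fin N) p {ψ φ} →
      Yields p (λ B → ∏ (λ j → phase z (c (f j) ∧ lookup B (f j))) *ᶜ ψ B) φ → Yields (phases f p) ψ φ
    phases-yields {zero}  f p y = yields-resp p (pointwise⇒sameRay λ B _ → sym (*-identityˡ _)) y
    phases-yields {suc M} f p {ψ} y = gateIf-yields (f zero) (c (f zero)) c⇒∈ (phases (f ∘ suc) p)
      (phases-yields (f ∘ suc) p (yields-resp p
        (pointwise⇒sameRay λ B _ → trans (sym (*-assoc _ _ _)) (*-congʳ (*-comm _ _))) y))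

  graphState-delete : ∀ {S : Subset N} (G : Graph S) v B → B ⊆ S - v → graphState G B ≈ graphState (delete v G) B
  graphState-delete {S = S} G v B B⊆ = graphState-cong {G = G} {H = delete v G} {B = B} same
    where
    same : ∀ u w → adj (induced G B) u w ≡ adj (induced (delete v G) B) u w
    same u w with lookup B u in p | lookup B w in q
    ... | true  | true  rewrite ∈⇒true (B⊆ (true⇒∈ p)) | ∈⇒true (B⊆ (true⇒∈ q)) | Bool.∧-identityʳ (adj G u w) = ≡.sym (Bool.∧-identityʳ _)
    ... | true  | false = ≡.trans (Bool.∧-zeroʳ (adj G u w)) (≡.sym (Bool.∧-zeroʳ (adj G u w ∧ _)))
    ... | false | _     = ≡.trans (Bool.∧-zeroʳ (adj G u w)) (≡.sym (Bool.∧-zeroʳ (adj G u w ∧ _)))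

  module _ {S : Subset N} (G : Graph S) (v : Fin N) where

    private
      after : Sign → State N
      after s = afterOutcome Z s v (graphState G)

      after≈ : ∀ s B → after s B ≈ graphState G (B [ v ]≔ negative s)
      after≈ s B = trans (afterOutcome-bra Z s v (graphState G) B) (applyGate-⟨Z∣ v (negative s) (graphState G) B)

      ≔-trivial : ∀ B → B ⊆ S - v → B [ v ]≔ false ≡ B
      ≔-trivial B B⊆ = ≡.trans (≡.cong (B [ v ]≔_) (≡.sym (∉⇒false (λ m → x∉p-x v (B⊆ m))))) ([]≔-lookup B v)

      after-delete : ∀ B → B ⊆ S - v → graphState G (B [ v ]≔ false) ≈ graphState (delete v G) B
      after-delete B B⊆ = trans (reflexive (≡.cong (graphState G) (≔-trivial B B⊆))) (graphState-delete G v B B⊆)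

    adj⇒∈- : ∀ {w} → adj G v w ≡ true → w ∈ S - v
    adj⇒∈- a = x∈p∧x≢y⇒x∈p-y (adj⇒∈ʳ G a) (λ w≡v → adj⇒≢ G a (≡.sym w≡v))

    measure-delete : ∀ {T : Subset N} (p : Protocol T (S - v)) {φ} → v ∈ S → Yields p (graphState (delete v G)) φ →
      Σ (Protocol T S) λ q → Yields q (graphState G) φ
    measure-delete {T} p {φ} v∈S y = measure v v∈S Z correct , correct-yields
      where
      correct : Sign → Protocol T (S - v)
      correct Sign.+ = p
      correct Sign.- = phases -1ᵍ diag--1-clifford (adj G v) adj⇒∈- id p

      correct-yields : ∀ s → ¬ IsZero (S - v) (after s) → Yields (correct s) (after s) φ
      correct-yields Sign.+ _ = yields-resp p (pointwise⇒sameRay λ B B⊆ → trans (after≈ Sign.+ B) (after-delete B B⊆)) y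
      correct-yields Sign.- _ = phases-yields -1ᵍ diag--1-clifford (adj G v) adj⇒∈- id p
        (yields-resp p (pointwise⇒sameRay λ B B⊆ → begin
          ∏ (λ w → sgn (adj G v w ∧ lookup B w)) *ᶜ after Sign.- B
            ≈⟨ *-cong (∏-sgn (λ w → adj G v w ∧ lookup B w)) (trans (after≈ Sign.- B) (graphState-insert G v B)) ⟩
          sgn (degree G v B) *ᶜ (sgn (degree G v B) *ᶜ graphState G (B [ v ]≔ false))
            ≈⟨ trans (sym (*-assoc _ _ _)) (trans (*-congʳ (sgn² (degree G v B))) (*-identityˡ _)) ⟩
          graphState G (B [ v ]≔ false)
            ≈⟨ after-delete B B⊆ ⟩
          graphState (delete v G) B ∎) y)

    gates-complement : ∀ {T : Subset N} (p : Protocol T S) {φ} → v ∈ S → Yields p (graphState (localComplement v G)) φ →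
      Σ (Protocol T S) λ q → Yields q (graphState G) φ
    gates-complement p v∈S y =
      gate v v∈S √X-gate √X-clifford (phases iᵍ diag-i-clifford (adj G v) (adj⇒∈ʳ G) id p) ,
      phases-yields iᵍ diag-i-clifford (adj G v) (adj⇒∈ʳ G) id p (yields-resp p
        -- `κ` accounts for the normalization of the gate, the other factor `1+i` for
        -- `graphState-localComplement`.
        (κ *ᶜ 1+i , x#0y#0→xy#0 (x#0y#0→xy#0 ½#0 1+i#0) 1+i#0 , λ B _ → begin
          P B *ᶜ applyGate √X-gate v (graphState G) B
            ≈⟨ *-congˡ (scaled B) ⟩
          P B *ᶜ (κ *ᶜ applyGate (ιᴹ √X) v (graphState G) B)
            ≈⟨ solve 3 (λ p κ a → p :* (κ :* a) := κ :* (p :* a)) refl (P B) κ _ ⟩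
          κ *ᶜ (P B *ᶜ applyGate (ιᴹ √X) v (graphState G) B)
            ≈⟨ trans (*-congˡ (graphState-localComplement G v B)) (sym (*-assoc _ _ _)) ⟩
          (κ *ᶜ 1+i) *ᶜ graphState (localComplement v G) B ∎) y)
      where
      κ = ½ *ᶜ 1+i

      1+i#0 : 1+i # 0#
      1+i#0 = ι#0 (1ᵍ +ᵍ iᵍ) 1 ≡.refl

      P : Subset N → Carrier
      P B = ∏ (λ w → phase iᵍ (adj G v w ∧ lookup B w))

      entry : ∀ a b → √X-gate a b ≈ κ *ᶜ ι (√X a b)
      entry a b = trans (*-congˡ (ι-* (1ᵍ +ᵍ iᵍ) (√X a b))) (sym (*-assoc _ _ _))

      scaled : ∀ B → applyGate √X-gate v (graphState G) B ≈ κ *ᶜ applyGate (ιᴹ √X) v (graphState G) B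
      scaled B = trans (+-cong (*-congʳ (entry (lookup B v) false)) (*-congʳ (entry (lookup B v) true)))
        (solve 5 (λ κ a b p q → (κ :* a) :* p :+ (κ :* b) :* q := κ :* (a :* p :+ b :* q)) refl κ _ _ _ _)

  minor⇒canPrepare : ∀ {T S : Subset N} {H : Graph T} {G : Graph S} → H IsVertexMinorOf G → CanPrepare H G
  minor⇒canPrepare {H = H} {G} (equal ≡.refl q) = stop ≡.refl , pointwise⇒sameRay λ B _ →
    graphState-cong {G = G} {H = H} {B = B} (λ u w → ≡.cong (_∧ _) (q u w))
  minor⇒canPrepare {G = G} (deletion v v∈S m) with p , y ← minor⇒canPrepare m = measure-delete G v p v∈S y
  minor⇒canPrepare {G = G} (complement v v∈S m) with p , y ← minor⇒canPrepare m = gates-complement G v p v∈S y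

mainTheorem1 : ∀ {c ℓ₁ ℓ₂} (K : ComplexField c ℓ₁ ℓ₂) {n : ℕ} (G G′ : Graph (⊤ {n})) →
    ∃[ d ] (StateDistance K G G′ d × GraphDistance G G′ d)
mainTheorem1 K G G′ with graphDistance G G′
... | d , (Ĝ , p , p′) , least-d = d ,
  ((Ĝ , minor⇒canPrepare K p , minor⇒canPrepare K p′) ,
   λ j (Ĝ , q , q′) → least-d j (Ĝ , canPrepare⇒minor K (embed j G) Ĝ q , canPrepare⇒minor K (embed j G′) Ĝ q′)) ,
  (Ĝ , p , p′) , least-d
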